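{- Let $n\ge 2$, let $A$ be the adjacency matrix of the path $P_n$, and let $a,b$ be distinct vertices of $P_n$. PST under $A^2$ from $a$ to $b$ occurs if and only if \[ (n;a,b)=(3;1,3),\qquad (n;a,b)=(5;2,4),\qquad\text{or}\qquad (n;a,b)=(7;2,6), \] up to interchanging $a$ and $b$. The corresponding minimum positive transfer times under $A^2$ are respectively $\pi/2$, $\pi/2$, and $\pi/\sqrt2$.
   Context: $P_n$ is the path with vertices $1,2,\ldots,n$, where $i$ and $j$ are adjacent iff $|i-j|=1$. A real symmetric matrix $K$ indexed by a finite vertex set has perfect state transfer (PST) from vertex $a$ to vertex $b$ at time $\tau>0$ (a transfer time) if $\exp(-\mathrm i\tau K)e_a=\gamma e_b$ for some $\gamma\in\mathbb C$ with $|\gamma|=1$, where $e_v$ is the standard basis vector indexed by $v$; PST under $K$ from $a$ to $b$ occurs if this holds for some $\tau>0$. -}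

module Defs where

open import Level using (0ℓ)
open import Algebra.Bundles using (CommutativeRing)
open import Algebra.Bundles.Raw using (RawRing; RawSemiring)
import Algebra.Properties.CommutativeSemigroup as CommutativeSemigroup
import Algebra.Properties.Ring as RingProperties
import Algebra.Definitions.RawSemiring as SemiringDefs
open import Data.Bool.Base using (if_then_else_)
open import Data.Fin.Base using (Fin; toℕ)
import Data.Fin.Properties as Fin
open import Data.Integer.Base using (+_)
open import Data.Nat.Base as ℕ using (ℕ; zero; suc; _⊔_; _!)
import Data.Nat.Properties as ℕ
open import Data.Product.Base using (Σ; ∃-syntax; _×_; _,_)
open import Data.Rational.Base as ℚ using (ℚ; 0ℚ; 1ℚ; ½; ∣_∣; 1/_; _/_)
import Data.Rational.Properties as ℚ
open import Data.Sum.Base using (_⊎_)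
open import Data.Vec.Functional using (Vector)
open import Relation.Binary.PropositionalEquality
  using (_≡_; refl; sym; trans; cong; cong₂; subst)
open import Relation.Nullary.Decidable using (does)
open import Relation.Nullary.Negation using (¬_)

-- A real number is a Cauchy sequence of rationals; equality is _≈ᵣ_, not _≡_.

IsCauchy : (ℕ → ℚ) → Set
IsCauchy s = ∀ ε → 0ℚ ℚ.< ε →
  ∃[ N ] (∀ m n → N ℕ.≤ m → N ℕ.≤ n → ∣ s m ℚ.- s n ∣ ℚ.< ε)

record ℝ : Set where
  constructor mkℝ
  field
    seq    : ℕ → ℚ
    cauchy : IsCauchy seq

open ℝ public

infix 4 _≈ᵣ_ _<ᵣ_ _≤ᵣ_

_≈ᵣ_ : ℝ → ℝ → Set
x ≈ᵣ y = ∀ ε → 0ℚ ℚ.< ε →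
  ∃[ N ] (∀ n → N ℕ.≤ n → ∣ seq x n ℚ.- seq y n ∣ ℚ.< ε)

_<ᵣ_ : ℝ → ℝ → Set
x <ᵣ y = ∃[ δ ] 0ℚ ℚ.< δ ×
  (∃[ N ] (∀ n → N ℕ.≤ n → seq x n ℚ.+ δ ℚ.< seq y n))

_≤ᵣ_ : ℝ → ℝ → Set
x ≤ᵣ y = ¬ (y <ᵣ x)

fromℚ : ℚ → ℝ
fromℚ q = mkℝ (λ _ → q) λ ε 0<ε → 0 , λ _ _ _ _ →
  subst (ℚ._< ε) (sym (cong ∣_∣ (ℚ.+-inverseʳ q))) 0<ε

fromℕ : ℕ → ℝ
fromℕ n = fromℚ (+ n / 1)

private
  open CommutativeSemigroup (CommutativeRing.+-commutativeSemigroup ℚ.+-*-commutativeRing)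
    using (interchange)
  open RingProperties (CommutativeRing.ring ℚ.+-*-commutativeRing)
    using (x[y-z]≈xy-xz)

  split-sub : ∀ p q → p ≡ (p ℚ.- q) ℚ.+ q
  split-sub p q = sym (trans (ℚ.+-assoc p (ℚ.- q) q)
    (trans (cong (p ℚ.+_) (ℚ.+-inverseˡ q)) (ℚ.+-identityʳ p)))

  +-sub-+ : ∀ a b c d → (a ℚ.+ b) ℚ.- (c ℚ.+ d) ≡ (a ℚ.- c) ℚ.+ (b ℚ.- d)
  +-sub-+ a b c d = trans (cong ((a ℚ.+ b) ℚ.+_) (ℚ.neg-distrib-+ c d))
    (interchange a b (ℚ.- c) (ℚ.- d))

  *-sub-* : ∀ a b c d →
    a ℚ.* b ℚ.- c ℚ.* d ≡ a ℚ.* (b ℚ.- d) ℚ.+ d ℚ.* (a ℚ.- c)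
  *-sub-* a b c d = sym (trans (cong₂ ℚ._+_ (x[y-z]≈xy-xz a b d) (x[y-z]≈xy-xz d a c))
    (trans (cong (λ t → (a ℚ.* b ℚ.- a ℚ.* d) ℚ.+ (t ℚ.- d ℚ.* c)) (ℚ.*-comm d a))
    (trans (sym (ℚ.+-assoc (a ℚ.* b ℚ.- a ℚ.* d) (a ℚ.* d) (ℚ.- (d ℚ.* c))))
    (cong₂ (λ t u → t ℚ.- u) (sym (split-sub (a ℚ.* b) (a ℚ.* d))) (ℚ.*-comm d c)))))

  ½ε+½ε : ∀ ε → ½ ℚ.* ε ℚ.+ ½ ℚ.* ε ≡ ε
  ½ε+½ε ε = trans (sym (ℚ.*-distribʳ-+ ε ½ ½)) (ℚ.*-identityˡ ε)

  ½-pos : ∀ {ε} → 0ℚ ℚ.< ε → 0ℚ ℚ.< ½ ℚ.* ε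
  ½-pos {ε} 0<ε = subst (ℚ._< ½ ℚ.* ε) (ℚ.*-zeroʳ ½) (ℚ.*-monoʳ-<-pos ½ 0<ε)

  scaled : ∀ B ε → 0ℚ ℚ.< B → ℚ
  scaled B ε 0<B = 1/_ B {{ℚ.pos⇒nonZero B {{ℚ.positive 0<B}}}} ℚ.* (½ ℚ.* ε)

  scaled-pos : ∀ B ε (0<B : 0ℚ ℚ.< B) → 0ℚ ℚ.< ε → 0ℚ ℚ.< scaled B ε 0<B
  scaled-pos B ε 0<B 0<ε = subst (ℚ._< scaled B ε 0<B) (ℚ.*-zeroʳ r)
    (ℚ.*-monoʳ-<-pos r {{ℚ.1/pos⇒pos B {{ℚ.positive 0<B}}}} (½-pos 0<ε))
    where r = 1/_ B {{ℚ.pos⇒nonZero B {{ℚ.positive 0<B}}}}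

  scaled-* : ∀ B ε (0<B : 0ℚ ℚ.< B) → B ℚ.* scaled B ε 0<B ≡ ½ ℚ.* ε
  scaled-* B ε 0<B = trans (sym (ℚ.*-assoc B r (½ ℚ.* ε)))
    (trans (cong (ℚ._* (½ ℚ.* ε)) (ℚ.*-inverseʳ B {{nz}})) (ℚ.*-identityˡ (½ ℚ.* ε)))
    where
    nz = ℚ.pos⇒nonZero B {{ℚ.positive 0<B}}
    r = 1/_ B {{nz}}

  eventuallyBounded : (x : ℝ) →
    ∃[ B ] 0ℚ ℚ.< B × (∃[ N ] (∀ n → N ℕ.≤ n → ∣ seq x n ∣ ℚ.≤ B))
  eventuallyBounded x with cauchy x 1ℚ (ℚ.positive⁻¹ 1ℚ)
  ... | N , close = B , 0<B , N , bound
    where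
    c = seq x N
    B = 1ℚ ℚ.+ ∣ c ∣
    0<B : 0ℚ ℚ.< B
    0<B = ℚ.+-mono-<-≤ (ℚ.positive⁻¹ 1ℚ) (ℚ.0≤∣p∣ c)
    bound : ∀ n → N ℕ.≤ n → ∣ seq x n ∣ ℚ.≤ B
    bound n N≤n = begin
      ∣ a ∣                    ≡⟨ cong ∣_∣ (split-sub a c) ⟩
      ∣ (a ℚ.- c) ℚ.+ c ∣      ≤⟨ ℚ.∣p+q∣≤∣p∣+∣q∣ (a ℚ.- c) c ⟩
      ∣ a ℚ.- c ∣ ℚ.+ ∣ c ∣    ≤⟨ ℚ.+-monoˡ-≤ ∣ c ∣ (ℚ.<⇒≤ (close n N N≤n ℕ.≤-refl)) ⟩
      B                        ∎
      where
      open ℚ.≤-Reasoning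
      a = seq x n

infixl 6 _+ᵣ_ _-ᵣ_
infixl 7 _*ᵣ_
infix  8 -ᵣ_

_+ᵣ_ : ℝ → ℝ → ℝ
x +ᵣ y = mkℝ (λ n → seq x n ℚ.+ seq y n) cau
  where
  cau : IsCauchy (λ n → seq x n ℚ.+ seq y n)
  cau ε 0<ε with cauchy x (½ ℚ.* ε) (½-pos 0<ε) | cauchy y (½ ℚ.* ε) (½-pos 0<ε)
  ... | N , cx | M , cy = N ⊔ M , λ m n p q →
    let a = seq x m ; b = seq y m ; c = seq x n ; d = seq y n in begin-strict
      ∣ (a ℚ.+ b) ℚ.- (c ℚ.+ d) ∣
        ≡⟨ cong ∣_∣ (+-sub-+ a b c d) ⟩
      ∣ (a ℚ.- c) ℚ.+ (b ℚ.- d) ∣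
        ≤⟨ ℚ.∣p+q∣≤∣p∣+∣q∣ (a ℚ.- c) (b ℚ.- d) ⟩
      ∣ a ℚ.- c ∣ ℚ.+ ∣ b ℚ.- d ∣
        <⟨ ℚ.+-mono-< (cx m n (ℕ.m⊔n≤o⇒m≤o N M p) (ℕ.m⊔n≤o⇒m≤o N M q))
                      (cy m n (ℕ.m⊔n≤o⇒n≤o N M p) (ℕ.m⊔n≤o⇒n≤o N M q)) ⟩
      ½ ℚ.* ε ℚ.+ ½ ℚ.* ε
        ≡⟨ ½ε+½ε ε ⟩
      ε ∎
    where open ℚ.≤-Reasoning

-ᵣ_ : ℝ → ℝ
-ᵣ x = mkℝ (λ n → ℚ.- seq x n) cau
  where
  cau : IsCauchy (λ n → ℚ.- seq x n)
  cau ε 0<ε with cauchy x ε 0<ε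
  ... | N , cx = N , λ m n p q →
    let a = seq x m ; b = seq x n in
    subst (ℚ._< ε)
      (trans (sym (ℚ.∣-p∣≡∣p∣ (a ℚ.- b)))
             (cong ∣_∣ (ℚ.neg-distrib-+ a (ℚ.- b))))
      (cx m n p q)

_-ᵣ_ : ℝ → ℝ → ℝ
x -ᵣ y = x +ᵣ (-ᵣ y)

_*ᵣ_ : ℝ → ℝ → ℝ
x *ᵣ y = mkℝ (λ n → seq x n ℚ.* seq y n) cau
  where
  cau : IsCauchy (λ n → seq x n ℚ.* seq y n)
  cau ε 0<ε with eventuallyBounded x | eventuallyBounded y
  ... | B , 0<B , N₁ , bx | C , 0<C , N₂ , cy
    with cauchy x (scaled C ε 0<C) (scaled-pos C ε 0<C 0<ε)
       | cauchy y (scaled B ε 0<B) (scaled-pos B ε 0<B 0<ε)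
  ... | N₃ , dx | N₄ , dy = N , close
    where
    open ℚ.≤-Reasoning
    N = (N₁ ⊔ N₂) ⊔ (N₃ ⊔ N₄)
    l : ∀ {m} → N ℕ.≤ m → N₁ ⊔ N₂ ℕ.≤ m
    l = ℕ.m⊔n≤o⇒m≤o (N₁ ⊔ N₂) (N₃ ⊔ N₄)
    r : ∀ {m} → N ℕ.≤ m → N₃ ⊔ N₄ ℕ.≤ m
    r = ℕ.m⊔n≤o⇒n≤o (N₁ ⊔ N₂) (N₃ ⊔ N₄)
    small : ∀ D (0<D : 0ℚ ℚ.< D) u v → ∣ u ∣ ℚ.≤ D → ∣ v ∣ ℚ.< scaled D ε 0<D →
            ∣ u ℚ.* v ∣ ℚ.< ½ ℚ.* ε
    small D 0<D u v u≤D v<s = begin-strict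
      ∣ u ℚ.* v ∣          ≡⟨ ℚ.∣p*q∣≡∣p∣*∣q∣ u v ⟩
      ∣ u ∣ ℚ.* ∣ v ∣      ≤⟨ ℚ.*-monoʳ-≤-nonNeg ∣ v ∣ {{ℚ.nonNegative (ℚ.0≤∣p∣ v)}} u≤D ⟩
      D ℚ.* ∣ v ∣          <⟨ ℚ.*-monoʳ-<-pos D {{ℚ.positive 0<D}} v<s ⟩
      D ℚ.* scaled D ε 0<D ≡⟨ scaled-* D ε 0<D ⟩
      ½ ℚ.* ε              ∎
    close : ∀ m n → N ℕ.≤ m → N ℕ.≤ n →
            ∣ seq x m ℚ.* seq y m ℚ.- seq x n ℚ.* seq y n ∣ ℚ.< ε
    close m n p q = begin-strict
      ∣ a ℚ.* b ℚ.- c ℚ.* d ∣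
        ≡⟨ cong ∣_∣ (*-sub-* a b c d) ⟩
      ∣ a ℚ.* (b ℚ.- d) ℚ.+ d ℚ.* (a ℚ.- c) ∣
        ≤⟨ ℚ.∣p+q∣≤∣p∣+∣q∣ (a ℚ.* (b ℚ.- d)) (d ℚ.* (a ℚ.- c)) ⟩
      ∣ a ℚ.* (b ℚ.- d) ∣ ℚ.+ ∣ d ℚ.* (a ℚ.- c) ∣
        <⟨ ℚ.+-mono-<
             (small B 0<B a (b ℚ.- d) (bx m (ℕ.m⊔n≤o⇒m≤o N₁ N₂ (l p)))
               (dy m n (ℕ.m⊔n≤o⇒n≤o N₃ N₄ (r p)) (ℕ.m⊔n≤o⇒n≤o N₃ N₄ (r q))))
             (small C 0<C d (a ℚ.- c) (cy n (ℕ.m⊔n≤o⇒n≤o N₁ N₂ (l q)))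
               (dx m n (ℕ.m⊔n≤o⇒m≤o N₃ N₄ (r p)) (ℕ.m⊔n≤o⇒m≤o N₃ N₄ (r q)))) ⟩
      ½ ℚ.* ε ℚ.+ ½ ℚ.* ε
        ≡⟨ ½ε+½ε ε ⟩
      ε ∎
      where
      a = seq x m
      b = seq y m
      c = seq x n
      d = seq y n

ℝ-rawRing : RawRing 0ℓ 0ℓ
ℝ-rawRing = record
  { Carrier = ℝ
  ; _≈_     = _≈ᵣ_
  ; _+_     = _+ᵣ_
  ; _*_     = _*ᵣ_
  ; -_      = -ᵣ_
  ; 0#      = fromℕ 0
  ; 1#      = fromℕ 1
  }

open SemiringDefs (RawRing.rawSemiring ℝ-rawRing) public
  using () renaming (sum to sumᵣ; _^_ to _^ᵣ_)

IsSqrt : ℝ → ℝ → Set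
IsSqrt x r = fromℕ 0 ≤ᵣ r × r *ᵣ r ≈ᵣ x

-- For y ≉ 0 this says q = x / y.
IsQuotient : ℝ → ℝ → ℝ → Set
IsQuotient x y q = q *ᵣ y ≈ᵣ x

IsLeast : (ℝ → Set) → ℝ → Set
IsLeast P t = P t × (∀ s → P s → t ≤ᵣ s)

_HasLimit_ : (ℕ → ℝ) → ℝ → Set
s HasLimit l = ∀ ε → 0ℚ ℚ.< ε → ∃[ N ] (∀ n → N ℕ.≤ n →
  (s n -ᵣ l <ᵣ fromℚ ε) × (l -ᵣ s n <ᵣ fromℚ ε))

inverseFactorial : ℕ → ℝ
inverseFactorial k = fromℚ ((+ 1 / (k !)) {{k ℕ.!≢0}})

-- sin x = s, by the power series Σₖ (-1)ᵏ x²ᵏ⁺¹ / (2k+1)!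
IsSin : ℝ → ℝ → Set
IsSin x s = (λ N → sumᵣ {N} (λ k → term (toℕ k))) HasLimit s
  where
  term : ℕ → ℝ
  term k = ((-ᵣ fromℕ 1) ^ᵣ k) *ᵣ (inverseFactorial (2 ℕ.* k ℕ.+ 1) *ᵣ (x ^ᵣ (2 ℕ.* k ℕ.+ 1)))

IsPi : ℝ → Set
IsPi = IsLeast (λ x → fromℕ 0 <ᵣ x × IsSin x (fromℕ 0))

record ℂ : Set where
  constructor _+i_
  field
    re im : ℝ

open ℂ public

ofℝ : ℝ → ℂ
ofℝ x = x +i fromℕ 0

𝕚 : ℂ
𝕚 = fromℕ 0 +i fromℕ 1

ℂ-rawRing : RawRing 0ℓ 0ℓ
ℂ-rawRing = record
  { Carrier = ℂ
  ; _≈_     = λ z w → re z ≈ᵣ re w × im z ≈ᵣ im w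
  ; _+_     = λ z w → (re z +ᵣ re w) +i (im z +ᵣ im w)
  ; _*_     = λ z w → (re z *ᵣ re w -ᵣ im z *ᵣ im w) +i (re z *ᵣ im w +ᵣ im z *ᵣ re w)
  ; -_      = λ z → (-ᵣ re z) +i (-ᵣ im z)
  ; 0#      = ofℝ (fromℕ 0)
  ; 1#      = ofℝ (fromℕ 1)
  }

open RawRing ℂ-rawRing public using ()
  renaming (_≈_ to _≈ᶜ_; _+_ to _+ᶜ_; _*_ to _*ᶜ_; -_ to -ᶜ_)

open SemiringDefs (RawRing.rawSemiring ℂ-rawRing) public
  using () renaming (sum to sumᶜ)

HasModulus : ℂ → ℝ → Set
HasModulus z r = IsSqrt (re z *ᵣ re z +ᵣ im z *ᵣ im z) r

module Matrices (R : RawSemiring 0ℓ 0ℓ) where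
  open RawSemiring R
  open SemiringDefs R using (sum)

  Matrix : ℕ → Set
  Matrix n = Fin n → Fin n → Carrier

  basis : ∀ {n} → Fin n → Vector Carrier n
  basis v j = if does (j Fin.≟ v) then 1# else 0#

  infixl 7 _⊗_ _⊗ᵛ_
  infixr 8 _^ᴹ_

  _⊗_ : ∀ {n} → Matrix n → Matrix n → Matrix n
  (X ⊗ Y) i j = sum (λ k → X i k * Y k j)

  _⊗ᵛ_ : ∀ {n} → Matrix n → Vector Carrier n → Vector Carrier n
  (X ⊗ᵛ v) i = sum (λ k → X i k * v k)

  _^ᴹ_ : ∀ {n} → Matrix n → ℕ → Matrix n
  X ^ᴹ zero  = λ i j → basis j i
  X ^ᴹ suc k = X ⊗ (X ^ᴹ k)

module Matrixᵣ = Matrices (RawRing.rawSemiring ℝ-rawRing)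
module Matrixᶜ = Matrices (RawRing.rawSemiring ℂ-rawRing)

-- E = exp X: the partial sums of Σₖ Xᵏ / k! converge entrywise to E.
IsExp : ∀ {n} → Matrixᶜ.Matrix n → Matrixᶜ.Matrix n → Set
IsExp X E = ∀ i j →
  ((λ N → re (partial N i j)) HasLimit re (E i j)) ×
  ((λ N → im (partial N i j)) HasLimit im (E i j))
  where
  partial : ℕ → Matrixᶜ.Matrix _
  partial N i j = sumᶜ {N} (λ k →
    ofℝ (inverseFactorial (toℕ k)) *ᶜ (X Matrixᶜ.^ᴹ toℕ k) i j)

-- The matrix -iτK.
generator : ∀ {n} → ℝ → Matrixᵣ.Matrix n → Matrixᶜ.Matrix n
generator τ K i j = -ᶜ (𝕚 *ᶜ ofℝ τ) *ᶜ ofℝ (K i j)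

-- exp is a relation here; the exponential series always converges, so asking
-- for some E with E = exp (-iτK) is only a way to name exp (-iτK).
PSTAt : ∀ {n} → Matrixᵣ.Matrix n → Fin n → Fin n → ℝ → Set
PSTAt {n} K a b τ = fromℕ 0 <ᵣ τ ×
  (Σ (Matrixᶜ.Matrix n) λ E → IsExp (generator τ K) E ×
    (∃[ γ ] HasModulus γ (fromℕ 1) ×
      (∀ j → (E Matrixᶜ.⊗ᵛ Matrixᶜ.basis a) j ≈ᶜ γ *ᶜ Matrixᶜ.basis b j)))

PST : ∀ {n} → Matrixᵣ.Matrix n → Fin n → Fin n → Set
PST K a b = ∃[ τ ] PSTAt K a b τ

-- The vertices of Pₙ are 1, …, n, whereas Fin n starts at 0.
label : ∀ {n} → Fin n → ℕ
label i = suc (toℕ i)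

pathAdjacency : ∀ n → Matrixᵣ.Matrix n
pathAdjacency n i j =
  if does (ℕ.∣ label i - label j ∣ ℕ.≟ 1) then fromℕ 1 else fromℕ 0

pathAdjacency² : ∀ n → Matrixᵣ.Matrix n
pathAdjacency² n = pathAdjacency n Matrixᵣ.^ᴹ 2

IsTriple : ℕ → ℕ → ℕ → (n : ℕ) → Fin n → Fin n → Set
IsTriple N p q n a b = n ≡ N ×
  ((label a ≡ p × label b ≡ q) ⊎ (label a ≡ q × label b ≡ p))

-- The least transfer time from a to b under K exists and is x / y.
LeastTimeIsQuotient : ∀ {n} → Matrixᵣ.Matrix n → Fin n → Fin n → ℝ → ℝ → Set
LeastTimeIsQuotient K a b x y =
  ∃[ τ ] IsLeast (PSTAt K a b) τ × IsQuotient x y τ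

-- Put m = n + 1.  The vectors j ↦ sin (kπj/m) are eigenvectors of A² for the eigenvalues θₖ = 2 + 2 cos (2πk/m), and
-- pairing a transfer exp (-iτA²) eₐ = γ e_b with them gives exp (-iτθₖ) sin (kπa/m) = γ sin (kπb/m).  Taking squared
-- moduli for k = 1 gives a + b = m, so that sin (kπb/m) = (-1)ᵏ⁺¹ sin (kπa/m); since θ₁ = θₙ, m is even.  Whenever m
-- divides neither ka nor la, τ (θₖ - θₗ) is therefore a multiple of π, and the relations
-- (θₖ - θₗ) x = (θₖ₋₁ - θₗ₋₁) + (θₖ₊₁ - θₗ₊₁) make x = 2 cos (2π/m) rational.  Chebyshev recursion up to index m/2,
-- where 2 cos (2πk/m) = -2, makes x an integer, so m divides 4 or 6; the vanishing of a difference θₖ - θₗ leads to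
-- m = 8.  Conversely, for m = 4, 6, 8 two explicit eigenvectors, symmetric and antisymmetric, with eigenvalues θ and
-- θ′ force sin (τ (θ - θ′)) = 0 and hence τ ≥ π / (θ - θ′), and at this τ the symmetric and the antisymmetric part of
-- eₐ acquire opposite phases.
--
-- π/2 is obtained as the limit of x ↦ x + cos x, so that π comes from the power series alone.  The argument uses only
-- that the reals form a complete Archimedean ordered ring in the constructive sense; it is carried out over an
-- arbitrary such ring, since in the Cauchy reals conversion would compare proofs of the Cauchy property.

module Submission where

open import Defs using (module Matrices; label)
open import Level using (0ℓ)
open import Algebra.Bundles using (CommutativeRing; RawRing; RawSemiring)
import Algebra.Definitions.RawSemiring as SemiringDefinitions
import Algebra.Properties.Ring as RingProperties
import Algebra.Properties.Semiring.Sum as SemiringSum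
import Algebra.Solver.Ring as RingSolver
open import Algebra.Solver.Ring.AlmostCommutativeRing using (fromCommutativeRing; _-Raw-AlmostCommutative⟶_)
open import Data.Bool.Base using (Bool; true; false; if_then_else_)
open import Data.Empty using (⊥; ⊥-elim)
open import Data.Fin.Base as Fin using (Fin; zero; suc; toℕ)
import Data.Fin.Properties as Fin
open import Data.Integer.Base as ℤ using (ℤ; +_; -[1+_])
import Data.Integer.Properties as ℤ
import Data.Integer.Tactic.RingSolver as ℤ-Solver
open import Data.List.Base as List using (List; []; _∷_)
open import Data.Maybe.Base using (Maybe; just; nothing)
open import Data.Nat.Base as ℕ using (ℕ; zero; suc; _!)
import Data.Nat.Coprimality as Coprimality
open import Data.Nat.Divisibility as ℕ using (_∣_; divides; _∣?_; ∣-refl; ∣1⇒≡1; ∣m⇒∣m*n; ∣m+n∣m⇒∣n; ∣⇒≤)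
import Data.Nat.Properties as ℕ
open import Data.Nat.Tactic.RingSolver using (solve-∀)
open import Data.Product.Base using (Σ; ∃-syntax; _×_; _,_; proj₁; proj₂)
import Data.Product.Properties as Product
open import Data.Rational.Base as ℚ using (ℚ; 0ℚ; 1ℚ; ½; -½; mkℚ; _/_)
import Data.Rational.Properties as ℚ
import Data.Rational.Solver as ℚ-Solver
import Data.Rational.Unnormalised.Base as ℚᵘ
import Data.Rational.Unnormalised.Properties as ℚᵘ
open import Data.Sum.Base using (_⊎_; inj₁; inj₂)
open import Function.Base using (_∘_)
open import Function.Bundles using (_⇔_; mk⇔)
open import Relation.Binary.Definitions using (tri<; tri≈; tri>)
open import Relation.Binary.PropositionalEquality as ≡ using (_≡_; _≢_)
open import Relation.Nullary.Decidable using (Dec; yes; no; does; True; toWitness; from-yes; from-no; decidable-stable; _×-dec_; _⊎-dec_)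
open import Relation.Nullary.Negation using (¬_)

-- The order of the constructive reals is undecidable, and a zero of the sine is an integer multiple
-- of π only up to double negation. So the classification is proved as `¬ ¬ Exceptional`, with free
-- case distinctions inside, and the double negation is removed at the end because `Exceptional` is
-- a decidable statement about natural numbers.
--
-- A difference of eigenvalues can be used only for indices k with m ∤ ka, and x becomes rational
-- only if the difference multiplying it is nonzero. As m ∤ a and m ∤ 2a always hold, the cases are
-- m ∣ 3a, m ∣ 4a and neither. In the last one the indices 1 to 4 serve, and the alternating phases
-- keep the difference away from 0. For m ∣ 3a the pair 2, 4 is multiplied by x, for m ∣ 4a the pair
-- 2, 6: the forbidden index then drops out. These differences may vanish; each is a multiple of a
-- product of two sines, which leads to m ∣ 6 or m ∣ 8.
--
-- An integer x satisfies |x| ≤ 2, and x = 0, ±1, ±2 mean m ∣ 4, m ∣ 6, m ∣ 2.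
--
-- The eigenvectors for m = 4, 6, 8 are checked by evaluation in ℚ(√2), where equality is decidable.

-- Axioms for the real line.

record RealLine : Set₁ where
  infix 4 _<_
  field
    commutativeRing : CommutativeRing 0ℓ 0ℓ
  open CommutativeRing commutativeRing public renaming (zero to *-zero)
  field
    _<_           : Carrier → Carrier → Set
    fromℚ         : ℚ → Carrier
    <-irrefl      : ∀ {x y} → x ≈ y → ¬ x < y
    <-asym        : ∀ {x y} → x < y → ¬ y < x
    <-cotrans     : ∀ {x y} → x < y → ∀ z → x < z ⊎ z < y
    <-tight       : ∀ {x y} → ¬ x < y → ¬ y < x → x ≈ y
    +-monoˡ-<     : ∀ z {x y} → x < y → x + z < y + z
    *-pos         : ∀ {x y} → 0# < x → 0# < y → 0# < x * y
    fromℚ-+       : ∀ p q → fromℚ (p ℚ.+ q) ≈ fromℚ p + fromℚ q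
    fromℚ-*       : ∀ p q → fromℚ (p ℚ.* q) ≈ fromℚ p * fromℚ q
    fromℚ-0       : fromℚ 0ℚ ≈ 0#
    fromℚ-1       : fromℚ 1ℚ ≈ 1#
    fromℚ-mono-<  : ∀ {p q} → p ℚ.< q → fromℚ p < fromℚ q
    archimedean   : ∀ x → ∃[ n ] x < fromℚ (+ n / 1)
    -- Puts a rational below every positive real, which connects the order with the rational
    -- tolerances of `HasLimit`.
    <-gap         : ∀ {x y} → x < y → ∃[ δ ] 0ℚ ℚ.< δ × x + fromℚ δ < y

  HasLimit : (ℕ → Carrier) → Carrier → Set
  HasLimit s l = ∀ ε → 0ℚ ℚ.< ε → ∃[ N ] (∀ n → N ℕ.≤ n →
    (s n - l < fromℚ ε) × (l - s n < fromℚ ε))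

  field
    complete : ∀ s →
      (∀ ε → 0ℚ ℚ.< ε → ∃[ N ] (∀ m n → N ℕ.≤ m → N ℕ.≤ n → s m - s n < fromℚ ε)) →
      ∃[ l ] HasLimit s l

-- Integers among the rationals, and coprimality.

/1≡mkℚ : ∀ z → z / 1 ≡ mkℚ z 0 (Coprimality.sym (Coprimality.1-coprimeTo ℤ.∣ z ∣))
/1≡mkℚ z = ℚ.↥p/↧p≡p (mkℚ z 0 _)

/1-+ : ∀ a b → (a ℤ.+ b) / 1 ≡ a / 1 ℚ.+ b / 1
/1-+ a b rewrite /1≡mkℚ a | /1≡mkℚ b = ≡.sym (≡.cong₂ (λ x y → (x ℤ.+ y) / 1) (ℤ.*-identityʳ a) (ℤ.*-identityʳ b))

/1-* : ∀ a b → (a ℤ.* b) / 1 ≡ (a / 1) ℚ.* (b / 1)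
/1-* a b rewrite /1≡mkℚ a | /1≡mkℚ b = ≡.refl

/1-neg : ∀ a → (ℤ.- a) / 1 ≡ ℚ.- (a / 1)
/1-neg a = ≡.trans (/1≡mkℚ (ℤ.- a)) (≡.trans (lemma a) (≡.cong ℚ.-_ (≡.sym (/1≡mkℚ a))))
  where
  lemma : ∀ a → mkℚ (ℤ.- a) 0 (Coprimality.sym (Coprimality.1-coprimeTo ℤ.∣ ℤ.- a ∣)) ≡ ℚ.- mkℚ a 0 (Coprimality.sym (Coprimality.1-coprimeTo ℤ.∣ a ∣))
  lemma (+ zero)  = ≡.refl
  lemma (+ suc n) = ≡.refl
  lemma -[1+ n ]  = ≡.refl

/1-mono-≤ : ∀ {a b} → a ℤ.≤ b → a / 1 ℚ.≤ b / 1
/1-mono-≤ {a} {b} a≤b rewrite /1≡mkℚ a | /1≡mkℚ b = ℚ.*≤* (ℤ.*-monoʳ-≤-nonNeg (+ 1) a≤b)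

/1-injective : ∀ {a b} → a / 1 ≡ b / 1 → a ≡ b
/1-injective {a} {b} eq = proj₁ (ℚ.mkℚ-injective (≡.trans (≡.sym (/1≡mkℚ a)) (≡.trans eq (/1≡mkℚ b))))

reciprocal : ∀ d .{{_ : ℕ.NonZero d}} → (+ d / 1) ℚ.* (+ 1 / d) ≡ 1ℚ
reciprocal (suc d) = ≡.trans (≡.cong₂ ℚ._*_ (/1≡mkℚ (+ suc d)) (ℚ.↥p/↧p≡p (mkℚ (+ 1) d (Coprimality.1-coprimeTo (suc d)))))
  (ℚ.*-inverseʳ (mkℚ (+ suc d) 0 (Coprimality.sym (Coprimality.1-coprimeTo (suc d)))))

↧*q≡↥ : ∀ q → (ℚ.↧ q / 1) ℚ.* q ≡ ℚ.↥ q / 1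
↧*q≡↥ q@(mkℚ n d c) rewrite /1≡mkℚ (+ suc d) | /1≡mkℚ n = ℚ.toℚᵘ-injective (ℚᵘ.≃-trans (ℚ.toℚᵘ-homo-* (mkℚ (+ suc d) 0 (Coprimality.sym (Coprimality.1-coprimeTo (suc d)))) q)
  (ℚᵘ.*≡* (identity (+ suc d) n)))
  where
  identity : ∀ d n → (d ℤ.* n) ℤ.* + 1 ≡ n ℤ.* (+ 1 ℤ.* d)
  identity = ℤ-Solver.solve-∀

-- Coprimality cancels the factors n of the power one at a time, leaving d ∣ 1.
coprime-∣-power : ∀ {d} n k → Coprimality.Coprime d ℤ.∣ n ∣ → d ∣ ℤ.∣ n ℤ.^ k ∣ → d ≡ 1
coprime-∣-power n zero    _  d∣1 = ∣1⇒≡1 d∣1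
coprime-∣-power n (suc k) cop d∣nᵏ = coprime-∣-power n k cop
  (Coprimality.coprime-divisor cop (≡.subst (_ ∣_) (ℤ.abs-* n (n ℤ.^ k)) d∣nᵏ))

-- The exceptional triples and their arithmetic.

Triple : ℕ → ℕ → ℕ → ℕ → ℕ → ℕ → Set
Triple N p q n a b = n ≡ N × ((a ≡ p × b ≡ q) ⊎ (a ≡ q × b ≡ p))

-- Phrased with natural numbers and hence decidable; at the labels of two vertices it unfolds to the
-- disjunction of the three `IsTriple`s.
Exceptional : ℕ → ℕ → ℕ → Set
Exceptional n a b = Triple 3 1 3 n a b ⊎ Triple 5 2 4 n a b ⊎ Triple 7 2 6 n a b

∣4⇒≡4 : ∀ {m} → 4 ℕ.≤ m → m ∣ 4 → m ≡ 4
∣4⇒≡4 4≤m m∣4 = ℕ.≤-antisym (∣⇒≤ m∣4) 4≤m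

∣6⇒≡6 : ∀ {m} → 4 ℕ.≤ m → m ∣ 6 → m ≡ 6
∣6⇒≡6 4≤m m∣6 = case (∣⇒≤ m∣6) 4≤m m∣6
  where
  case : ∀ {m} → m ℕ.≤ 6 → 4 ℕ.≤ m → m ∣ 6 → m ≡ 6
  case {4} _ _ p = ⊥-elim (from-no (4 ∣? 6) p)
  case {5} _ _ p = ⊥-elim (from-no (5 ∣? 6) p)
  case {6} _ _ p = ≡.refl
  case {suc (suc (suc (suc (suc (suc (suc _))))))} (ℕ.s≤s (ℕ.s≤s (ℕ.s≤s (ℕ.s≤s (ℕ.s≤s (ℕ.s≤s ())))))) _ _
  case {1} _ (ℕ.s≤s ()) _
  case {2} _ (ℕ.s≤s (ℕ.s≤s ())) _
  case {3} _ (ℕ.s≤s (ℕ.s≤s (ℕ.s≤s ()))) _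

∣8⇒≡4⊎≡8 : ∀ {m} → 4 ℕ.≤ m → m ∣ 8 → m ≡ 4 ⊎ m ≡ 8
∣8⇒≡4⊎≡8 4≤m m∣8 = case (∣⇒≤ m∣8) 4≤m m∣8
  where
  case : ∀ {m} → m ℕ.≤ 8 → 4 ℕ.≤ m → m ∣ 8 → m ≡ 4 ⊎ m ≡ 8
  case {4} _ _ p = inj₁ ≡.refl
  case {5} _ _ p = ⊥-elim (from-no (5 ∣? 8) p)
  case {6} _ _ p = ⊥-elim (from-no (6 ∣? 8) p)
  case {7} _ _ p = ⊥-elim (from-no (7 ∣? 8) p)
  case {8} _ _ p = inj₂ ≡.refl
  case {suc (suc (suc (suc (suc (suc (suc (suc (suc _))))))))} (ℕ.s≤s (ℕ.s≤s (ℕ.s≤s (ℕ.s≤s (ℕ.s≤s (ℕ.s≤s (ℕ.s≤s (ℕ.s≤s ())))))))) _ _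
  case {1} _ (ℕ.s≤s ()) _
  case {2} _ (ℕ.s≤s (ℕ.s≤s ())) _
  case {3} _ (ℕ.s≤s (ℕ.s≤s (ℕ.s≤s ()))) _

overshoot : ∀ k a b → 0 ℕ.< b → ¬ k ℕ.+ a ℕ.+ b ≡ k
overshoot k a b 0<b eq = ℕ.<-irrefl (≡.sym eq) (ℕ.≤-<-trans (ℕ.m≤m+n k a) (ℕ.m<m+n (k ℕ.+ a) 0<b))

vertices-4 : ∀ a b → 0 ℕ.< a → 0 ℕ.< b → a ≢ b → a ℕ.+ b ≡ 4 → Exceptional 3 a b
vertices-4 1 _ _ _ _ ≡.refl = inj₁ (≡.refl , inj₁ (≡.refl , ≡.refl))
vertices-4 2 _ _ _ a≢b ≡.refl = ⊥-elim (a≢b ≡.refl)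
vertices-4 3 _ _ _ _ ≡.refl = inj₁ (≡.refl , inj₂ (≡.refl , ≡.refl))
vertices-4 (suc (suc (suc (suc a)))) b _ 0<b _ eq = ⊥-elim (overshoot 4 a b 0<b eq)

-- The pair 1, 5 also adds up to 6; the divisibility excludes it.
vertices-6 : ∀ a b → 0 ℕ.< a → 0 ℕ.< b → a ≢ b → a ℕ.+ b ≡ 6 → 6 ∣ 3 ℕ.* a ⊎ 6 ∣ 4 ℕ.* a → Exceptional 5 a b
vertices-6 1 _ _ _ _ ≡.refl (inj₁ p) = ⊥-elim (from-no (6 ∣? 3) p)
vertices-6 1 _ _ _ _ ≡.refl (inj₂ p) = ⊥-elim (from-no (6 ∣? 4) p)
vertices-6 2 _ _ _ _ ≡.refl _ = inj₂ (inj₁ (≡.refl , inj₁ (≡.refl , ≡.refl)))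
vertices-6 3 _ _ _ a≢b ≡.refl _ = ⊥-elim (a≢b ≡.refl)
vertices-6 4 _ _ _ _ ≡.refl _ = inj₂ (inj₁ (≡.refl , inj₂ (≡.refl , ≡.refl)))
vertices-6 5 _ _ _ _ ≡.refl (inj₁ p) = ⊥-elim (from-no (6 ∣? 15) p)
vertices-6 5 _ _ _ _ ≡.refl (inj₂ p) = ⊥-elim (from-no (6 ∣? 20) p)
vertices-6 (suc (suc (suc (suc (suc (suc a)))))) b _ 0<b _ eq _ = ⊥-elim (overshoot 6 a b 0<b eq)

-- 8 ∣ 4a forces a to be even, and a = 4 would give a = b.
vertices-8 : ∀ a b → 0 ℕ.< a → 0 ℕ.< b → a ≢ b → a ℕ.+ b ≡ 8 → 8 ∣ 4 ℕ.* a → Exceptional 7 a b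
vertices-8 1 _ _ _ _ ≡.refl p = ⊥-elim (from-no (8 ∣? 4) p)
vertices-8 2 _ _ _ _ ≡.refl _ = inj₂ (inj₂ (≡.refl , inj₁ (≡.refl , ≡.refl)))
vertices-8 3 _ _ _ _ ≡.refl p = ⊥-elim (from-no (8 ∣? 12) p)
vertices-8 4 _ _ _ a≢b ≡.refl _ = ⊥-elim (a≢b ≡.refl)
vertices-8 5 _ _ _ _ ≡.refl p = ⊥-elim (from-no (8 ∣? 20) p)
vertices-8 6 _ _ _ _ ≡.refl _ = inj₂ (inj₂ (≡.refl , inj₂ (≡.refl , ≡.refl)))
vertices-8 7 _ _ _ _ ≡.refl p = ⊥-elim (from-no (8 ∣? 28) p)
vertices-8 (suc (suc (suc (suc (suc (suc (suc (suc a)))))))) b _ 0<b _ eq _ = ⊥-elim (overshoot 8 a b 0<b eq)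

even-or-odd : ∀ k → (∃[ h ] k ≡ 2 ℕ.* h) ⊎ (∃[ h ] k ≡ suc (2 ℕ.* h))
even-or-odd zero    = inj₁ (0 , ≡.refl)
even-or-odd (suc k) with even-or-odd k
... | inj₁ (h , eq) = inj₂ (h , ≡.cong suc eq)
... | inj₂ (h , eq) = inj₁ (suc h , ≡.trans (≡.cong suc eq) (≡.sym (ℕ.*-suc 2 h)))

-- Decidable eigenvector equations over ℚ(√2).

-- The pair (p , q) stands for p + q √2.
ℚ[√2] : Set
ℚ[√2] = ℚ × ℚ

infix 4 _≟√2_
infixl 6 _⊞_
infixl 7 _⊠_

_⊞_ _⊠_ : ℚ[√2] → ℚ[√2] → ℚ[√2]
(p , q) ⊞ (p′ , q′) = p ℚ.+ p′ , q ℚ.+ q′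
(p , q) ⊠ (p′ , q′) = p ℚ.* p′ ℚ.+ (+ 2 / 1) ℚ.* (q ℚ.* q′) , p ℚ.* q′ ℚ.+ q ℚ.* p′

𝟘 𝟙 : ℚ[√2]
𝟘 = 0ℚ , 0ℚ
𝟙 = 1ℚ , 0ℚ

_≟√2_ : (x y : ℚ[√2]) → Dec (x ≡ y)
_≟√2_ = Product.≡-dec ℚ._≟_ ℚ._≟_

-- Lists are continued by 𝟘, so trailing zeros, including the boundary value at n + 1, may be left
-- out, and `[]` is the zero vector.
entry : List ℚ[√2] → ℕ → ℚ[√2]
entry []       _       = 𝟘
entry (x ∷ _)  zero    = x
entry (_ ∷ xs) (suc k) = entry xs k

rationals : List ℚ → List ℚ[√2]
rationals = List.map (λ q → q , 0ℚ)

-- A u = v and A v = θ u on the path with vertices 1, …, n, for lists that begin with the position 0 outside the path.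
IsPathEigenvector : ℕ → ℚ[√2] → List ℚ[√2] → List ℚ[√2] → Set
IsPathEigenvector n θ u v =
  (entry u 0 ≡ 𝟘 × entry u (suc n) ≡ 𝟘) × (entry v 0 ≡ 𝟘 × entry v (suc n) ≡ 𝟘) ×
  (∀ (j : Fin n) → entry u (toℕ j) ⊞ entry u (2 ℕ.+ toℕ j) ≡ entry v (label j)) ×
  (∀ (j : Fin n) → entry v (toℕ j) ⊞ entry v (2 ℕ.+ toℕ j) ≡ θ ⊠ entry u (label j))

-- Equality of reals cannot be decided, equality of pairs of rationals can: concrete eigenvectors
-- are verified by running this procedure and then carried over to the reals.
isPathEigenvector? : ∀ n θ u v → Dec (IsPathEigenvector n θ u v)
isPathEigenvector? n θ u v =
  ((entry u 0 ≟√2 𝟘) ×-dec (entry u (suc n) ≟√2 𝟘)) ×-dec ((entry v 0 ≟√2 𝟘) ×-dec (entry v (suc n) ≟√2 𝟘)) ×-dec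
  (Fin.all? (λ j → entry u (toℕ j) ⊞ entry u (2 ℕ.+ toℕ j) ≟√2 entry v (label j)) ×-dec
   Fin.all? (λ j → entry v (toℕ j) ⊞ entry v (2 ℕ.+ toℕ j) ≟√2 (θ ⊠ entry u (label j))))

Sums : ∀ n → (Fin n → ℚ[√2]) → (Fin n → ℚ[√2]) → (Fin n → ℚ[√2]) → Set
Sums n u v w = ∀ (j : Fin n) → u j ⊞ v j ≡ w j

sums? : ∀ n u v w → Dec (Sums n u v w)
sums? n u v w = Fin.all? (λ j → (u j ⊞ v j) ≟√2 w j)

basis[√2] : ∀ {n} → Fin n → Fin n → ℚ[√2]
basis[√2] a j = if does (j Fin.≟ a) then 𝟙 else 𝟘

neg : ℚ[√2] → ℚ[√2]
neg (p , q) = ℚ.- p , ℚ.- q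

¼ : ℚ
¼ = + 1 / 4

triple? : ∀ N p q n a b → Dec (Triple N p q n a b)
triple? N p q n a b = (n ℕ.≟ N) ×-dec (((a ℕ.≟ p) ×-dec (b ℕ.≟ q)) ⊎-dec ((a ℕ.≟ q) ×-dec (b ℕ.≟ p)))

exceptional? : ∀ n a b → Dec (Exceptional n a b)
exceptional? n a b = triple? 3 1 3 n a b ⊎-dec (triple? 5 2 4 n a b ⊎-dec triple? 7 2 6 n a b)

-- Order and absolute value without decidability.

module Analysis (𝓡 : RealLine) where
  open RealLine 𝓡 public
    renaming (refl to ≈-refl; sym to ≈-sym; trans to ≈-trans; reflexive to ≈-reflexive)
  open RingProperties (CommutativeRing.ring commutativeRing) public
    using (-‿involutive; -‿distribˡ-*; -‿distribʳ-*; -0#≈0#; -‿+-comm; +-cancelˡ)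
  open SemiringDefinitions (RawRing.rawSemiring rawRing) public using (sum; _^_)

  infix 4 _≤_
  -- A negation, hence stable under double negation and open to proofs by undecidable case
  -- distinctions.
  _≤_ : Carrier → Carrier → Set
  x ≤ y = ¬ y < x

  fromℕ : ℕ → Carrier
  fromℕ n = fromℚ (+ n / 1)

  fromℚ-neg : ∀ p → fromℚ (ℚ.- p) ≈ - fromℚ p
  fromℚ-neg p = +-cancelˡ (fromℚ p) _ _ (≈-trans (≈-sym (fromℚ-+ p (ℚ.- p)))
    (≈-trans (≈-reflexive (≡.cong fromℚ (ℚ.+-inverseʳ p)))
    (≈-trans fromℚ-0 (≈-sym (-‿inverseʳ _)))))

  -- Coefficients 0 and 1 are interpreted by 0# and 1# themselves, so that solver goals may mention these.
  coefficient : ℚ → Carrier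
  coefficient (mkℚ (+ 0) zero _) = 0#
  coefficient (mkℚ (+ 1) zero _) = 1#
  coefficient q                  = fromℚ q

  coefficient≈ : ∀ q → coefficient q ≈ fromℚ q
  coefficient≈ (mkℚ (+ 0) zero _) = ≈-sym fromℚ-0
  coefficient≈ (mkℚ (+ 1) zero _) = ≈-sym fromℚ-1
  coefficient≈ (mkℚ (+ 0) (suc _) _) = ≈-refl
  coefficient≈ (mkℚ (+ 1) (suc _) _) = ≈-refl
  coefficient≈ (mkℚ (+ suc (suc _)) _ _) = ≈-refl
  coefficient≈ (mkℚ -[1+ _ ] _ _) = ≈-refl

  coefficient-+ : ∀ p q → coefficient (p ℚ.+ q) ≈ coefficient p + coefficient q
  coefficient-+ p q = ≈-trans (coefficient≈ _) (≈-trans (fromℚ-+ p q) (≈-sym (+-cong (coefficient≈ p) (coefficient≈ q))))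

  coefficient-* : ∀ p q → coefficient (p ℚ.* q) ≈ coefficient p * coefficient q
  coefficient-* p q = ≈-trans (coefficient≈ _) (≈-trans (fromℚ-* p q) (≈-sym (*-cong (coefficient≈ p) (coefficient≈ q))))

  coefficient-neg : ∀ p → coefficient (ℚ.- p) ≈ - coefficient p
  coefficient-neg p = ≈-trans (coefficient≈ _) (≈-trans (fromℚ-neg p) (≈-sym (-‿cong (coefficient≈ p))))

  private
    ℚ-rawRing : RawRing 0ℓ 0ℓ
    ℚ-rawRing = CommutativeRing.rawRing ℚ.+-*-commutativeRing

    coefficient-hom : ℚ-rawRing -Raw-AlmostCommutative⟶ fromCommutativeRing commutativeRing
    coefficient-hom = record
      { ⟦_⟧    = coefficient
      ; +-homo = coefficient-+
      ; *-homo = coefficient-*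
      ; -‿homo = coefficient-neg
      ; 0-homo = ≈-refl
      ; 1-homo = ≈-refl
      }

    equal? : ∀ p q → Maybe (coefficient p ≈ coefficient q)
    equal? p q with p ℚ.≟ q
    ... | yes p≡q = just (≈-reflexive (≡.cong coefficient p≡q))
    ... | no _    = nothing

  open RingSolver ℚ-rawRing (fromCommutativeRing commutativeRing) coefficient-hom equal? public
    using (solve; _:=_; _:+_; _:*_; _:-_; :-_; con; _:^_; Polynomial)

  num : ∀ {n} → ℕ → Polynomial n
  num k = con (+ k / 1)

  infix 4 _⊑_
  -- |x| ≤ b
  record _⊑_ (x b : Carrier) : Set where
    constructor bounded
    field
      lower : - b ≤ x
      upper : x ≤ b
  open _⊑_ public

  -- Excluded middle for P is available constructively as long as the goal is a negation.
  by-cases : ∀ {A : Set} (P : Set) → (P → ¬ A) → (¬ P → ¬ A) → ¬ A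
  by-cases P f g a = g (λ p → f p a) a

  ≈-stable : ∀ {x y} → ¬ ¬ x ≈ y → x ≈ y
  ≈-stable nn = <-tight (λ x<y → nn λ x≈y → <-irrefl x≈y x<y)
                        (λ y<x → nn λ x≈y → <-irrefl (≈-sym x≈y) y<x)

  <-respˡ : ∀ {x x′ y} → x ≈ x′ → x < y → x′ < y
  <-respˡ x≈x′ x<y with <-cotrans x<y _
  ... | inj₁ x<x′ = ⊥-elim (<-irrefl x≈x′ x<x′)
  ... | inj₂ x′<y = x′<y

  <-respʳ : ∀ {x y y′} → y ≈ y′ → x < y → x < y′
  <-respʳ y≈y′ x<y with <-cotrans x<y _
  ... | inj₁ x<y′ = x<y′
  ... | inj₂ y′<y = ⊥-elim (<-irrefl (≈-sym y≈y′) y′<y)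

  ≤-resp : ∀ {x x′ y y′} → x ≈ x′ → y ≈ y′ → x ≤ y → x′ ≤ y′
  ≤-resp x≈x′ y≈y′ x≤y y′<x′ = x≤y (<-respˡ (≈-sym y≈y′) (<-respʳ (≈-sym x≈x′) y′<x′))

  <-≤-trans : ∀ {x y z} → x < y → y ≤ z → x < z
  <-≤-trans x<y y≤z with <-cotrans x<y _
  ... | inj₁ x<z = x<z
  ... | inj₂ z<y = ⊥-elim (y≤z z<y)

  ≤-<-trans : ∀ {x y z} → x ≤ y → y < z → x < z
  ≤-<-trans x≤y y<z with <-cotrans y<z _
  ... | inj₁ y<x = ⊥-elim (x≤y y<x)
  ... | inj₂ x<z = x<z

  <⇒≤ : ∀ {x y} → x < y → x ≤ y
  <⇒≤ = <-asym

  <-trans : ∀ {x y z} → x < y → y < z → x < z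
  <-trans x<y y<z = <-≤-trans x<y (<⇒≤ y<z)

  ≈⇒≤ : ∀ {x y} → x ≈ y → x ≤ y
  ≈⇒≤ x≈y = <-irrefl (≈-sym x≈y)

  ≤-refl : ∀ {x} → x ≤ x
  ≤-refl = ≈⇒≤ ≈-refl

  ≤-trans : ∀ {x y z} → x ≤ y → y ≤ z → x ≤ z
  ≤-trans x≤y y≤z z<x = x≤y (≤-<-trans y≤z z<x)

  ≤-antisym : ∀ {x y} → x ≤ y → y ≤ x → x ≈ y
  ≤-antisym x≤y y≤x = <-tight y≤x x≤y

  +-monoˡ-≤ : ∀ z {x y} → x ≤ y → x + z ≤ y + z
  +-monoˡ-≤ z {x} {y} x≤y y+z<x+z = x≤y (<-respˡ (cancel y z) (<-respʳ (cancel x z) (+-monoˡ-< (- z) y+z<x+z)))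
    where
    cancel : ∀ x z → (x + z) + - z ≈ x
    cancel = solve 2 (λ x z → (x :+ z) :+ :- z := x) ≈-refl

  +-mono-≤ : ∀ {x y u v} → x ≤ y → u ≤ v → x + u ≤ y + v
  +-mono-≤ x≤y u≤v = ≤-trans (+-monoˡ-≤ _ x≤y)
    (≤-resp (+-comm _ _) (+-comm _ _) (+-monoˡ-≤ _ u≤v))

  -- The pattern for inequalities throughout: d is a combination visibly nonnegative, and the
  -- identity y - x = d is left to the ring solver.
  ≤-by : ∀ {x y d} → 0# ≤ d → y - x ≈ d → x ≤ y
  ≤-by {x} {y} 0≤d eq = ≤-resp (+-identityˡ x) (cancel x y) (+-monoˡ-≤ x (≤-resp ≈-refl (≈-sym eq) 0≤d))
    where
    cancel : ∀ x y → (y - x) + x ≈ y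
    cancel = solve 2 (λ x y → (y :- x) :+ x := y) ≈-refl

  <-by : ∀ {x y d} → 0# < d → y - x ≈ d → x < y
  <-by {x} {y} 0<d eq = <-respˡ (+-identityˡ x) (<-respʳ (cancel x y) (+-monoˡ-< x (<-respʳ (≈-sym eq) 0<d)))
    where
    cancel : ∀ x y → (y - x) + x ≈ y
    cancel = solve 2 (λ x y → (y :- x) :+ x := y) ≈-refl

  x≤y⇒0≤y-x : ∀ {x y} → x ≤ y → 0# ≤ y - x
  x≤y⇒0≤y-x {x} x≤y = ≤-resp (-‿inverseʳ x) ≈-refl (+-monoˡ-≤ (- x) x≤y)

  x<y⇒0<y-x : ∀ {x y} → x < y → 0# < y - x
  x<y⇒0<y-x {x} x<y = <-respˡ (-‿inverseʳ x) (+-monoˡ-< (- x) x<y)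

  0≤-+ : ∀ {x y} → 0# ≤ x → 0# ≤ y → 0# ≤ x + y
  0≤-+ 0≤x 0≤y = ≤-resp (+-identityˡ 0#) ≈-refl (+-mono-≤ 0≤x 0≤y)

  0<-+-≤ : ∀ {x y} → 0# < x → 0# ≤ y → 0# < x + y
  0<-+-≤ {x} {y} 0<x 0≤y = <-≤-trans 0<x (≤-by 0≤y (solve 2 (λ x y → (x :+ y) :- x := y) ≈-refl x y))

  -- If xy < 0, then x > 0 would force y ≈ 0 and xy ≈ 0; so x ≈ 0, which again contradicts xy < 0.
  0≤-* : ∀ {x y} → 0# ≤ x → 0# ≤ y → 0# ≤ x * y
  0≤-* {x} {y} 0≤x 0≤y xy<0 = <-irrefl (≈-trans (*-congʳ x≈0) (zeroˡ y)) xy<0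
    where
    0≮x : ¬ 0# < x
    0≮x 0<x = <-irrefl (≈-trans (*-congˡ (≤-antisym (λ 0<y → <-asym xy<0 (*-pos 0<x 0<y)) 0≤y)) (zeroʳ x)) xy<0
    x≈0 : x ≈ 0#
    x≈0 = ≤-antisym 0≮x 0≤x

  neg-flip : ∀ {x} → x < 0# → 0# < - x
  neg-flip {x} x<0 = <-respʳ (+-identityˡ (- x)) (x<y⇒0<y-x x<0)

  0≤-square : ∀ x → 0# ≤ x * x
  0≤-square x = by-cases (x < 0#)
    (λ x<0 → let 0≤-x = <⇒≤ (neg-flip x<0) in
      ≤-resp ≈-refl (solve 1 (λ x → :- x :* :- x := x :* x) ≈-refl x) (0≤-* 0≤-x 0≤-x))
    (λ 0≤x → 0≤-* 0≤x 0≤x)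

  -- Takes the place of division by y. A merely negative hypothesis on y suffices, because the
  -- conclusion is an equality and follows by tightness.
  x*y≈0⇒x≈0 : ∀ {x y} → x * y ≈ 0# → ¬ y ≈ 0# → x ≈ 0#
  x*y≈0⇒x≈0 {x} {y} xy≈0 y≉0 = <-tight
    (λ x<0 → nonzero (neg-flip x<0) (≈-trans (≈-sym (-‿distribˡ-* x y)) (≈-trans (-‿cong xy≈0) -0#≈0#)))
    (λ 0<x → nonzero 0<x xy≈0)
    where
    nonzero : ∀ {z} → 0# < z → ¬ z * y ≈ 0#
    nonzero {z} 0<z zy≈0 = y≉0 (<-tight
      (λ y<0 → <-irrefl (≈-sym (≈-trans (≈-sym (-‿distribʳ-* z y)) (≈-trans (-‿cong zy≈0) -0#≈0#))) (*-pos 0<z (neg-flip y<0)))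
      (λ 0<y → <-irrefl (≈-sym zy≈0) (*-pos 0<z 0<y)))

  fromℚ-mono-≤ : ∀ {p q} → p ℚ.≤ q → fromℚ p ≤ fromℚ q
  fromℚ-mono-≤ {p} {q} p≤q with q ℚ.≤? p
  ... | yes q≤p = ≈⇒≤ (≈-reflexive (≡.cong fromℚ (ℚ.≤-antisym p≤q q≤p)))
  ... | no q≰p = <⇒≤ (fromℚ-mono-< (ℚ.≰⇒> q≰p))

  0≤fromℚ : ∀ {q} → 0ℚ ℚ.≤ q → 0# ≤ fromℚ q
  0≤fromℚ 0≤q = ≤-resp fromℚ-0 ≈-refl (fromℚ-mono-≤ 0≤q)

  0<fromℚ : ∀ {q} → 0ℚ ℚ.< q → 0# < fromℚ q
  0<fromℚ 0<q = <-respˡ fromℚ-0 (fromℚ-mono-< 0<q)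

  0<1 : 0# < 1#
  0<1 = <-respʳ fromℚ-1 (0<fromℚ (ℚ.positive⁻¹ 1ℚ))

  neg-≤ : ∀ {x y} → x ≤ y → - y ≤ - x
  neg-≤ {x} {y} x≤y = ≤-by (x≤y⇒0≤y-x x≤y) (solve 2 (λ x y → :- x :- :- y := y :- x) ≈-refl x y)

  ⊑-resp : ∀ {x y b c} → x ≈ y → b ≈ c → x ⊑ b → y ⊑ c
  ⊑-resp x≈y b≈c (bounded l u) = bounded (≤-resp (-‿cong b≈c) x≈y l) (≤-resp x≈y b≈c u)

  ⊑-neg : ∀ {x b} → x ⊑ b → - x ⊑ b
  ⊑-neg (bounded l u) = bounded (neg-≤ u) (≤-resp ≈-refl (-‿involutive _) (neg-≤ l))

  ⊑-+ : ∀ {x y b c} → x ⊑ b → y ⊑ c → x + y ⊑ b + c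
  ⊑-+ {b = b} {c} (bounded l u) (bounded l′ u′) =
    bounded (≤-resp (-‿+-comm b c) ≈-refl (+-mono-≤ l l′)) (+-mono-≤ u u′)

  ⊑-trans : ∀ {x b c} → x ⊑ b → b ≤ c → x ⊑ c
  ⊑-trans (bounded l u) b≤c = bounded (≤-trans (neg-≤ b≤c) l) (≤-trans u b≤c)

  0≤⇒⊑ : ∀ {x b} → 0# ≤ x → x ≤ b → x ⊑ b
  0≤⇒⊑ {x} {b} 0≤x x≤b = bounded
    (≤-trans (≤-resp ≈-refl -0#≈0# (neg-≤ (≤-trans 0≤x x≤b))) 0≤x) x≤b

  ⊑⇒0≤ : ∀ {x b} → x ⊑ b → 0# ≤ b
  ⊑⇒0≤ {x} {b} (bounded l u) = ≤-resp ≈-refl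
    (solve 2 (λ x b → con ½ :* ((b :- x) :+ (x :- :- b)) := b) ≈-refl x b)
    (0≤-* (0≤fromℚ (ℚ.nonNegative⁻¹ ½)) (0≤-+ (x≤y⇒0≤y-x u) (x≤y⇒0≤y-x l)))

  -- Both bc + xy and bc - xy are half a sum of two products of the nonnegative numbers b ± x and c
  -- ± y.
  ⊑-* : ∀ {x y b c} → x ⊑ b → y ⊑ c → x * y ⊑ b * c
  ⊑-* {x} {y} {b} {c} (bounded l u) (bounded l′ u′) = bounded
    (≤-by (0≤-* 0≤½ (0≤-+ (0≤-* (x≤y⇒0≤y-x u) (x≤y⇒0≤y-x u′)) (0≤-* (x≤y⇒0≤y-x l) (x≤y⇒0≤y-x l′))))
      (solve 4 (λ x y b c → x :* y :- :- (b :* c) :=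
        con ½ :* ((b :- x) :* (c :- y) :+ (x :- :- b) :* (y :- :- c))) ≈-refl x y b c))
    (≤-by (0≤-* 0≤½ (0≤-+ (0≤-* (x≤y⇒0≤y-x u) (x≤y⇒0≤y-x l′)) (0≤-* (x≤y⇒0≤y-x l) (x≤y⇒0≤y-x u′))))
      (solve 4 (λ x y b c → b :* c :- x :* y :=
        con ½ :* ((b :- x) :* (y :- :- c) :+ (x :- :- b) :* (c :- y))) ≈-refl x y b c))
    where
    0≤½ : 0# ≤ fromℚ ½
    0≤½ = 0≤fromℚ (ℚ.nonNegative⁻¹ ½)

  -- Limits

  half-pos : ∀ {ε} → 0ℚ ℚ.< ε → 0ℚ ℚ.< ½ ℚ.* ε
  half-pos {ε} 0<ε = ≡.subst (ℚ._< ½ ℚ.* ε) (ℚ.*-zeroʳ ½) (ℚ.*-monoʳ-<-pos ½ 0<ε)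

  halves : ∀ ε → fromℚ (½ ℚ.* ε) + fromℚ (½ ℚ.* ε) ≈ fromℚ ε
  halves ε = ≈-trans (+-cong (fromℚ-* ½ ε) (fromℚ-* ½ ε))
    (solve 1 (λ e → con ½ :* e :+ con ½ :* e := e) ≈-refl (fromℚ ε))

  Eventually : (ℕ → Set) → Set
  Eventually P = ∃[ N ] (∀ n → N ℕ.≤ n → P n)

  eventually-and : ∀ {P Q : ℕ → Set} → Eventually P → Eventually Q → Eventually (λ n → P n × Q n)
  eventually-and (M , p) (N , q) = M ℕ.⊔ N , λ n le → p n (ℕ.m⊔n≤o⇒m≤o M N le) , q n (ℕ.m⊔n≤o⇒n≤o M N le)

  eventually-map : ∀ {P Q : ℕ → Set} → (∀ {n} → P n → Q n) → Eventually P → Eventually Q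
  eventually-map f (N , p) = N , λ n le → f (p n le)

  -- Convergence to 0, with ≤ in place of the < of HasLimit.
  record Null (s : ℕ → Carrier) : Set where
    constructor null
    field small : ∀ ε → 0ℚ ℚ.< ε → Eventually (λ n → s n ⊑ fromℚ ε)
  open Null public

  infix 4 _⟶_
  record _⟶_ (s : ℕ → Carrier) (l : Carrier) : Set where
    constructor converges
    field difference : Null (λ n → s n - l)
  open _⟶_ public

  half< : ∀ {ε} → 0ℚ ℚ.< ε → fromℚ (½ ℚ.* ε) < fromℚ ε
  half< {ε} 0<ε = <-by (0<fromℚ (half-pos 0<ε)) (≈-trans (+-cong (≈-sym (halves ε)) ≈-refl)
    (solve 1 (λ h → (h :+ h) :- h := h) ≈-refl _))

  ⟶⇒HasLimit : ∀ {s l} → s ⟶ l → HasLimit s l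
  ⟶⇒HasLimit {s} {l} s⟶l ε 0<ε with small (difference s⟶l) (½ ℚ.* ε) (half-pos 0<ε)
  ... | N , near = N , λ n le →
    ≤-<-trans (upper (near n le)) (half< 0<ε) ,
    ≤-<-trans (≤-resp (solve 2 (λ s l → :- (s :- l) := l :- s) ≈-refl (s n) l) ≈-refl (upper (⊑-neg (near n le)))) (half< 0<ε)

  HasLimit⇒⟶ : ∀ {s l} → HasLimit s l → s ⟶ l
  HasLimit⇒⟶ {s} {l} has = converges (null λ ε 0<ε → let N , near = has ε 0<ε in N , λ n le →
    bounded (≤-resp ≈-refl (solve 2 (λ s l → :- (l :- s) := s :- l) ≈-refl (s n) l) (neg-≤ (<⇒≤ (proj₂ (near n le)))))
            (<⇒≤ (proj₁ (near n le))))

  null-resp : ∀ {s t} → (∀ n → s n ≈ t n) → Null s → Null t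
  null-resp s≈t s↓0 = null λ ε 0<ε → eventually-map (⊑-resp (s≈t _) ≈-refl) (small s↓0 ε 0<ε)

  null-squeeze : ∀ {s t} → (∀ n → s n ⊑ t n) → Null t → Null s
  null-squeeze s⊑t t↓0 = null λ ε 0<ε → eventually-map (λ {n} t≤ → ⊑-trans (s⊑t n) (upper t≤)) (small t↓0 ε 0<ε)

  null-shift : ∀ k {s} → Null (λ n → s (k ℕ.+ n)) → Null s
  null-shift k {s} s↓0 = null λ ε 0<ε → let N , near = small s↓0 ε 0<ε in k ℕ.+ N , λ n k+N≤n →
    ≡.subst (λ n → s n ⊑ fromℚ ε) (ℕ.m+[n∸m]≡n (ℕ.m+n≤o⇒m≤o k k+N≤n))
      (near (n ℕ.∸ k) (ℕ.m+n≤o⇒m≤o∸n N (≡.subst (ℕ._≤ n) (ℕ.+-comm k N) k+N≤n)))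

  null-subsequence : ∀ {s} (f : ℕ → ℕ) → (∀ n → n ℕ.≤ f n) → Null s → Null (s ∘ f)
  null-subsequence f n≤fn s↓0 = null λ ε 0<ε → let N , near = small s↓0 ε 0<ε in
    N , λ n N≤n → near (f n) (ℕ.≤-trans N≤n (n≤fn n))

  null-+ : ∀ {s t} → Null s → Null t → Null (λ n → s n + t n)
  null-+ s↓0 t↓0 = null λ ε 0<ε → eventually-map
    (λ (s≤ , t≤) → ⊑-resp ≈-refl (halves ε) (⊑-+ s≤ t≤))
    (eventually-and (small s↓0 _ (half-pos 0<ε)) (small t↓0 _ (half-pos 0<ε)))

  null-neg : ∀ {s} → Null s → Null (λ n → - s n)
  null-neg s↓0 = null λ ε 0<ε → eventually-map ⊑-neg (small s↓0 ε 0<ε)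

  null-* : ∀ {s t} → Null s → Null t → Null (λ n → s n * t n)
  null-* s↓0 t↓0 = null λ ε 0<ε → eventually-map
    (λ (s≤ , t≤) → ⊑-resp ≈-refl (≈-trans (*-congˡ fromℚ-1) (*-identityʳ _)) (⊑-* s≤ t≤))
    (eventually-and (small s↓0 ε 0<ε) (small t↓0 1ℚ (ℚ.positive⁻¹ 1ℚ)))

  ⊑-fromℕ : ∀ x → ∃[ B ] x ⊑ fromℕ (suc B)
  ⊑-fromℕ x = M ℕ.+ N , bounded
    (≤-resp ≈-refl (-‿involutive x) (neg-≤ (≤-trans (<⇒≤ (proj₂ (archimedean (- x)))) (fromℚ-mono-≤ (/1-mono-≤ (ℤ.+≤+ (ℕ.m≤n⇒m≤1+n (ℕ.m≤n+m N M))))))))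
    (≤-trans (<⇒≤ (proj₂ (archimedean x))) (fromℚ-mono-≤ (/1-mono-≤ (ℤ.+≤+ (ℕ.m≤n⇒m≤1+n (ℕ.m≤m+n M N))))))
    where
    M = proj₁ (archimedean x)
    N = proj₁ (archimedean (- x))

  null-scale : ∀ c {s} → Null s → Null (λ n → c * s n)
  null-scale c {s} s↓0 = null λ ε 0<ε → eventually-map
      (λ s≤ → ⊑-resp ≈-refl (≈-trans (≈-sym (fromℚ-* b _)) (≈-reflexive (≡.cong fromℚ (cancel ε)))) (⊑-* c≤b s≤))
      (small s↓0 (1/b ℚ.* ε) (≡.subst (ℚ._< 1/b ℚ.* ε) (ℚ.*-zeroʳ 1/b) (ℚ.*-monoʳ-<-pos 1/b {{ℚ.1/pos⇒pos b}} 0<ε)))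
    where
    c≤b = proj₂ (⊑-fromℕ c)
    b = + suc (proj₁ (⊑-fromℕ c)) / 1
    instance
      b-pos : ℚ.Positive b
      b-pos = ℚ.normalize-pos (suc (proj₁ (⊑-fromℕ c))) 1
      b-nonZero : ℚ.NonZero b
      b-nonZero = ℚ.pos⇒nonZero b
    1/b = ℚ.1/ b
    cancel : ∀ ε → b ℚ.* (1/b ℚ.* ε) ≡ ε
    cancel ε = ≡.trans (≡.sym (ℚ.*-assoc b 1/b ε)) (≡.trans (≡.cong (ℚ._* ε) (ℚ.*-inverseʳ b)) (ℚ.*-identityˡ ε))

  -- If 0 < x, then `<-gap` yields a rational δ with 0 < δ < x, against x ≤ δ.
  small⇒≤0 : ∀ {x} → (∀ ε → 0ℚ ℚ.< ε → x ≤ fromℚ ε) → x ≤ 0#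
  small⇒≤0 x≤ε 0<x with <-gap 0<x
  ... | δ , 0<δ , δ<x = x≤ε δ 0<δ (<-respˡ (+-identityˡ _) δ<x)

  null-const : ∀ {x} → Null (λ _ → x) → x ≈ 0#
  null-const {x} x↓0 = ≤-antisym
    (small⇒≤0 λ ε 0<ε → let N , near = small x↓0 ε 0<ε in upper (near N ℕ.≤-refl))
    (≤-resp -0#≈0# (-‿involutive x) (neg-≤ (small⇒≤0 λ ε 0<ε → let N , near = small x↓0 ε 0<ε in upper (⊑-neg (near N ℕ.≤-refl)))))

  ⟶-resp : ∀ {s t l m} → (∀ n → s n ≈ t n) → l ≈ m → s ⟶ l → t ⟶ m
  ⟶-resp s≈t l≈m (converges d) = converges (null-resp (λ n → +-cong (s≈t n) (-‿cong l≈m)) d)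

  ⟶-unique : ∀ {s l m} → s ⟶ l → s ⟶ m → l ≈ m
  ⟶-unique {s} {l} {m} (converges d) (converges e) = ≈-trans (≈-sym (+-identityʳ l))
    (≈-trans (+-congˡ (≈-sym (null-const (null-resp
      (λ n → solve 3 (λ s l m → (s :- l) :- (s :- m) := m :- l) ≈-refl (s n) l m) (null-+ d (null-neg e))))))
    (solve 2 (λ l m → l :+ (m :- l) := m) ≈-refl l m))

  ⟶-const : ∀ x → (λ _ → x) ⟶ x
  ⟶-const x = converges (null λ ε 0<ε → 0 , λ _ _ →
    ⊑-resp (≈-sym (-‿inverseʳ x)) ≈-refl (0≤⇒⊑ ≤-refl (<⇒≤ (0<fromℚ 0<ε))))

  ⟶-+ : ∀ {s t l m} → s ⟶ l → t ⟶ m → (λ n → s n + t n) ⟶ l + m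
  ⟶-+ {s} {t} {l} {m} (converges d) (converges e) = converges (null-resp
    (λ n → solve 4 (λ s t l m → (s :- l) :+ (t :- m) := (s :+ t) :- (l :+ m)) ≈-refl (s n) (t n) l m) (null-+ d e))

  ⟶-* : ∀ {s t l m} → s ⟶ l → t ⟶ m → (λ n → s n * t n) ⟶ l * m
  ⟶-* {s} {t} {l} {m} (converges d) (converges e) = converges (null-resp
    (λ n → solve 4 (λ s t l m → (s :- l) :* (t :- m) :+ (l :* (t :- m) :+ m :* (s :- l)) := s :* t :- l :* m) ≈-refl (s n) (t n) l m)
    (null-+ (null-* d e) (null-+ (null-scale l e) (null-scale m d))))

  ⟶-scale : ∀ c {s l} → s ⟶ l → (λ n → c * s n) ⟶ c * l
  ⟶-scale c = ⟶-* (⟶-const c)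

  ⟶-neg : ∀ {s l} → s ⟶ l → (λ n → - s n) ⟶ - l
  ⟶-neg {s} {l} (converges d) = converges (null-resp (λ n → solve 2 (λ s l → :- (s :- l) := :- s :- :- l) ≈-refl (s n) l) (null-neg d))

  ⟶-null : ∀ {s t l} → Null (λ n → s n - t n) → s ⟶ l → t ⟶ l
  ⟶-null {s} {t} {l} s-t↓0 (converges d) = converges (null-resp
    (λ n → solve 3 (λ s t l → (s :- l) :- (s :- t) := t :- l) ≈-refl (s n) (t n) l) (null-+ d (null-neg s-t↓0)))

  ⟶-subsequence : ∀ {s l} (f : ℕ → ℕ) → (∀ n → n ℕ.≤ f n) → s ⟶ l → (s ∘ f) ⟶ l
  ⟶-subsequence f n≤fn (converges d) = converges (null-subsequence f n≤fn d)

  ⟶-≤ : ∀ {s l b} → s ⟶ l → (∀ n → s n ≤ b) → l ≤ b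
  ⟶-≤ {s} {l} {b} (converges d) s≤b = ≤-by (≤-resp -0#≈0# ≈-refl (neg-≤ (small⇒≤0 λ ε 0<ε →
      let N , near = small d ε 0<ε in ≤-trans
        (≤-by (x≤y⇒0≤y-x (s≤b N)) (solve 3 (λ s l b → :- (s :- l) :- (l :- b) := b :- s) ≈-refl (s N) l b))
        (upper (⊑-neg (near N ℕ.≤-refl))))))
    (solve 2 (λ l b → b :- l := :- (l :- b)) ≈-refl l b)

  ⟶-≥ : ∀ {s l b} → s ⟶ l → (∀ n → b ≤ s n) → b ≤ l
  ⟶-≥ {l = l} {b} s⟶l b≤s = ≤-resp (-‿involutive b) (-‿involutive l) (neg-≤ (⟶-≤ (⟶-neg s⟶l) (λ n → neg-≤ (b≤s n))))

  ⟶-⊑ : ∀ {s l b} → s ⟶ l → (∀ n → s n ⊑ b) → l ⊑ b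
  ⟶-⊑ s⟶l s⊑b = bounded (⟶-≥ s⟶l (λ n → lower (s⊑b n))) (⟶-≤ s⟶l (λ n → upper (s⊑b n)))

  dominated-converges : ∀ s {t} → (∀ N j → s (N ℕ.+ j) - s N ⊑ t N) → Null t → ∃[ l ] s ⟶ l
  dominated-converges s {t} tail t↓0 = proj₁ limit , HasLimit⇒⟶ (proj₂ limit)
    where
    close : ∀ {ε N} → t N ⊑ fromℚ (½ ℚ.* (½ ℚ.* ε)) → ∀ n → N ℕ.≤ n → s n - s N ⊑ fromℚ (½ ℚ.* (½ ℚ.* ε))
    close {ε} {N} tN≤ n N≤n = ⊑-trans (≡.subst (λ k → s k - s N ⊑ t N) (ℕ.m+[n∸m]≡n N≤n) (tail N (n ℕ.∸ N))) (upper tN≤)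
    -- Two tails of at most ε/4 leave ε/2, which is strictly below ε as `complete` demands.
    limit = complete s λ ε 0<ε → let N , near = small t↓0 _ (half-pos (half-pos 0<ε)) in N , λ m n N≤m N≤n →
      ≤-<-trans
        (≤-resp (solve 3 (λ a b c → (a :- c) :+ :- (b :- c) := a :- b) ≈-refl (s m) (s n) (s N)) (halves _)
          (+-mono-≤ (upper (close {ε} (near N ℕ.≤-refl) m N≤m)) (upper (⊑-neg (close {ε} (near N ℕ.≤-refl) n N≤n)))))
        (half< 0<ε)

  fromℤ : ℤ → Carrier
  fromℤ z = fromℚ (z / 1)

  fromℤ-+ : ∀ a b → fromℤ (a ℤ.+ b) ≈ fromℤ a + fromℤ b
  fromℤ-+ a b = ≈-trans (≈-reflexive (≡.cong fromℚ (/1-+ a b))) (fromℚ-+ _ _)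

  fromℤ-* : ∀ a b → fromℤ (a ℤ.* b) ≈ fromℤ a * fromℤ b
  fromℤ-* a b = ≈-trans (≈-reflexive (≡.cong fromℚ (/1-* a b))) (fromℚ-* _ _)

  fromℤ-neg : ∀ a → fromℤ (ℤ.- a) ≈ - fromℤ a
  fromℤ-neg a = ≈-trans (≈-reflexive (≡.cong fromℚ (/1-neg a))) (fromℚ-neg _)

  fromℤ-mono-≤ : ∀ {a b} → a ℤ.≤ b → fromℤ a ≤ fromℤ b
  fromℤ-mono-≤ a≤b = fromℚ-mono-≤ (/1-mono-≤ a≤b)

  fromℕ-suc : ∀ n → fromℕ (suc n) ≈ 1# + fromℕ n
  fromℕ-suc n = ≈-trans (fromℤ-+ (+ 1) (+ n)) (+-congʳ fromℚ-1)

  fromℕ-* : ∀ m n → fromℕ (m ℕ.* n) ≈ fromℕ m * fromℕ n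
  fromℕ-* m n = ≈-trans (≈-reflexive (≡.cong fromℤ (ℤ.pos-* m n))) (fromℤ-* (+ m) (+ n))

  fromℕ-mono-≤ : ∀ {m n} → m ℕ.≤ n → fromℕ m ≤ fromℕ n
  fromℕ-mono-≤ m≤n = fromℤ-mono-≤ (ℤ.+≤+ m≤n)

  0≤fromℕ : ∀ n → 0# ≤ fromℕ n
  0≤fromℕ n = ≤-resp fromℚ-0 ≈-refl (fromℕ-mono-≤ (ℕ.z≤n {n}))

  0<fromℕ : ∀ n → 0# < fromℕ (suc n)
  0<fromℕ n = <-respʳ (≈-sym (fromℕ-suc n)) (0<-+-≤ 0<1 (0≤fromℕ n))

  *-cancel-0≤ : ∀ {c x} → 0# < c → 0# ≤ c * x → 0# ≤ x
  *-cancel-0≤ {c} {x} 0<c 0≤cx x<0 = 0≤cx (<-by (*-pos 0<c (neg-flip x<0))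
    (solve 2 (λ c x → num 0 :- c :* x := c :* :- x) ≈-refl c x))

  *-cancel-≈ : ∀ {c x y} → 0# < c → c * x ≈ c * y → x ≈ y
  *-cancel-≈ {c} {x} {y} 0<c cx≈cy = ≈-trans (≈-sym (+-identityʳ x)) (≈-trans
    (+-congˡ (≈-sym (x*y≈0⇒x≈0 {y - x} {c}
      (≈-trans (solve 3 (λ c x y → (y :- x) :* c := c :* y :- c :* x) ≈-refl c x y)
        (≈-trans (+-congˡ (-‿cong cx≈cy)) (-‿inverseʳ _)))
      (λ c≈0 → <-irrefl (≈-sym c≈0) 0<c))))
    (solve 2 (λ x y → x :+ (y :- x) := y) ≈-refl x y))

  -- Exponential series

  ∑ : ℕ → (ℕ → Carrier) → Carrier
  ∑ N f = sum {N} (λ k → f (toℕ k))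

  ∑-cong : ∀ N {f g} → (∀ k → f k ≈ g k) → ∑ N f ≈ ∑ N g
  ∑-cong zero    f≈g = ≈-refl
  ∑-cong (suc N) f≈g = +-cong (f≈g 0) (∑-cong N (f≈g ∘ suc))

  ∑-last : ∀ N f → ∑ (suc N) f ≈ ∑ N f + f N
  ∑-last zero    f = +-comm _ _
  ∑-last (suc N) f = ≈-trans (+-congˡ (∑-last N (f ∘ suc))) (≈-sym (+-assoc _ _ _))

  ∑-+ : ∀ N f g → ∑ N (λ k → f k + g k) ≈ ∑ N f + ∑ N g
  ∑-+ zero    f g = ≈-sym (+-identityˡ _)
  ∑-+ (suc N) f g = ≈-trans (+-congˡ (∑-+ N (f ∘ suc) (g ∘ suc)))
    (solve 4 (λ a b c d → (a :+ b) :+ (c :+ d) := (a :+ c) :+ (b :+ d)) ≈-refl (f 0) (g 0) _ _)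

  ∑-scale : ∀ N c f → ∑ N (λ k → c * f k) ≈ c * ∑ N f
  ∑-scale zero    c f = ≈-sym (zeroʳ c)
  ∑-scale (suc N) c f = ≈-trans (+-congˡ (∑-scale N c (f ∘ suc))) (≈-sym (distribˡ c _ _))

  ∑-neg : ∀ N f → ∑ N (λ k → - f k) ≈ - ∑ N f
  ∑-neg zero    f = ≈-sym -0#≈0#
  ∑-neg (suc N) f = ≈-trans (+-congˡ (∑-neg N (f ∘ suc))) (-‿+-comm _ _)

  ∑-split : ∀ M N f → ∑ (M ℕ.+ N) f ≈ ∑ M f + ∑ N (λ k → f (M ℕ.+ k))
  ∑-split zero    N f = ≈-sym (+-identityˡ _)
  ∑-split (suc M) N f = ≈-trans (+-congˡ (∑-split M N (f ∘ suc))) (≈-sym (+-assoc _ _ _))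

  ∑-⊑ : ∀ N {f g} → (∀ k → f k ⊑ g k) → ∑ N f ⊑ ∑ N g
  ∑-⊑ zero    f⊑g = 0≤⇒⊑ ≤-refl ≤-refl
  ∑-⊑ (suc N) f⊑g = ⊑-+ (f⊑g 0) (∑-⊑ N (f⊑g ∘ suc))

  0≤-∑ : ∀ N {f} → (∀ k → 0# ≤ f k) → 0# ≤ ∑ N f
  0≤-∑ zero    0≤f = ≤-refl
  0≤-∑ (suc N) 0≤f = 0≤-+ (0≤f 0) (0≤-∑ N (0≤f ∘ suc))

  ∑-product : ∀ M N f g → ∑ M (λ k → ∑ N (λ l → f k * g l)) ≈ ∑ M f * ∑ N g
  ∑-product M N f g = ≈-trans (∑-cong M (λ k → ≈-trans (∑-scale N (f k) g) (*-comm _ _)))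
    (≈-trans (∑-scale M (∑ N g) f) (*-comm _ _))

  inverseFactorial : ℕ → Carrier
  inverseFactorial k = fromℚ ((+ 1 / (k !)) {{k ℕ.!≢0}})

  factorial-inverse : ∀ k → fromℕ (k !) * inverseFactorial k ≈ 1#
  factorial-inverse k = ≈-trans (≈-sym (fromℚ-* _ _))
    (≈-trans (≈-reflexive (≡.cong fromℚ (reciprocal (k !) {{k ℕ.!≢0}}))) fromℚ-1)

  inverseFactorial-suc : ∀ k → fromℕ (suc k) * inverseFactorial (suc k) ≈ inverseFactorial k
  inverseFactorial-suc k = ≈-trans (≈-sym (*-identityʳ _)) (≈-trans (*-congˡ (≈-sym (factorial-inverse k)))
    (≈-trans (solve 4 (λ s i f j → s :* i :* (f :* j) := s :* f :* i :* j) ≈-refl _ _ _ _)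
    (≈-trans (*-congʳ (≈-trans (*-congʳ (≈-sym (fromℕ-* (suc k) (k !)))) (factorial-inverse (suc k)))) (*-identityˡ _))))

  0≤inverseFactorial : ∀ k → 0# ≤ inverseFactorial k
  0≤inverseFactorial k = 0≤fromℚ (ℚ.nonNegative⁻¹ _ {{ℚ.normalize-nonNeg 1 (k !) {{k ℕ.!≢0}}}})

  dividedPower : ℕ → Carrier → Carrier
  dividedPower k x = inverseFactorial k * x ^ k

  dividedPower-0 : ∀ x → dividedPower 0 x ≈ 1#
  dividedPower-0 x = ≈-trans (*-identityʳ _) fromℚ-1

  dividedPower-suc : ∀ k x → fromℕ (suc k) * dividedPower (suc k) x ≈ x * dividedPower k x
  dividedPower-suc k x = ≈-trans (≈-sym (*-assoc _ _ _)) (≈-trans (*-congʳ (inverseFactorial-suc k))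
    (solve 3 (λ i x p → i :* (x :* p) := x :* (i :* p)) ≈-refl _ _ _))

  0≤-^ : ∀ k {x} → 0# ≤ x → 0# ≤ x ^ k
  0≤-^ zero    0≤x = <⇒≤ 0<1
  0≤-^ (suc k) 0≤x = 0≤-* 0≤x (0≤-^ k 0≤x)

  ^-⊑ : ∀ k {x b} → x ⊑ b → x ^ k ⊑ b ^ k
  ^-⊑ zero    x⊑b = 0≤⇒⊑ (<⇒≤ 0<1) ≤-refl
  ^-⊑ (suc k) x⊑b = ⊑-* x⊑b (^-⊑ k x⊑b)

  0≤-dividedPower : ∀ k {x} → 0# ≤ x → 0# ≤ dividedPower k x
  0≤-dividedPower k 0≤x = 0≤-* (0≤inverseFactorial k) (0≤-^ k 0≤x)

  inverseFactorial-⊑ : ∀ k {a b} → a ⊑ b → inverseFactorial k * a ⊑ inverseFactorial k * b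
  inverseFactorial-⊑ k = ⊑-* (0≤⇒⊑ (0≤inverseFactorial k) ≤-refl)

  -- For n beyond C/ε both C - n s and ε (n - C/ε) are nonnegative; their sum is n (ε - s), so s ≤
  -- ε.
  null-reciprocal : ∀ {s C} → (∀ n → 0# ≤ s n) → (∀ n → fromℕ n * s n ≤ C) → Null s
  null-reciprocal {s} {C} 0≤s ns≤C = null small-terms
    where
    small-terms : ∀ ε → 0ℚ ℚ.< ε → Eventually (λ n → s n ⊑ fromℚ ε)
    small-terms ε 0<ε = suc M , near
      where
      instance
        ε-nonZero : ℚ.NonZero ε
        ε-nonZero = ℚ.>-nonZero 0<ε
      e i : Carrier
      e = fromℚ ε
      i = fromℚ (ℚ.1/ ε)
      bound : ∃[ M ] C * i < fromℕ M
      bound = archimedean (C * i)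
      M : ℕ
      M = proj₁ bound
      ei≈1 : e * i ≈ 1#
      ei≈1 = ≈-trans (≈-sym (fromℚ-* _ _)) (≈-trans (≈-reflexive (≡.cong fromℚ (ℚ.*-inverseʳ ε))) fromℚ-1)
      identity : ∀ n → (C - fromℕ (suc n) * s (suc n)) + e * (fromℕ (suc n) - C * i) ≈ fromℕ (suc n) * (e - s (suc n))
      identity n = ≈-trans
        (solve 5 (λ C n s e i → (C :- n :* s) :+ e :* (n :- C :* i) := n :* (e :- s) :+ C :* (num 1 :- e :* i)) ≈-refl C _ _ e i)
        (≈-trans (+-congˡ (≈-trans (*-congˡ (≈-trans (+-congˡ (-‿cong ei≈1)) (-‿inverseʳ 1#))) (zeroʳ C))) (+-identityʳ _))
      near : ∀ n → suc M ℕ.≤ n → s n ⊑ e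
      near (suc n) (ℕ.s≤s M≤n) = 0≤⇒⊑ (0≤s (suc n)) (≤-by (*-cancel-0≤ (0<fromℕ n) (≤-resp ≈-refl (identity n)
        (0≤-+ (x≤y⇒0≤y-x (ns≤C (suc n)))
          (0≤-* (<⇒≤ (0<fromℚ 0<ε)) (x≤y⇒0≤y-x (≤-trans (<⇒≤ (proj₂ bound)) (fromℕ-mono-≤ (ℕ.m≤n⇒m≤1+n M≤n)))))))) ≈-refl)

  module _ {B : Carrier} (0≤B : 0# ≤ B) where
    private
      -- An index above 2B: from there on every term Bᵏ/k! is at most half its predecessor.
      N₀ : ℕ
      N₀ = proj₁ (archimedean (fromℕ 2 * B))

      term : ℕ → Carrier
      term k = dividedPower (N₀ ℕ.+ k) B

      0≤term : ∀ k → 0# ≤ term k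
      0≤term k = 0≤-dividedPower (N₀ ℕ.+ k) 0≤B

      term-halves : ∀ k → 0# ≤ term k - fromℕ 2 * term (suc k)
      term-halves k = ≡.subst (λ m → 0# ≤ term k - fromℕ 2 * dividedPower m B) (≡.sym (ℕ.+-suc N₀ k))
        (*-cancel-0≤ (0<fromℕ (N₀ ℕ.+ k)) (≤-resp ≈-refl identity
          (0≤-* (x≤y⇒0≤y-x (≤-trans (<⇒≤ (proj₂ (archimedean (fromℕ 2 * B))))
            (fromℕ-mono-≤ (ℕ.m≤n⇒m≤1+n (ℕ.m≤m+n N₀ k))))) (0≤term k))))
        where
        n t t′ : Carrier
        n = fromℕ (suc (N₀ ℕ.+ k))
        t = term k
        t′ = dividedPower (suc (N₀ ℕ.+ k)) B
        identity : (n - fromℕ 2 * B) * t ≈ n * (t - fromℕ 2 * t′)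
        identity = ≈-trans (solve 3 (λ n B t → (n :- num 2 :* B) :* t := n :* t :- num 2 :* (B :* t)) ≈-refl n B t)
          (≈-trans (+-congˡ (-‿cong (*-congˡ (≈-sym (dividedPower-suc (N₀ ℕ.+ k) B)))))
          (solve 3 (λ n t t′ → n :* t :- num 2 :* (n :* t′) := n :* (t :- num 2 :* t′)) ≈-refl n t t′))

      -- The extra summand on the left makes the induction telescope: halving says t + 2t′ ≤ 2t for
      -- consecutive terms t, t′.
      term-tail : ∀ N j → ∑ j (λ k → term (N ℕ.+ k)) + fromℕ 2 * term (N ℕ.+ j) ≤ fromℕ 2 * term N
      term-tail N zero = ≈⇒≤ (≈-trans (+-identityˡ _) (*-congˡ (≈-reflexive (≡.cong term (ℕ.+-identityʳ N)))))
      term-tail N (suc j) = ≤-trans (≤-by (term-halves (N ℕ.+ j)) (≈-trans (+-congˡ (-‿cong (+-cong (∑-last j (λ k → term (N ℕ.+ k)))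
          (*-congˡ (≈-reflexive (≡.cong term (ℕ.+-suc N j)))))))
          (solve 3 (λ a b c → (a :+ num 2 :* b) :- ((a :+ b) :+ num 2 :* c) := b :- num 2 :* c) ≈-refl _ _ _)))
        (term-tail N j)

      term-decreasing : ∀ k → term k ≤ term 0
      term-decreasing zero = ≤-refl
      term-decreasing (suc k) = ≤-trans (≤-by (0≤-+ (term-halves k) (0≤term (suc k)))
        (solve 2 (λ a b → a :- b := (a :- num 2 :* b) :+ b) ≈-refl _ _)) (term-decreasing k)

      -- k times the k-th term is at most B times its predecessor, by the recursion of divided
      -- powers, hence at most B times the first term.
      term-null : Null term
      term-null = null-reciprocal {C = B * term 0} 0≤term λ where
        zero → ≤-trans (≈⇒≤ (≈-trans (*-congʳ fromℚ-0) (zeroˡ _))) (0≤-* 0≤B (0≤term 0))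
        (suc k) → ≤-trans (≤-by (0≤-* (0≤fromℕ N₀) (0≤term (suc k)))
            (≈-trans (+-congʳ (≈-trans (≈-reflexive (≡.cong (λ m → fromℕ m * term (suc k)) (≡.sym (ℕ.+-suc N₀ k))))
              (*-congʳ (fromℤ-+ (+ N₀) (+ suc k)))))
            (solve 3 (λ n k t → (n :+ k) :* t :- k :* t := n :* t) ≈-refl _ _ _)))
          (≤-trans (≈⇒≤ (≈-trans (≈-reflexive (≡.cong (λ m → fromℕ (suc (N₀ ℕ.+ k)) * dividedPower m B) (ℕ.+-suc N₀ k)))
            (dividedPower-suc (N₀ ℕ.+ k) B)))
          (≤-by (0≤-* 0≤B (x≤y⇒0≤y-x (term-decreasing k)))
            (solve 3 (λ b t u → b :* t :- b :* u := b :* (t :- u)) ≈-refl _ _ _)))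

    -- The domination by Bᵏ is general enough to cover cosine, sine and the entries of matrix
    -- exponentials.
    exponential-series-converges : ∀ (a : ℕ → Carrier) → (∀ k → a k ⊑ B ^ k) →
      ∃[ l ] (λ N → ∑ N (λ k → inverseFactorial k * a k)) ⟶ l
    exponential-series-converges a a⊑B^k = proj₁ shifted , converges (null-shift N₀ (difference (proj₂ shifted)))
      where
      partialSum : ℕ → Carrier
      partialSum N = ∑ N (λ k → inverseFactorial k * a k)

      tail : ∀ N j → partialSum (N₀ ℕ.+ (N ℕ.+ j)) - partialSum (N₀ ℕ.+ N) ⊑ fromℕ 2 * term N
      tail N j = ⊑-resp (≈-sym difference≈) ≈-refl (⊑-trans (∑-⊑ j (λ k → inverseFactorial-⊑ (N₀ ℕ.+ N ℕ.+ k) (a⊑B^k (N₀ ℕ.+ N ℕ.+ k))))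
        (≤-trans (≤-by (0≤-* (0≤fromℕ 2) (0≤term (N ℕ.+ j)))
          (≈-trans (+-congˡ (-‿cong (∑-cong j (λ k → ≈-reflexive (≡.cong (λ m → dividedPower m B) (ℕ.+-assoc N₀ N k))))))
            (solve 2 (λ a b → (a :+ b) :- a := b) ≈-refl _ _)))
          (term-tail N j)))
        where
        difference≈ : partialSum (N₀ ℕ.+ (N ℕ.+ j)) - partialSum (N₀ ℕ.+ N) ≈
                      ∑ j (λ k → inverseFactorial (N₀ ℕ.+ N ℕ.+ k) * a (N₀ ℕ.+ N ℕ.+ k))
        difference≈ = ≈-trans (+-congʳ (≈-trans (≈-reflexive (≡.cong partialSum (≡.sym (ℕ.+-assoc N₀ N j))))
            (∑-split (N₀ ℕ.+ N) j (λ k → inverseFactorial k * a k))))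
          (solve 2 (λ a b → (a :+ b) :- a := b) ≈-refl _ _)

      shifted : ∃[ l ] (λ N → partialSum (N₀ ℕ.+ N)) ⟶ l
      shifted = dominated-converges (λ N → partialSum (N₀ ℕ.+ N)) tail (null-scale (fromℕ 2) term-null)

  -- Cauchy products and the binomial theorem.

  -- ∑_{k+l=n} F k l
  antidiagonal : ℕ → (ℕ → ℕ → Carrier) → Carrier
  antidiagonal zero    F = F 0 0
  antidiagonal (suc n) F = F 0 (suc n) + antidiagonal n (F ∘ suc)

  -- ∑_{k+l<N} F k l
  triangle : ℕ → (ℕ → ℕ → Carrier) → Carrier
  triangle zero    F = 0#
  triangle (suc N) F = ∑ (suc N) (F 0) + triangle N (F ∘ suc)

  rectangle : ℕ → ℕ → (ℕ → ℕ → Carrier) → Carrier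
  rectangle M N F = ∑ M (λ k → ∑ N (F k))

  -- ∑ F k l over k < M, l < M + j, k + l ≥ M
  corner : ℕ → ℕ → (ℕ → ℕ → Carrier) → Carrier
  corner zero    j F = 0#
  corner (suc M) j F = ∑ j (λ i → F 0 (suc M ℕ.+ i)) + corner M (suc j) (F ∘ suc)

  -- Removing the row k = 0 lowers M but not the length of the remaining rows, so the excess `j`
  -- grows by one.
  rectangle≈triangle+corner : ∀ M j F → rectangle M (M ℕ.+ j) F ≈ triangle M F + corner M j F
  rectangle≈triangle+corner zero    j F = ≈-sym (+-identityˡ _)
  rectangle≈triangle+corner (suc M) j F = ≈-trans
    (+-cong (∑-split (suc M) j (F 0))
      (≈-trans (≈-reflexive (≡.cong (λ N → rectangle M N (F ∘ suc)) (≡.sym (ℕ.+-suc M j))))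
        (rectangle≈triangle+corner M (suc j) (F ∘ suc))))
    (solve 4 (λ a b c d → (a :+ b) :+ (c :+ d) := (a :+ c) :+ (b :+ d)) ≈-refl _ _ _ _)

  corner-⊑ : ∀ M j {F G} → (∀ k l → F k l ⊑ G k l) → corner M j F ⊑ corner M j G
  corner-⊑ zero    j F⊑G = 0≤⇒⊑ ≤-refl ≤-refl
  corner-⊑ (suc M) j F⊑G = ⊑-+ (∑-⊑ j (λ i → F⊑G 0 (suc M ℕ.+ i))) (corner-⊑ M (suc j) (F⊑G ∘ suc))

  0≤-triangle : ∀ N {F} → (∀ k l → 0# ≤ F k l) → 0# ≤ triangle N F
  0≤-triangle zero    0≤F = ≤-refl
  0≤-triangle (suc N) 0≤F = 0≤-+ (0≤-∑ (suc N) (0≤F 0)) (0≤-triangle N (0≤F ∘ suc))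

  rectangle≤triangle : ∀ M N {F} → (∀ k l → 0# ≤ F k l) → rectangle M N F ≤ triangle (M ℕ.+ N) F
  rectangle≤triangle zero    N 0≤F = 0≤-triangle N 0≤F
  rectangle≤triangle (suc M) N {F} 0≤F = +-mono-≤
    (≤-by (0≤-∑ (suc M) (λ k → 0≤F 0 (N ℕ.+ k)))
      (≈-trans (+-congʳ (≈-trans (≈-reflexive (≡.cong (λ n → ∑ n (F 0)) (ℕ.+-comm (suc M) N))) (∑-split N (suc M) (F 0))))
        (solve 2 (λ a b → (a :+ b) :- a := b) ≈-refl _ _)))
    (rectangle≤triangle M N (0≤F ∘ suc))

  triangle-last : ∀ N F → triangle (suc N) F ≈ triangle N F + antidiagonal N F
  triangle-last zero    F = solve 1 (λ a → (a :+ num 0) :+ num 0 := num 0 :+ a) ≈-refl (F 0 0)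
  triangle-last (suc N) F = ≈-trans (+-cong (∑-last (suc N) (F 0)) (triangle-last N (F ∘ suc)))
    (solve 4 (λ a b c d → (a :+ b) :+ (c :+ d) := (a :+ c) :+ (b :+ d)) ≈-refl _ _ _ _)

  triangle≈∑-antidiagonal : ∀ N F → triangle N F ≈ ∑ N (λ n → antidiagonal n F)
  triangle≈∑-antidiagonal zero    F = ≈-refl
  triangle≈∑-antidiagonal (suc N) F = ≈-trans (triangle-last N F) (≈-trans
    (+-congʳ (triangle≈∑-antidiagonal N F)) (≈-sym (∑-last N (λ n → antidiagonal n F))))

  antidiagonal-cong : ∀ n {F G} → (∀ k l → F k l ≈ G k l) → antidiagonal n F ≈ antidiagonal n G
  antidiagonal-cong zero    F≈G = F≈G 0 0
  antidiagonal-cong (suc n) F≈G = +-cong (F≈G 0 (suc n)) (antidiagonal-cong n (F≈G ∘ suc))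

  antidiagonal-+ : ∀ n F G → antidiagonal n (λ k l → F k l + G k l) ≈ antidiagonal n F + antidiagonal n G
  antidiagonal-+ zero    F G = ≈-refl
  antidiagonal-+ (suc n) F G = ≈-trans (+-congˡ (antidiagonal-+ n (F ∘ suc) (G ∘ suc)))
    (solve 4 (λ a b c d → (a :+ b) :+ (c :+ d) := (a :+ c) :+ (b :+ d)) ≈-refl _ _ _ _)

  antidiagonal-scale : ∀ n c F → antidiagonal n (λ k l → c * F k l) ≈ c * antidiagonal n F
  antidiagonal-scale zero    c F = ≈-refl
  antidiagonal-scale (suc n) c F = ≈-trans (+-congˡ (antidiagonal-scale n c (F ∘ suc))) (≈-sym (distribˡ c _ _))

  antidiagonal-weight : ∀ n (e : ℕ → Carrier) F → antidiagonal n (λ k l → e (k ℕ.+ l) * F k l) ≈ e n * antidiagonal n F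
  antidiagonal-weight zero    e F = ≈-refl
  antidiagonal-weight (suc n) e F = ≈-trans (+-congˡ (antidiagonal-weight n (e ∘ suc) (F ∘ suc))) (≈-sym (distribˡ (e (suc n)) _ _))

  antidiagonal-last : ∀ n F → antidiagonal (suc n) F ≈ antidiagonal n (λ k l → F k (suc l)) + F (suc n) 0
  antidiagonal-last zero    F = ≈-refl
  antidiagonal-last (suc n) F = ≈-trans (+-congˡ (antidiagonal-last n (F ∘ suc))) (≈-sym (+-assoc _ _ _))

  powerProduct : Carrier → Carrier → ℕ → ℕ → Carrier
  powerProduct x y k l = dividedPower k x * dividedPower l y

  -- Divided powers xᵏ/k! absorb the binomial coefficients. Multiplying by n + 1 = k + l and using k
  -- · xᵏ/k! = x · xᵏ⁻¹/(k-1)! on either factor reduces n + 1 to n.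
  binomial-theorem : ∀ n x y → antidiagonal n (powerProduct x y) ≈ dividedPower n (x + y)
  binomial-theorem zero x y = ≈-trans (*-cong (dividedPower-0 x) (dividedPower-0 y))
    (≈-trans (*-identityˡ 1#) (≈-sym (dividedPower-0 (x + y))))
  binomial-theorem (suc n) x y = *-cancel-≈ (0<fromℕ n) (begin
    fromℕ (suc n) * antidiagonal (suc n) H
      ≈⟨ antidiagonal-weight (suc n) fromℕ H ⟨
    antidiagonal (suc n) (λ k l → fromℕ (k ℕ.+ l) * H k l)
      ≈⟨ antidiagonal-cong (suc n) (λ k l → ≈-trans (*-congʳ (fromℤ-+ (+ k) (+ l))) (distribʳ (H k l) _ _)) ⟩
    antidiagonal (suc n) (λ k l → fromℕ k * H k l + fromℕ l * H k l)
      ≈⟨ antidiagonal-+ (suc n) (λ k l → fromℕ k * H k l) (λ k l → fromℕ l * H k l) ⟩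
    antidiagonal (suc n) (λ k l → fromℕ k * H k l) + antidiagonal (suc n) (λ k l → fromℕ l * H k l)
      ≈⟨ +-cong (≈-trans (+-cong (vanish (H 0 (suc n))) (antidiagonal-cong n first)) (+-identityˡ _))
           (≈-trans (antidiagonal-last n (λ k l → fromℕ l * H k l))
             (≈-trans (+-cong (antidiagonal-cong n second) (vanish (H (suc n) 0))) (+-identityʳ _))) ⟩
    antidiagonal n (λ k l → x * H k l) + antidiagonal n (λ k l → y * H k l)
      ≈⟨ +-cong (antidiagonal-scale n x H) (antidiagonal-scale n y H) ⟩
    x * antidiagonal n H + y * antidiagonal n H
      ≈⟨ distribʳ _ x y ⟨
    (x + y) * antidiagonal n H
      ≈⟨ *-congˡ (binomial-theorem n x y) ⟩
    (x + y) * dividedPower n (x + y)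
      ≈⟨ dividedPower-suc n (x + y) ⟨
    fromℕ (suc n) * dividedPower (suc n) (x + y) ∎)
    where
    open import Relation.Binary.Reasoning.Setoid setoid
    H : ℕ → ℕ → Carrier
    H = powerProduct x y
    vanish : ∀ z → fromℕ 0 * z ≈ 0#
    vanish z = ≈-trans (*-congʳ fromℚ-0) (zeroˡ z)
    first : ∀ k l → fromℕ (suc k) * H (suc k) l ≈ x * H k l
    first k l = ≈-trans (≈-sym (*-assoc _ _ _)) (≈-trans (*-congʳ (dividedPower-suc k x)) (*-assoc _ _ _))
    second : ∀ k l → fromℕ (suc l) * H k (suc l) ≈ y * H k l
    second k l = ≈-trans (solve 3 (λ c a b → c :* (a :* b) := a :* (c :* b)) ≈-refl _ _ _)
      (≈-trans (*-congˡ (dividedPower-suc l y)) (solve 3 (λ a c b → a :* (c :* b) := c :* (a :* b)) ≈-refl _ _ _))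

  triangle-powerProduct : ∀ N (e : ℕ → Carrier) x y → triangle N (λ k l → e (k ℕ.+ l) * powerProduct x y k l) ≈
                          ∑ N (λ n → e n * dividedPower n (x + y))
  triangle-powerProduct N e x y = ≈-trans (triangle≈∑-antidiagonal N (λ k l → e (k ℕ.+ l) * powerProduct x y k l)) (∑-cong N (λ n →
    ≈-trans (antidiagonal-weight n e (powerProduct x y)) (*-congˡ (binomial-theorem n x y))))

  -- |x| ≤ X and |y| ≤ Y: the part of the square k, l < N outside the triangle k + l < N is bounded
  -- by the same part for X and Y, which is at most a segment of the exponential series of X + Y.
  cauchy-product : ∀ (e : ℕ → Carrier) → (∀ n → e n ⊑ 1#) → ∀ {x y X Y} → x ⊑ X → y ⊑ Y →
    Null (λ N → rectangle N N (λ k l → e (k ℕ.+ l) * powerProduct x y k l) - ∑ N (λ n → e n * dividedPower n (x + y)))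
  cauchy-product e e⊑1 {x} {y} {X} {Y} x⊑X y⊑Y = null-squeeze
    (λ N → ⊑-resp (corner≈ N) ≈-refl (⊑-trans (corner-⊑ N 0 F⊑G) (corner≤ N)))
    segment-null
    where
    0≤X : 0# ≤ X
    0≤X = ⊑⇒0≤ x⊑X
    0≤Y : 0# ≤ Y
    0≤Y = ⊑⇒0≤ y⊑Y

    F G : ℕ → ℕ → Carrier
    F k l = e (k ℕ.+ l) * powerProduct x y k l
    G k l = 1# * powerProduct X Y k l

    F⊑G : ∀ k l → F k l ⊑ G k l
    F⊑G k l = ⊑-* (e⊑1 (k ℕ.+ l)) (⊑-* (inverseFactorial-⊑ k (^-⊑ k x⊑X))
                                       (inverseFactorial-⊑ l (^-⊑ l y⊑Y)))

    0≤G : ∀ k l → 0# ≤ G k l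
    0≤G k l = 0≤-* (<⇒≤ 0<1) (0≤-* (0≤-dividedPower k 0≤X) (0≤-dividedPower l 0≤Y))

    series : ℕ → Carrier
    series N = ∑ N (λ n → 1# * dividedPower n (X + Y))

    segment-null : Null (λ N → series (N ℕ.+ N) - series N)
    segment-null = null-resp
      (λ N → cancel (series (N ℕ.+ N)) (series N) l)
      (null-+ doubled (null-neg (difference limit)))
      where
      cancel : ∀ a b l → (a - l) - (b - l) ≈ a - b
      cancel = solve 3 (λ a b l → (a :- l) :- (b :- l) := a :- b) ≈-refl
      exists : ∃[ l ] (λ N → ∑ N (λ k → dividedPower k (X + Y))) ⟶ l
      exists = exponential-series-converges (0≤-+ 0≤X 0≤Y) ((X + Y) ^_) (λ k → 0≤⇒⊑ (0≤-^ k (0≤-+ 0≤X 0≤Y)) ≤-refl)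
      l : Carrier
      l = proj₁ exists
      limit : series ⟶ l
      limit = ⟶-resp (λ N → ∑-cong N {λ n → dividedPower n (X + Y)} {λ n → 1# * dividedPower n (X + Y)}
        (λ n → ≈-sym (*-identityˡ (dividedPower n (X + Y))))) ≈-refl (proj₂ exists)
      doubled : Null (λ N → series (N ℕ.+ N) - l)
      doubled = null-subsequence {λ N → series N - l} (λ N → N ℕ.+ N) (λ N → ℕ.m≤m+n N N) (difference limit)

    square≈ : ∀ N H → rectangle N N H ≈ triangle N H + corner N 0 H
    square≈ N H = ≈-trans (≈-reflexive (≡.cong (λ M → rectangle N M H) (≡.sym (ℕ.+-identityʳ N)))) (rectangle≈triangle+corner N 0 H)

    corner≈ : ∀ N → corner N 0 F ≈ rectangle N N F - ∑ N (λ n → e n * dividedPower n (x + y))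
    corner≈ N = ≈-trans (solve 2 (λ a b → b := (a :+ b) :- a) ≈-refl (triangle N F) (corner N 0 F))
      (+-cong (≈-sym (square≈ N F)) (-‿cong (triangle-powerProduct N e x y)))

    corner≤ : ∀ N → corner N 0 G ≤ series (N ℕ.+ N) - series N
    corner≤ N = ≤-resp
      (≈-trans (+-congʳ (square≈ N G)) (solve 2 (λ a b → (a :+ b) :- a := b) ≈-refl (triangle N G) (corner N 0 G)))
      (+-cong (triangle-powerProduct (N ℕ.+ N) (λ _ → 1#) X Y) (-‿cong (triangle-powerProduct N (λ _ → 1#) X Y)))
      (+-monoˡ-≤ (- triangle N G) (rectangle≤triangle N N 0≤G))

  -- Cosine and sine from the exponential series.

  -- reI k + i imI k = iᵏ
  reI imI : ℕ → Carrier
  reI zero    = 1#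
  reI (suc k) = - imI k
  imI zero    = 0#
  imI (suc k) = reI k

  reI-⊑ : ∀ k → reI k ⊑ 1#
  imI-⊑ : ∀ k → imI k ⊑ 1#
  reI-⊑ zero    = 0≤⇒⊑ (<⇒≤ 0<1) ≤-refl
  reI-⊑ (suc k) = ⊑-neg (imI-⊑ k)
  imI-⊑ zero    = 0≤⇒⊑ ≤-refl (<⇒≤ 0<1)
  imI-⊑ (suc k) = reI-⊑ k

  reI-+ : ∀ k l → reI (k ℕ.+ l) ≈ reI k * reI l - imI k * imI l
  imI-+ : ∀ k l → imI (k ℕ.+ l) ≈ imI k * reI l + reI k * imI l
  reI-+ zero    l = solve 2 (λ r i → r := num 1 :* r :- num 0 :* i) ≈-refl (reI l) (imI l)
  reI-+ (suc k) l = ≈-trans (-‿cong (imI-+ k l))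
    (solve 4 (λ r i r′ i′ → :- (i :* r′ :+ r :* i′) := :- i :* r′ :- r :* i′) ≈-refl (reI k) (imI k) (reI l) (imI l))
  imI-+ zero    l = solve 2 (λ r i → i := num 0 :* r :+ num 1 :* i) ≈-refl (reI l) (imI l)
  imI-+ (suc k) l = ≈-trans (reI-+ k l)
    (solve 4 (λ r i r′ i′ → r :* r′ :- i :* i′ := r :* r′ :+ :- i :* i′) ≈-refl (reI k) (imI k) (reI l) (imI l))

  ^-cong : ∀ k {x y} → x ≈ y → x ^ k ≈ y ^ k
  ^-cong zero    x≈y = ≈-refl
  ^-cong (suc k) x≈y = *-cong x≈y (^-cong k x≈y)

  dividedPower-cong : ∀ k {x y} → x ≈ y → dividedPower k x ≈ dividedPower k y
  dividedPower-cong k x≈y = *-congˡ (^-cong k x≈y)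

  powerSeries : (ℕ → Carrier) → Carrier → ℕ → Carrier
  powerSeries e x N = ∑ N (λ k → e k * dividedPower k x)

  powerSeries-converges : ∀ e → (∀ k → e k ⊑ 1#) → ∀ x → ∃[ l ] powerSeries e x ⟶ l
  powerSeries-converges e e⊑1 x = proj₁ sums , ⟶-resp
      (λ N → ∑-cong N {λ k → inverseFactorial k * (e k * x ^ k)} {λ k → e k * dividedPower k x} (λ k → swap _ _ _))
      ≈-refl (proj₂ sums)
    where
    swap : ∀ i e p → i * (e * p) ≈ e * (i * p)
    swap = solve 3 (λ i e p → i :* (e :* p) := e :* (i :* p)) ≈-refl
    B : ∃[ B ] x ⊑ fromℕ (suc B)
    B = ⊑-fromℕ x
    sums : ∃[ l ] (λ N → ∑ N (λ k → inverseFactorial k * (e k * x ^ k))) ⟶ l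
    sums = exponential-series-converges (⊑⇒0≤ (proj₂ B)) (λ k → e k * x ^ k)
      (λ k → ⊑-resp ≈-refl (*-identityˡ _) (⊑-* (e⊑1 k) (^-⊑ k (proj₂ B))))

  -- A module of its own keeps cos and sin opaque in the abstract blocks that follow.
  module CosineAndSine where
    abstract
      cos sin : Carrier → Carrier
      cos x = proj₁ (powerSeries-converges reI reI-⊑ x)
      sin x = proj₁ (powerSeries-converges imI imI-⊑ x)

      cos-limit : ∀ x → powerSeries reI x ⟶ cos x
      cos-limit x = proj₂ (powerSeries-converges reI reI-⊑ x)

      sin-limit : ∀ x → powerSeries imI x ⟶ sin x
      sin-limit x = proj₂ (powerSeries-converges imI imI-⊑ x)
  open CosineAndSine public

  powerSeries-cong : ∀ e {x y} → x ≈ y → ∀ N → powerSeries e x N ≈ powerSeries e y N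
  powerSeries-cong e x≈y N = ∑-cong N (λ k → *-congˡ {e k} (dividedPower-cong k x≈y))

  cos-cong : ∀ {x y} → x ≈ y → cos x ≈ cos y
  cos-cong {x} {y} x≈y = ⟶-unique (⟶-resp (powerSeries-cong reI x≈y) ≈-refl (cos-limit x)) (cos-limit y)

  sin-cong : ∀ {x y} → x ≈ y → sin x ≈ sin y
  sin-cong {x} {y} x≈y = ⟶-unique (⟶-resp (powerSeries-cong imI x≈y) ≈-refl (sin-limit x)) (sin-limit y)

  rectangle-product : ∀ N e f x y →
    rectangle N N (λ k l → (e k * f l) * powerProduct x y k l) ≈ powerSeries e x N * powerSeries f y N
  rectangle-product N e f x y = ≈-trans
    (∑-cong N (λ k → ∑-cong N (λ l → swap (e k) (f l) (dividedPower k x) (dividedPower l y))))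
    (∑-product N N (λ k → e k * dividedPower k x) (λ l → f l * dividedPower l y))
    where
    swap : ∀ a b c d → (a * b) * (c * d) ≈ (a * c) * (b * d)
    swap = solve 4 (λ a b c d → (a :* b) :* (c :* d) := (a :* c) :* (b :* d)) ≈-refl

  -- The coefficient of degree k + l is a sum of two products, so the square of the Cauchy product
  -- splits into two products of partial sums. The signs s = -1 and s = 1 give the formulas for
  -- cosine and sine.
  addition-formula : ∀ e (e⊑1 : ∀ k → e k ⊑ 1#) {a b c d s} → (∀ k l → e (k ℕ.+ l) ≈ a k * b l + s * (c k * d l)) →
    ∀ {x y A B C D L} → powerSeries a x ⟶ A → powerSeries b y ⟶ B → powerSeries c x ⟶ C → powerSeries d y ⟶ D →
    powerSeries e (x + y) ⟶ L → L ≈ A * B + s * (C * D)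
  addition-formula e e⊑1 {a} {b} {c} {d} {s} e-+ {x} {y} {A} {B} {C} {D} ⟶A ⟶B ⟶C ⟶D ⟶L = ⟶-unique ⟶L
    (⟶-null (cauchy-product e e⊑1 (proj₂ (⊑-fromℕ x)) (proj₂ (⊑-fromℕ y)))
      (⟶-resp (λ N → ≈-sym (square N)) ≈-refl (⟶-+ (⟶-* ⟶A ⟶B) (⟶-scale s (⟶-* ⟶C ⟶D)))))
    where
    expand : ∀ a b c d s p → (a * b + s * (c * d)) * p ≈ (a * b) * p + s * ((c * d) * p)
    expand = solve 6 (λ a b c d s p → (a :* b :+ s :* (c :* d)) :* p := (a :* b) :* p :+ s :* ((c :* d) :* p)) ≈-refl
    F G : ℕ → ℕ → Carrier
    F k l = (a k * b l) * powerProduct x y k l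
    G k l = (c k * d l) * powerProduct x y k l
    square : ∀ N → rectangle N N (λ k l → e (k ℕ.+ l) * powerProduct x y k l) ≈
             powerSeries a x N * powerSeries b y N + s * (powerSeries c x N * powerSeries d y N)
    square N = ≈-trans
      (∑-cong N {g = λ k → ∑ N (F k) + s * ∑ N (G k)} (λ k → ≈-trans
        (∑-cong N {g = λ l → F k l + s * G k l} (λ l → ≈-trans (*-congʳ (e-+ k l))
          (expand (a k) (b l) (c k) (d l) s (powerProduct x y k l))))
        (≈-trans (∑-+ N (F k) (λ l → s * G k l)) (+-congˡ (∑-scale N s (G k))))))
      (≈-trans (∑-+ N (λ k → ∑ N (F k)) (λ k → s * ∑ N (G k)))
        (+-cong (rectangle-product N a b x y) (≈-trans (∑-scale N s (λ k → ∑ N (G k))) (*-congˡ (rectangle-product N c d x y)))))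

  cos-+ : ∀ x y → cos (x + y) ≈ cos x * cos y - sin x * sin y
  cos-+ x y = ≈-trans
    (addition-formula reI reI-⊑ {reI} {reI} {imI} {imI} { - 1# }
      (λ k l → ≈-trans (reI-+ k l) (minus (reI k * reI l) (imI k * imI l)))
      (cos-limit x) (cos-limit y) (sin-limit x) (sin-limit y) (cos-limit (x + y)))
    (≈-sym (minus (cos x * cos y) (sin x * sin y)))
    where
    minus : ∀ a b → a - b ≈ a + - 1# * b
    minus = solve 2 (λ a b → a :- b := a :+ :- num 1 :* b) ≈-refl

  sin-+ : ∀ x y → sin (x + y) ≈ sin x * cos y + cos x * sin y
  sin-+ x y = ≈-trans
    (addition-formula imI imI-⊑ {imI} {reI} {reI} {imI} {1#}
      (λ k l → ≈-trans (imI-+ k l) (+-congˡ (≈-sym (*-identityˡ (reI k * imI l)))))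
      (sin-limit x) (cos-limit y) (cos-limit x) (sin-limit y) (sin-limit (x + y)))
    (+-congˡ (*-identityˡ (cos x * sin y)))

  cos-0 : cos 0# ≈ 1#
  -- The partial sum without terms is 0; after a shift by one the sequence is constantly 1.
  cos-0 = ⟶-unique (⟶-subsequence suc ℕ.n≤1+n (cos-limit 0#)) (⟶-resp (λ N → ≈-sym (partial N)) ≈-refl (⟶-const 1#))
    where
    vanish : ∀ e i p → e * (i * (0# * p)) ≈ 0# * e
    vanish = solve 3 (λ e i p → e :* (i :* (num 0 :* p)) := num 0 :* e) ≈-refl
    partial : ∀ N → powerSeries reI 0# (suc N) ≈ 1#
    partial N = ≈-trans (+-cong (≈-trans (*-identityˡ _) (dividedPower-0 0#))
      (≈-trans (∑-cong N {g = λ k → 0# * reI (suc k)} (λ k → vanish (reI (suc k)) (inverseFactorial (suc k)) (0# ^ k)))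
        (≈-trans (∑-scale N 0# (λ k → reI (suc k))) (zeroˡ _)))) (+-identityʳ 1#)

  -- iᵏ is real for even k and imaginary for odd k; the mutual induction with `imI-neg` replaces a
  -- distinction by parity.
  reI-neg : ∀ k x → reI k * (- x) ^ k ≈ reI k * x ^ k
  imI-neg : ∀ k x → imI k * (- x) ^ k ≈ - (imI k * x ^ k)
  reI-neg zero    x = ≈-refl
  reI-neg (suc k) x = ≈-trans (solve 3 (λ i x p → :- i :* (:- x :* p) := x :* (i :* p)) ≈-refl (imI k) x ((- x) ^ k))
    (≈-trans (*-congˡ (imI-neg k x)) (solve 3 (λ i x p → x :* :- (i :* p) := :- i :* (x :* p)) ≈-refl (imI k) x (x ^ k)))
  imI-neg zero    x = solve 0 (num 0 :* num 1 := :- (num 0 :* num 1)) ≈-refl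
  imI-neg (suc k) x = ≈-trans (solve 3 (λ i x p → i :* (:- x :* p) := :- x :* (i :* p)) ≈-refl (reI k) x ((- x) ^ k))
    (≈-trans (*-congˡ (reI-neg k x)) (solve 3 (λ i x p → :- x :* (i :* p) := :- (i :* (x :* p))) ≈-refl (reI k) x (x ^ k)))

  cos-neg : ∀ x → cos (- x) ≈ cos x
  cos-neg x = ⟶-unique (cos-limit (- x)) (⟶-resp (λ N → ∑-cong N (λ k → ≈-trans (swap (reI k) (inverseFactorial k) (x ^ k))
    (≈-trans (*-congˡ (≈-sym (reI-neg k x))) (≈-sym (swap (reI k) (inverseFactorial k) ((- x) ^ k)))))) ≈-refl (cos-limit x))
    where
    swap : ∀ e i p → e * (i * p) ≈ i * (e * p)
    swap = solve 3 (λ e i p → e :* (i :* p) := i :* (e :* p)) ≈-refl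

  sin-neg : ∀ x → sin (- x) ≈ - sin x
  sin-neg x = ⟶-unique (sin-limit (- x)) (⟶-resp (λ N → ≈-trans (≈-sym (∑-neg N (λ k → imI k * dividedPower k x)))
      (∑-cong N (λ k → ≈-trans (swap⁻ (imI k) (inverseFactorial k) (x ^ k))
      (≈-trans (*-congˡ (≈-sym (imI-neg k x))) (≈-sym (swap (imI k) (inverseFactorial k) ((- x) ^ k)))))))
      ≈-refl (⟶-neg (sin-limit x)))
    where
    swap : ∀ e i p → e * (i * p) ≈ i * (e * p)
    swap = solve 3 (λ e i p → e :* (i :* p) := i :* (e :* p)) ≈-refl
    swap⁻ : ∀ e i p → - (e * (i * p)) ≈ i * - (e * p)
    swap⁻ = solve 3 (λ e i p → :- (e :* (i :* p)) := i :* :- (e :* p)) ≈-refl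

  sin-0 : sin 0# ≈ 0#
  sin-0 = ≈-trans (solve 1 (λ s → s := con ½ :* (s :- :- s)) ≈-refl (sin 0#))
    (≈-trans (*-congˡ (+-congˡ (-‿cong (≈-trans (≈-sym (sin-neg 0#)) (sin-cong -0#≈0#)))))
    (solve 1 (λ s → con ½ :* (s :- s) := num 0) ≈-refl (sin 0#)))

  cos²+sin²≈1 : ∀ x → cos x * cos x + sin x * sin x ≈ 1#
  cos²+sin²≈1 x = ≈-trans (≈-trans (solve 2 (λ c s → c :* c :+ s :* s := c :* c :- s :* :- s) ≈-refl (cos x) (sin x))
    (+-cong (*-congˡ (≈-sym (cos-neg x))) (-‿cong (*-congˡ (≈-sym (sin-neg x))))))
    (≈-trans (≈-sym (cos-+ x (- x))) (≈-trans (cos-cong (-‿inverseʳ x)) cos-0))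

  cos-- : ∀ x y → cos (x - y) ≈ cos x * cos y + sin x * sin y
  cos-- x y = ≈-trans (cos-+ x (- y)) (≈-trans (+-cong (*-congˡ (cos-neg y)) (-‿cong (*-congˡ (sin-neg y))))
    (solve 4 (λ a b c d → a :* b :- c :* :- d := a :* b :+ c :* d) ≈-refl (cos x) (cos y) (sin x) (sin y)))

  sin-- : ∀ x y → sin (x - y) ≈ sin x * cos y - cos x * sin y
  sin-- x y = ≈-trans (sin-+ x (- y)) (≈-trans (+-cong (*-congˡ (cos-neg y)) (*-congˡ (sin-neg y)))
    (solve 4 (λ a b c d → a :* b :+ c :* :- d := a :* b :- c :* d) ≈-refl (sin x) (cos y) (cos x) (sin y)))

  ∑-pairs : ∀ N f → ∑ (2 ℕ.* N) f ≈ ∑ N (λ k → f (2 ℕ.* k) + f (2 ℕ.* k ℕ.+ 1))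
  ∑-pairs zero    f = ≈-refl
  ∑-pairs (suc N) f = ≈-trans (≈-reflexive (≡.cong (λ M → ∑ M f) (ℕ.*-suc 2 N)))
    (≈-trans (∑-last (suc (2 ℕ.* N)) f) (≈-trans (+-congʳ (∑-last (2 ℕ.* N) f))
    (≈-trans (+-assoc _ _ _) (≈-trans
      (+-cong (∑-pairs N f) (+-congˡ {f (2 ℕ.* N)} (≈-reflexive (≡.cong f (ℕ.+-comm 1 (2 ℕ.* N))))))
      (≈-sym (∑-last N (λ k → f (2 ℕ.* k) + f (2 ℕ.* k ℕ.+ 1))))))))

  reI-even : ∀ k → reI (2 ℕ.* k) ≈ (- 1#) ^ k
  reI-even zero    = ≈-refl
  reI-even (suc k) = ≈-trans (≈-reflexive (≡.cong reI (ℕ.*-suc 2 k)))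
    (≈-trans (-‿cong (reI-even k)) (solve 1 (λ p → :- p := :- num 1 :* p) ≈-refl _))

  imI-even : ∀ k → imI (2 ℕ.* k) ≈ 0#
  imI-even zero    = ≈-refl
  imI-even (suc k) = ≈-trans (≈-reflexive (≡.cong imI (ℕ.*-suc 2 k))) (≈-trans (-‿cong (imI-even k)) -0#≈0#)

  cos-alternating : ∀ x → (λ N → ∑ N (λ k → (- 1#) ^ k * dividedPower (2 ℕ.* k) x)) ⟶ cos x
  cos-alternating x = ⟶-resp pairs ≈-refl (⟶-subsequence (2 ℕ.*_) (λ N → ℕ.m≤m+n N _) (cos-limit x))
    where
    pairs : ∀ N → powerSeries reI x (2 ℕ.* N) ≈ ∑ N (λ k → (- 1#) ^ k * dividedPower (2 ℕ.* k) x)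
    pairs N = ≈-trans (∑-pairs N (λ k → reI k * dividedPower k x)) (∑-cong N (λ k →
      ≈-trans (+-cong (*-congʳ {dividedPower (2 ℕ.* k) x} (reI-even k)) (≈-trans (*-congʳ (≈-trans (≈-reflexive (≡.cong reI (ℕ.+-comm (2 ℕ.* k) 1)))
        (≈-trans (-‿cong (imI-even k)) -0#≈0#))) (zeroˡ (dividedPower (2 ℕ.* k ℕ.+ 1) x))))
      (+-identityʳ _)))

  -- Taking the terms in pairs removes those of even index and leaves the series that defines
  -- `IsSin`.
  sin-alternating : ∀ x → (λ N → ∑ N (λ k → (- 1#) ^ k * dividedPower (2 ℕ.* k ℕ.+ 1) x)) ⟶ sin x
  sin-alternating x = ⟶-resp pairs ≈-refl (⟶-subsequence (2 ℕ.*_) (λ N → ℕ.m≤m+n N _) (sin-limit x))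
    where
    pairs : ∀ N → powerSeries imI x (2 ℕ.* N) ≈ ∑ N (λ k → (- 1#) ^ k * dividedPower (2 ℕ.* k ℕ.+ 1) x)
    pairs N = ≈-trans (∑-pairs N (λ k → imI k * dividedPower k x)) (∑-cong N (λ k →
      ≈-trans (+-cong (≈-trans (*-congʳ (imI-even k)) (zeroˡ (dividedPower (2 ℕ.* k) x)))
        (*-congʳ {dividedPower (2 ℕ.* k ℕ.+ 1) x} (≈-trans (≈-reflexive (≡.cong imI (ℕ.+-comm (2 ℕ.* k) 1))) (reI-even k))))
      (+-identityˡ _)))

  -- Alternating series and Taylor bounds on [0, 2].

  alternating : (ℕ → Carrier) → ℕ → Carrier
  alternating a N = ∑ N (λ k → (- 1#) ^ k * a k)

  alternating-suc : ∀ a N → alternating a (suc N) ≈ a 0 - alternating (a ∘ suc) N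
  alternating-suc a N = +-cong (*-identityˡ (a 0))
    (≈-trans (∑-cong N {λ k → (- 1#) ^ suc k * a (suc k)} {λ k → - 1# * ((- 1#) ^ k * a (suc k))} (λ k → *-assoc (- 1#) ((- 1#) ^ k) (a (suc k))))
    (≈-trans (∑-scale N (- 1#) (λ k → (- 1#) ^ k * a (suc k))) (solve 1 (λ s → :- num 1 :* s := :- s) ≈-refl _)))

  -- Splitting off the first term leaves a 0 minus an alternating sum of the same kind; the upper
  -- bound for a follows from the lower bound for the shifted sequence and conversely.
  alternating-≤ : ∀ {a} → (∀ k → 0# ≤ a k) → (∀ k → a (suc k) ≤ a k) → ∀ N → alternating a N ≤ a 0
  0≤-alternating : ∀ {a} → (∀ k → 0# ≤ a k) → (∀ k → a (suc k) ≤ a k) → ∀ N → 0# ≤ alternating a N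
  alternating-≤ 0≤a mono zero = 0≤a 0
  alternating-≤ {a} 0≤a mono (suc N) = ≤-by (0≤-alternating {a ∘ suc} (0≤a ∘ suc) (mono ∘ suc) N)
    (≈-trans (+-congˡ (-‿cong (alternating-suc a N))) (cancel (a 0) (alternating (a ∘ suc) N)))
    where
    cancel : ∀ x y → x - (x - y) ≈ y
    cancel = solve 2 (λ x y → x :- (x :- y) := y) ≈-refl
  0≤-alternating 0≤a mono zero = ≤-refl
  0≤-alternating {a} 0≤a mono (suc N) = ≤-resp ≈-refl (≈-sym (alternating-suc a N))
    (x≤y⇒0≤y-x (≤-trans (alternating-≤ {a ∘ suc} (0≤a ∘ suc) (mono ∘ suc) N) (mono 0)))

  alternating-limit : ∀ {a l} → (∀ k → 0# ≤ a k) → (∀ k → a (suc k) ≤ a k) → alternating a ⟶ l →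
    a 0 - a 1 ≤ l × l ≤ a 0
  alternating-limit {a} {l} 0≤a mono a⟶l =
    ⟶-≥ (⟶-subsequence suc ℕ.n≤1+n a⟶l) (λ N → ≤-resp ≈-refl (≈-sym (alternating-suc a N))
      (+-mono-≤ ≤-refl (neg-≤ (alternating-≤ {a ∘ suc} (0≤a ∘ suc) (mono ∘ suc) N)))) ,
    ⟶-≤ a⟶l (alternating-≤ {a} 0≤a mono)

  module _ {x : Carrier} (0≤x : 0# ≤ x) (x≤2 : x ≤ fromℕ 2) where
    private
      D : ℕ → Carrier
      D k = dividedPower k x

      -- Consecutive terms differ by the factor x/(k + 2), which is at most 1 because x ≤ 2.
      D-decreasing : ∀ k → D (2 ℕ.+ k) ≤ D (suc k)
      D-decreasing k = ≤-by (*-cancel-0≤ (0<fromℕ (suc k)) (≤-resp ≈-refl identity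
          (0≤-* (x≤y⇒0≤y-x (≤-trans x≤2 (fromℕ-mono-≤ (ℕ.s≤s (ℕ.s≤s (ℕ.z≤n {k})))))) (0≤-dividedPower (suc k) 0≤x)))) ≈-refl
        where
        rearrange : ∀ n x d → (n - x) * d ≈ n * d - x * d
        rearrange = solve 3 (λ n x d → (n :- x) :* d := n :* d :- x :* d) ≈-refl
        factor : ∀ n d d′ → n * d - n * d′ ≈ n * (d - d′)
        factor = solve 3 (λ n d d′ → n :* d :- n :* d′ := n :* (d :- d′)) ≈-refl
        identity : (fromℕ (2 ℕ.+ k) - x) * D (suc k) ≈ fromℕ (2 ℕ.+ k) * (D (suc k) - D (2 ℕ.+ k))
        identity = ≈-trans (rearrange _ x (D (suc k))) (≈-trans (+-congˡ (-‿cong (≈-sym (dividedPower-suc (suc k) x)))) (factor _ _ _))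

      D-decreasing₂ : ∀ k → D (3 ℕ.+ k) ≤ D (suc k)
      D-decreasing₂ k = ≤-trans (D-decreasing (suc k)) (D-decreasing k)

      index : ∀ k → suc (2 ℕ.* k) ≡ 2 ℕ.* k ℕ.+ 1
      index k = ℕ.+-comm 1 (2 ℕ.* k)

      D1 : D 1 ≈ x
      D1 = ≈-trans (*-congʳ fromℚ-1) (solve 1 (λ x → num 1 :* (x :* num 1) := x) ≈-refl x)
      D2 : D 2 ≈ fromℚ ½ * (x * x)
      D2 = solve 1 (λ x → con ½ :* (x :* (x :* num 1)) := con ½ :* (x :* x)) ≈-refl x
      D3 : D 3 ≈ fromℚ (+ 1 / 6) * (x * x * x)
      D3 = solve 1 (λ x → con (+ 1 / 6) :* (x :* (x :* (x :* num 1))) := con (+ 1 / 6) :* (x :* x :* x)) ≈-refl x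
      D4 : D 4 ≈ fromℚ (+ 1 / 24) * ((x * x) * (x * x))
      D4 = solve 1 (λ x → con (+ 1 / 24) :* (x :* (x :* (x :* (x :* num 1)))) := con (+ 1 / 24) :* ((x :* x) :* (x :* x))) ≈-refl x

    sin-bounds : x - fromℚ (+ 1 / 6) * (x * x * x) ≤ sin x × sin x ≤ x
    sin-bounds = ≤-resp (+-cong D1 (-‿cong D3)) ≈-refl (proj₁ bounds) , ≤-resp ≈-refl D1 (proj₂ bounds)
      where
      bounds : D 1 - D 3 ≤ sin x × sin x ≤ D 1
      bounds = alternating-limit {λ k → D (2 ℕ.* k ℕ.+ 1)} (λ k → 0≤-dividedPower (2 ℕ.* k ℕ.+ 1) 0≤x)
        (λ k → ≡.subst₂ (λ m n → D m ≤ D n) (index (suc k)) (index k)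
          (≡.subst (λ m → D (suc m) ≤ D (suc (2 ℕ.* k))) (≡.sym (ℕ.*-suc 2 k)) (D-decreasing₂ (2 ℕ.* k))))
        (sin-alternating x)

    -- The terms of the cosine series decrease only from x²/2 on.
    cos-bounds : 1# - fromℚ ½ * (x * x) ≤ cos x × cos x ≤ 1# - fromℚ ½ * (x * x) + fromℚ (+ 1 / 24) * ((x * x) * (x * x))
    cos-bounds =
      ≤-by (x≤y⇒0≤y-x (proj₂ bounds)) (≈-trans (rearrange _ _ _) (+-congʳ (≈-sym D2))) ,
      ≤-by (x≤y⇒0≤y-x (proj₁ bounds)) (≈-trans (rearrange′ _ _ _ _) (+-congˡ (-‿cong (+-cong (≈-sym D2) (-‿cong (≈-sym D4))))))
      where
      rearrange : ∀ a b c → c - (a - b) ≈ b - (a - c)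
      rearrange = solve 3 (λ a b c → c :- (a :- b) := b :- (a :- c)) ≈-refl
      rearrange′ : ∀ a b d c → (a - b + d) - c ≈ (a - c) - (b - d)
      rearrange′ = solve 4 (λ a b d c → (a :- b :+ d) :- c := (a :- c) :- (b :- d)) ≈-refl
      a : ℕ → Carrier
      a k = D (2 ℕ.* k)
      shifted : alternating (a ∘ suc) ⟶ 1# - cos x
      shifted = ⟶-resp (λ N → ≈-trans (+-congˡ (-‿cong (alternating-suc a N))) (≈-trans (+-congʳ (≈-sym (dividedPower-0 x)))
          (solve 2 (λ x y → x :- (x :- y) := y) ≈-refl (D 0) (alternating (a ∘ suc) N)))) ≈-refl
        (⟶-+ (⟶-const 1#) (⟶-neg (⟶-subsequence suc ℕ.n≤1+n (cos-alternating x))))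
      bounds : D 2 - D 4 ≤ 1# - cos x × 1# - cos x ≤ D 2
      bounds = alternating-limit {a ∘ suc} (λ k → 0≤-dividedPower (2 ℕ.* suc k) 0≤x)
        (λ k → ≡.subst (λ m → D m ≤ D (2 ℕ.* suc k)) (≡.sym (ℕ.*-suc 2 (suc k)))
          (≡.subst (λ m → D (2 ℕ.+ m) ≤ D m) (≡.sym (ℕ.*-suc 2 k)) (D-decreasing₂ (suc (2 ℕ.* k)))))
        shifted

  ⊑-stable : ∀ {x b} → ¬ ¬ x ⊑ b → x ⊑ b
  ⊑-stable nn = bounded (λ lt → nn (λ p → lower p lt)) (λ lt → nn (λ p → upper p lt))

  -- The sign of x is undecidable, but for a stable property that passes from -x to x the case x ≥ 0
  -- is enough.
  by-sign : ∀ {A : Carrier → Set} → (∀ x → ¬ ¬ A x → A x) → (∀ x → 0# ≤ x → A x) → (∀ x → A (- x) → A x) → ∀ x → A x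
  by-sign stable nonneg even x = stable x λ ¬Ax → ¬Ax (even x (nonneg (- x) λ -x<0 → ¬Ax (nonneg x
    (λ x<0 → <-asym -x<0 (neg-flip x<0)))))

  0≤-const : ∀ q → {_ : True (0ℚ ℚ.≤? q)} → 0# ≤ fromℚ q
  0≤-const q {t} = 0≤fromℚ (toWitness t)

  0<-const : ∀ q → {_ : True (0ℚ ℚ.<? q)} → 0# < fromℚ q
  0<-const q {t} = 0<fromℚ (toWitness t)

  *-mono-≤ : ∀ {x y u v} → 0# ≤ x → 0# ≤ u → x ≤ y → u ≤ v → x * u ≤ y * v
  *-mono-≤ 0≤x 0≤u x≤y u≤v = upper (⊑-* (0≤⇒⊑ 0≤x x≤y) (0≤⇒⊑ 0≤u u≤v))

  -- Makes the lower bound x (6 - x²)/6 of the sine positive on (0, 2].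
  6-x²-positive : ∀ {x} → 0# ≤ x → x ≤ fromℕ 2 → 0# < fromℕ 6 - x * x
  6-x²-positive {x} 0≤x x≤2 = <-respʳ (solve 1 (λ x → num 2 :+ (num 2 :* num 2 :- x :* x) := num 6 :- x :* x) ≈-refl x)
    (0<-+-≤ (0<fromℕ 1) (x≤y⇒0≤y-x (*-mono-≤ 0≤x 0≤x x≤2 x≤2)))

  factor-sin-bound : ∀ x → fromℚ (+ 1 / 6) * (fromℕ 6 - x * x) * x ≈ x - fromℚ (+ 1 / 6) * (x * x * x)
  factor-sin-bound = solve 1 (λ x → con (+ 1 / 6) :* (num 6 :- x :* x) :* x := x :- con (+ 1 / 6) :* (x :* x :* x)) ≈-refl

  0≤-sin : ∀ {x} → 0# ≤ x → x ≤ fromℕ 2 → 0# ≤ sin x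
  0≤-sin {x} 0≤x x≤2 = ≤-trans (≤-resp ≈-refl (factor-sin-bound x)
    (0≤-* (0≤-* (0≤-const (+ 1 / 6)) (<⇒≤ (6-x²-positive 0≤x x≤2))) 0≤x)) (proj₁ (sin-bounds 0≤x x≤2))

  0<-sin : ∀ {x} → 0# < x → x ≤ fromℕ 2 → 0# < sin x
  0<-sin {x} 0<x x≤2 = <-≤-trans (<-respʳ (factor-sin-bound x)
    (*-pos (*-pos (0<-const (+ 1 / 6)) (6-x²-positive (<⇒≤ 0<x) x≤2)) 0<x)) (proj₁ (sin-bounds (<⇒≤ 0<x) x≤2))

  cos²≤1 : ∀ x → cos x * cos x ≤ 1#
  cos²≤1 x = ≤-by (0≤-square (sin x)) (≈-trans (+-congʳ (≈-sym (cos²+sin²≈1 x)))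
    (solve 2 (λ c s → (c :* c :+ s :* s) :- c :* c := s :* s) ≈-refl (cos x) (sin x)))

  sin²≤1 : ∀ x → sin x * sin x ≤ 1#
  sin²≤1 x = ≤-by (0≤-square (cos x)) (≈-trans (+-congʳ (≈-sym (cos²+sin²≈1 x)))
    (solve 2 (λ c s → (c :* c :+ s :* s) :- s :* s := c :* c) ≈-refl (cos x) (sin x)))

  x²≤1⇒x≤1 : ∀ {x} → x * x ≤ 1# → x ≤ 1#
  x²≤1⇒x≤1 {x} x²≤1 1<x = x²≤1 (<-by (*-pos 0<x-1 (0<-+-≤ 0<x-1 (0≤fromℕ 2)))
    (solve 1 (λ x → x :* x :- num 1 := (x :- num 1) :* ((x :- num 1) :+ num 2)) ≈-refl x))
    where
    0<x-1 : 0# < x - 1#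
    0<x-1 = x<y⇒0<y-x 1<x

  x²≤1⇒x⊑1 : ∀ {x} → x * x ≤ 1# → x ⊑ 1#
  x²≤1⇒x⊑1 {x} x²≤1 = bounded
    (≤-resp ≈-refl (-‿involutive x) (neg-≤ (x²≤1⇒x≤1 (≤-resp (solve 1 (λ x → x :* x := :- x :* :- x) ≈-refl x) ≈-refl x²≤1))))
    (x²≤1⇒x≤1 x²≤1)

  cos-⊑1 : ∀ x → cos x ⊑ 1#
  cos-⊑1 x = x²≤1⇒x⊑1 (cos²≤1 x)

  sin-⊑1 : ∀ x → sin x ⊑ 1#
  sin-⊑1 x = x²≤1⇒x⊑1 (sin²≤1 x)

  sin-⊑ : ∀ {b} → b ≤ fromℕ 2 → ∀ x → x ⊑ b → sin x ⊑ b
  sin-⊑ {b} b≤2 = by-sign (λ x nn x⊑b → ⊑-stable (λ ¬p → nn (λ f → ¬p (f x⊑b))))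
    (λ x 0≤x x⊑b → let x≤2 = ≤-trans (upper x⊑b) b≤2 in
      0≤⇒⊑ (0≤-sin 0≤x x≤2) (≤-trans (proj₂ (sin-bounds 0≤x x≤2)) (upper x⊑b)))
    (λ x f x⊑b → ⊑-resp (≈-trans (-‿cong (sin-neg x)) (-‿involutive _)) ≈-refl (⊑-neg (f (⊑-neg x⊑b))))

  -- The Taylor bound x³/6, coarsened to b³; it enters the contraction estimate `cos-step`.
  x-sin-⊑ : ∀ {b} → b ≤ fromℕ 2 → ∀ x → x ⊑ b → x - sin x ⊑ b * b * b
  x-sin-⊑ {b} b≤2 = by-sign (λ x nn x⊑b → ⊑-stable (λ ¬p → nn (λ f → ¬p (f x⊑b)))) nonneg
    (λ x f x⊑b → ⊑-resp (≈-trans (-‿cong (+-congˡ (-‿cong (sin-neg x)))) (flip x (sin x))) ≈-refl (⊑-neg (f (⊑-neg x⊑b))))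
    where
    flip : ∀ x s → - (- x - - s) ≈ x - s
    flip = solve 2 (λ x s → :- (:- x :- :- s) := x :- s) ≈-refl
    nonneg : ∀ x → 0# ≤ x → x ⊑ b → x - sin x ⊑ b * b * b
    nonneg x 0≤x x⊑b = 0≤⇒⊑ (x≤y⇒0≤y-x (proj₂ bounds)) (≤-trans (≤-by (0≤-+ (x≤y⇒0≤y-x (proj₁ bounds))
        (0≤-* (0≤-const (+ 5 / 6)) (0≤-* (0≤-* 0≤x 0≤x) 0≤x))) (identity x (sin x)))
      (*-mono-≤ (0≤-* 0≤x 0≤x) 0≤x (*-mono-≤ 0≤x 0≤x x≤b x≤b) x≤b))
      where
      x≤b : x ≤ b
      x≤b = upper x⊑b
      bounds : x - fromℚ (+ 1 / 6) * (x * x * x) ≤ sin x × sin x ≤ x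
      bounds = sin-bounds 0≤x (≤-trans x≤b b≤2)
      identity : ∀ x s → x * x * x - (x - s) ≈ (s - (x - fromℚ (+ 1 / 6) * (x * x * x))) + fromℚ (+ 5 / 6) * (x * x * x)
      identity = solve 2 (λ x s → x :* x :* x :- (x :- s) :=
        (s :- (x :- con (+ 1 / 6) :* (x :* x :* x))) :+ con (+ 5 / 6) :* (x :* x :* x)) ≈-refl

  1-cos-⊑ : ∀ {b} → b ≤ fromℕ 2 → ∀ x → x ⊑ b → 1# - cos x ⊑ b * b
  1-cos-⊑ {b} b≤2 = by-sign (λ x nn x⊑b → ⊑-stable (λ ¬p → nn (λ f → ¬p (f x⊑b)))) nonneg
    (λ x f x⊑b → ⊑-resp (+-congˡ (-‿cong (cos-neg x))) ≈-refl (f (⊑-neg x⊑b)))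
    where
    identity : ∀ x c → x * x - (1# - c) ≈ (c - (1# - fromℚ ½ * (x * x))) + fromℚ ½ * (x * x)
    identity = solve 2 (λ x c → x :* x :- (num 1 :- c) := (c :- (num 1 :- con ½ :* (x :* x))) :+ con ½ :* (x :* x)) ≈-refl
    nonneg : ∀ x → 0# ≤ x → x ⊑ b → 1# - cos x ⊑ b * b
    nonneg x 0≤x x⊑b = 0≤⇒⊑ (x≤y⇒0≤y-x (upper (cos-⊑1 x))) (≤-trans
      (≤-by (0≤-+ (x≤y⇒0≤y-x (proj₁ (cos-bounds 0≤x (≤-trans (upper x⊑b) b≤2)))) (0≤-* (0≤-const ½) (0≤-square x))) (identity x (cos x)))
      (*-mono-≤ 0≤x 0≤x (upper x⊑b) (upper x⊑b)))

  -- Construction of π/2.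

  -- The iteration x ↦ x + cos x converges to π/2: with c = cos x and s = sin x, the next cosine is
  -- c cos c - s sin c = s (c - sin c) + c (1 - s) - c (1 - cos c), of order c³.
  approximation : ℕ → Carrier
  approximation zero    = fromℚ (+ 3 / 2)
  approximation (suc n) = approximation n + cos (approximation n)

  -- Bounds the cosine at the n-th approximation, that is, the length of the next step; being
  -- geometric, the steps from n on add up to at most twice `radius n`.
  radius : ℕ → Carrier
  radius zero    = fromℚ (+ 1 / 8)
  radius (suc n) = fromℚ ½ * radius n

  0≤radius : ∀ n → 0# ≤ radius n
  0≤radius zero    = 0≤-const (+ 1 / 8)
  0≤radius (suc n) = 0≤-* (0≤-const ½) (0≤radius n)

  radius≤⅛ : ∀ n → radius n ≤ fromℚ (+ 1 / 8)
  radius≤⅛ zero    = ≤-refl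
  radius≤⅛ (suc n) = ≤-trans (≤-by (0≤-* (0≤-const ½) (0≤radius n)) (solve 1 (λ r → r :- con ½ :* r := con ½ :* r) ≈-refl (radius n)))
    (radius≤⅛ n)

  cos-step : ∀ {x b} → 0# ≤ b → b ≤ fromℚ (+ 1 / 8) → 0# ≤ sin x → cos x ⊑ b → cos (x + cos x) ⊑ fromℚ ½ * b
  cos-step {x} {b} 0≤b b≤⅛ 0≤s c⊑b = ⊑-resp (≈-sym (≈-trans (cos-+ x c) (split c s (cos c) (sin c)))) ≈-refl
    (⊑-trans (⊑-+ (⊑-+ (⊑-* (sin-⊑1 x) (x-sin-⊑ b≤2 c c⊑b)) (⊑-* c⊑b 1-s⊑)) (⊑-neg (⊑-* c⊑b (1-cos-⊑ b≤2 c c⊑b))))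
      -- The three error terms add up to 3b³, and b ≤ 1/8 gives 3b² ≤ 3/64; the constant is 29/64 =
      -- 1/2 - 3/64.
      (≤-by (0≤-* 0≤b (0≤-+ (0≤-const (+ 29 / 64)) (0≤-* (0≤fromℕ 3) (x≤y⇒0≤y-x (*-mono-≤ 0≤b 0≤b b≤⅛ b≤⅛))))) (bound b)))
    where
    c s : Carrier
    c = cos x
    s = sin x
    b≤2 : b ≤ fromℕ 2
    b≤2 = ≤-trans b≤⅛ (fromℚ-mono-≤ (toWitness {a? = (+ 1 / 8) ℚ.≤? (+ 2 / 1)} _))
    split : ∀ c s u v → c * u - s * v ≈ s * (c - v) + c * (1# - s) - c * (1# - u)
    split = solve 4 (λ c s u v → c :* u :- s :* v := s :* (c :- v) :+ c :* (num 1 :- s) :- c :* (num 1 :- u)) ≈-refl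
    -- By c² + s² = 1 and 0 ≤ s ≤ 1, the difference c² - (1 - s) = s (1 - s) is nonnegative.
    1-s⊑ : 1# - s ⊑ b * b
    1-s⊑ = 0≤⇒⊑ (x≤y⇒0≤y-x s≤1) (≤-trans (≤-by (0≤-* 0≤s (x≤y⇒0≤y-x s≤1))
        (≈-trans (solve 2 (λ c s → c :* c :- (num 1 :- s) := (c :* c :+ s :* s) :- num 1 :+ s :* (num 1 :- s)) ≈-refl c s)
          (≈-trans (+-congʳ (≈-trans (+-congʳ (cos²+sin²≈1 x)) (-‿inverseʳ 1#))) (+-identityˡ _))))
      (upper (⊑-* c⊑b c⊑b)))
      where
      s≤1 : s ≤ 1#
      s≤1 = upper (sin-⊑1 x)
    bound : ∀ b → fromℚ ½ * b - (1# * (b * b * b) + b * (b * b) + b * (b * b)) ≈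
      b * (fromℚ (+ 29 / 64) + fromℕ 3 * (fromℚ (+ 1 / 8) * fromℚ (+ 1 / 8) - b * b))
    bound = solve 1 (λ b → con ½ :* b :- (num 1 :* (b :* b :* b) :+ b :* (b :* b) :+ b :* (b :* b)) :=
      b :* (con (+ 29 / 64) :+ num 3 :* (con (+ 1 / 8) :* con (+ 1 / 8) :- b :* b))) ≈-refl

  near-3/2⇒[0,2] : ∀ {x} → x - fromℚ (+ 3 / 2) ⊑ fromℚ (+ 1 / 4) → 0# < x × x ≤ fromℕ 2
  near-3/2⇒[0,2] {x} (bounded l u) =
    <-respʳ (solve 1 (λ x → num 1 :+ (con (+ 1 / 4) :+ (x :- con (+ 3 / 2) :- :- con (+ 1 / 4))) := x) ≈-refl x)
      (0<-+-≤ 0<1 (0≤-+ (0≤-const (+ 1 / 4)) (x≤y⇒0≤y-x l))) ,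
    ≤-by (0≤-+ (x≤y⇒0≤y-x u) (0≤-const (+ 1 / 4)))
      (solve 1 (λ x → num 2 :- x := (con (+ 1 / 4) :- (x :- con (+ 3 / 2))) :+ con (+ 1 / 4)) ≈-refl x)

  swap-last : ∀ a b c → (a - b) + c ≈ (a + c) - b
  swap-last = solve 3 (λ a b c → (a :- b) :+ c := (a :+ c) :- b) ≈-refl

  radius-telescope : ∀ r s → (fromℕ 2 * r - fromℕ 2 * s) + s ≈ fromℕ 2 * r - fromℕ 2 * (fromℚ ½ * s)
  radius-telescope = solve 2 (λ r s → (num 2 :* r :- num 2 :* s) :+ s := num 2 :* r :- num 2 :* (con ½ :* s)) ≈-refl

  2r-2s≤2r : ∀ r {s} → 0# ≤ s → fromℕ 2 * r - fromℕ 2 * s ≤ fromℕ 2 * r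
  2r-2s≤2r r {s} 0≤s = ≤-by (0≤-* (0≤fromℕ 2) 0≤s) (cancel r s)
    where
    cancel : ∀ r s → fromℕ 2 * r - (fromℕ 2 * r - fromℕ 2 * s) ≈ fromℕ 2 * s
    cancel = solve 2 (λ r s → num 2 :* r :- (num 2 :* r :- num 2 :* s) := num 2 :* s) ≈-refl

  within-¼ : ∀ {x n} → x ⊑ fromℕ 2 * radius 0 - fromℕ 2 * radius n → x ⊑ fromℚ (+ 1 / 4)
  within-¼ {n = n} x⊑ = ⊑-resp ≈-refl (solve 0 (num 2 :* con (+ 1 / 8) := con (+ 1 / 4)) ≈-refl)
    (⊑-trans x⊑ (2r-2s≤2r (radius 0) (0≤radius n)))

  -- Proved together with `cos-approximation`: the total drift from 3/2 stays within 2 · 1/8, which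
  -- keeps the approximation in [0, 2], where the sine is nonnegative and the next cosine can be
  -- bounded.
  approximation-near : ∀ n → approximation n - fromℚ (+ 3 / 2) ⊑ fromℕ 2 * radius 0 - fromℕ 2 * radius n
  cos-approximation : ∀ n → cos (approximation n) ⊑ radius n
  approximation-near zero    = ⊑-resp (≈-sym (-‿inverseʳ _)) (≈-sym (-‿inverseʳ _)) (0≤⇒⊑ ≤-refl ≤-refl)
  approximation-near (suc n) = ⊑-resp (swap-last _ _ _) (radius-telescope (radius 0) (radius n))
    (⊑-+ (approximation-near n) (cos-approximation n))
  cos-approximation zero = bounded
      -- At 3/2 the Taylor bounds for the cosine are -1/8 and 11/128.
      (≤-trans (≤-by ≤-refl (solve 0 ((num 1 :- con ½ :* (con (+ 3 / 2) :* con (+ 3 / 2))) :- :- con (+ 1 / 8) := num 0) ≈-refl)) (proj₁ bounds))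
      (≤-trans (proj₂ bounds) (≤-by (0≤-const (+ 5 / 128))
        (solve 0 (con (+ 1 / 8) :- (num 1 :- con ½ :* (con (+ 3 / 2) :* con (+ 3 / 2)) :+
          con (+ 1 / 24) :* ((con (+ 3 / 2) :* con (+ 3 / 2)) :* (con (+ 3 / 2) :* con (+ 3 / 2)))) := con (+ 5 / 128)) ≈-refl)))
    where
    x : Carrier
    x = fromℚ (+ 3 / 2)
    bounds : 1# - fromℚ ½ * (x * x) ≤ cos x × cos x ≤ 1# - fromℚ ½ * (x * x) + fromℚ (+ 1 / 24) * ((x * x) * (x * x))
    bounds = cos-bounds (0≤-const (+ 3 / 2)) (fromℚ-mono-≤ (toWitness {a? = (+ 3 / 2) ℚ.≤? (+ 2 / 1)} _))
  cos-approximation (suc n) = cos-step (0≤radius n) (radius≤⅛ n) (0≤-sin (<⇒≤ (proj₁ in-range)) (proj₂ in-range)) (cos-approximation n)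
    where
    in-range : 0# < approximation n × approximation n ≤ fromℕ 2
    in-range = near-3/2⇒[0,2] (within-¼ {n = n} (approximation-near n))

  approximation-tail : ∀ N j → approximation (N ℕ.+ j) - approximation N ⊑ fromℕ 2 * radius N - fromℕ 2 * radius (N ℕ.+ j)
  approximation-tail N zero = ≡.subst (λ n → approximation n - approximation N ⊑ fromℕ 2 * radius N - fromℕ 2 * radius n)
    (≡.sym (ℕ.+-identityʳ N)) (⊑-resp (≈-sym (-‿inverseʳ _)) (≈-sym (-‿inverseʳ _)) (0≤⇒⊑ ≤-refl ≤-refl))
  approximation-tail N (suc j) = ≡.subst (λ n → approximation n - approximation N ⊑ fromℕ 2 * radius N - fromℕ 2 * radius n)
    (≡.sym (ℕ.+-suc N j)) (⊑-resp (swap-last _ _ _) (radius-telescope (radius N) (radius (N ℕ.+ j)))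
      (⊑-+ (approximation-tail N j) (cos-approximation (N ℕ.+ j))))

  approximation-error : ∀ N j → approximation (N ℕ.+ j) - approximation N ⊑ fromℕ 2 * radius N
  approximation-error N j = ⊑-trans (approximation-tail N j) (2r-2s≤2r (radius N) (0≤radius (N ℕ.+ j)))

  n*radius≤⅛ : ∀ n → fromℕ (suc n) * radius n ≤ fromℚ (+ 1 / 8)
  n*radius≤⅛ zero    = ≈⇒≤ (≈-trans (*-congʳ fromℚ-1) (*-identityˡ _))
  n*radius≤⅛ (suc n) = ≤-trans (≤-by (0≤-* (0≤-* (0≤-const ½) (0≤fromℕ n)) (0≤radius n))
      (≈-trans (+-cong (*-congʳ (fromℕ-suc n)) (-‿cong (*-congʳ (≈-trans (fromℕ-suc (suc n)) (+-congˡ (fromℕ-suc n))))))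
        (halve (fromℕ n) (radius n))))
    (n*radius≤⅛ n)
    where
    halve : ∀ n r → (1# + n) * r - (1# + (1# + n)) * (fromℚ ½ * r) ≈ fromℚ ½ * n * r
    halve = solve 2 (λ n r → (num 1 :+ n) :* r :- (num 1 :+ (num 1 :+ n)) :* (con ½ :* r) := con ½ :* n :* r) ≈-refl

  radius-null : Null radius
  radius-null = null-reciprocal {C = fromℚ (+ 1 / 8)} 0≤radius (λ n → ≤-trans
    (≤-by (0≤radius n) (≈-trans (+-congʳ (*-congʳ (fromℕ-suc n))) (solve 2 (λ n r → (num 1 :+ n) :* r :- n :* r := r) ≈-refl (fromℕ n) (radius n))))
    (n*radius≤⅛ n))

  module HalfPi where
    abstract
      halfπ-limit : ∃[ p ] approximation ⟶ p
      halfπ-limit = dominated-converges approximation approximation-error (null-scale (fromℕ 2) radius-null)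
  open HalfPi public

  halfπ : Carrier
  halfπ = proj₁ halfπ-limit

  halfπ-error : ∀ n → halfπ - approximation n ⊑ fromℕ 2 * radius n
  halfπ-error n = ⟶-⊑ (⟶-+ (⟶-subsequence (n ℕ.+_) (λ j → ℕ.m≤n+m j n) (proj₂ halfπ-limit)) (⟶-const (- approximation n)))
    (approximation-error n)

  halfπ-range : 0# < halfπ × halfπ ≤ fromℕ 2
  halfπ-range = near-3/2⇒[0,2] (⊑-resp ≈-refl (solve 0 (num 2 :* con (+ 1 / 8) := con (+ 1 / 4)) ≈-refl) (halfπ-error 0))

  -- Write the limit as x + d with x the n-th approximation: cos x and sin d are both of order
  -- `radius n`, and the addition formula bounds the cosine of the limit by three radii.
  cos-halfπ : cos halfπ ≈ 0#
  cos-halfπ = null-const (null-squeeze cos⊑ (null-scale (fromℕ 3) radius-null))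
    where
    rearrange : ∀ x p → x + (p - x) ≈ p
    rearrange = solve 2 (λ x p → x :+ (p :- x) := p) ≈-refl
    triple : ∀ r → r * 1# + 1# * (fromℕ 2 * r) ≈ fromℕ 3 * r
    triple = solve 1 (λ r → r :* num 1 :+ num 1 :* (num 2 :* r) := num 3 :* r) ≈-refl
    quarter : ∀ n → fromℕ 2 * radius n ≤ fromℕ 2
    quarter n = ≤-trans (*-mono-≤ (0≤fromℕ 2) (0≤radius n) ≤-refl (radius≤⅛ n))
      (≤-by (0≤-const (+ 7 / 4)) (solve 0 (num 2 :- num 2 :* con (+ 1 / 8) := con (+ 7 / 4)) ≈-refl))
    cos⊑ : ∀ n → cos halfπ ⊑ fromℕ 3 * radius n
    cos⊑ n = ⊑-resp (≈-trans (≈-sym (cos-+ x d)) (cos-cong (rearrange x halfπ))) (triple (radius n))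
      (⊑-+ (⊑-* (cos-approximation n) (cos-⊑1 d)) (⊑-neg (⊑-* (sin-⊑1 x) (sin-⊑ (quarter n) d (halfπ-error n)))))
      where
      x d : Carrier
      x = approximation n
      d = halfπ - x

  -- (s - 1)(s + 1) = -cos² = 0, and s + 1 > 0 because the sine is nonnegative on [0, 2].
  sin-halfπ : sin halfπ ≈ 1#
  sin-halfπ = ≈-trans (solve 1 (λ s → s := num 1 :+ (s :- num 1)) ≈-refl s)
    (≈-trans (+-congˡ (x*y≈0⇒x≈0 {s - 1#} {s + 1#} product≈0 (λ eq → <-irrefl (≈-sym eq) 0<s+1))) (+-identityʳ 1#))
    where
    s : Carrier
    s = sin halfπ
    0<s+1 : 0# < s + 1#
    0<s+1 = <-respʳ (+-comm 1# s) (0<-+-≤ 0<1 (0≤-sin (<⇒≤ (proj₁ halfπ-range)) (proj₂ halfπ-range)))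
    product≈0 : (s - 1#) * (s + 1#) ≈ 0#
    product≈0 = ≈-trans (solve 2 (λ c s → (s :- num 1) :* (s :+ num 1) := (c :* c :+ s :* s) :- num 1 :- c :* c) ≈-refl (cos halfπ) s)
      (≈-trans (+-cong (≈-trans (+-congʳ (cos²+sin²≈1 halfπ)) (-‿inverseʳ 1#)) (-‿cong (≈-trans (*-congʳ cos-halfπ) (zeroˡ _))))
      (≈-trans (+-identityˡ _) -0#≈0#))

  abstract
    π : Carrier
    π = halfπ + halfπ

    π≈ : π ≈ halfπ + halfπ
    π≈ = ≈-refl

    0<π : 0# < π
    0<π = 0<-+-≤ (proj₁ halfπ-range) (<⇒≤ (proj₁ halfπ-range))

    sin-π : sin π ≈ 0#
    sin-π = ≈-trans (sin-+ halfπ halfπ) (≈-trans (+-cong (*-congˡ cos-halfπ) (*-congʳ cos-halfπ))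
      (solve 1 (λ s → s :* num 0 :+ num 0 :* s := num 0) ≈-refl (sin halfπ)))

    cos-π : cos π ≈ - 1#
    cos-π = ≈-trans (cos-+ halfπ halfπ) (≈-trans (+-cong (*-cong cos-halfπ cos-halfπ) (-‿cong (*-cong sin-halfπ sin-halfπ)))
      (solve 0 (num 0 :* num 0 :- num 1 :* num 1 := :- num 1) ≈-refl))

    -- Up to 2 the Taylor bound makes the sine positive. Beyond 2 the reflection x ↦ π - x leads
    -- back to (0, 2), since π ≤ 4.
    sin-nonzero : ∀ {x} → 0# < x → x < π → ¬ sin x ≈ 0#
    sin-nonzero {x} 0<x x<π = by-cases (fromℕ 2 < x)
      (λ 2<x sin≈0 → <-irrefl (≈-sym (reflect sin≈0)) (0<-sin (x<y⇒0<y-x x<π) (<⇒≤ (<-by (0<-+-≤ (x<y⇒0<y-x 2<x)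
        (0≤-+ (x≤y⇒0≤y-x (proj₂ halfπ-range)) (x≤y⇒0≤y-x (proj₂ halfπ-range))))
        (solve 2 (λ p x → num 2 :- (p :+ p :- x) := (x :- num 2) :+ ((num 2 :- p) :+ (num 2 :- p))) ≈-refl halfπ x)))))
      (λ x≤2 sin≈0 → <-irrefl (≈-sym sin≈0) (0<-sin 0<x x≤2))
      where
      reflect : sin x ≈ 0# → sin (π - x) ≈ 0#
      reflect sin≈0 = ≈-trans (sin-- π x) (≈-trans (+-cong (*-congʳ sin-π) (-‿cong (*-congˡ sin≈0)))
        (solve 2 (λ a b → num 0 :* a :- b :* num 0 := num 0) ≈-refl (cos x) (cos π)))

  -- The zeros of the sine.

  fromℤ-injective : ∀ {a b} → fromℤ a ≈ fromℤ b → a ≡ b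
  fromℤ-injective {a} {b} a≈b with ℚ.<-cmp (a / 1) (b / 1)
  ... | tri< a<b _ _ = ⊥-elim (<-irrefl a≈b (fromℚ-mono-< a<b))
  ... | tri≈ _ a≡b _ = /1-injective a≡b
  ... | tri> _ _ b<a = ⊥-elim (<-irrefl (≈-sym a≈b) (fromℚ-mono-< b<a))

  -- Subtracts π as long as x ≥ π; below π only 0 is left. The comparison with π is undecidable,
  -- whence the double negation.
  sin-zero-below : ∀ N {x} → 0# ≤ x → x < fromℕ N * π → sin x ≈ 0# → ¬ ¬ (∃[ k ] x ≈ fromℕ k * π)
  sin-zero-below zero 0≤x x<0 _ _ = 0≤x (<-respʳ (≈-trans (*-congʳ fromℚ-0) (zeroˡ π)) x<0)
  sin-zero-below (suc N) {x} 0≤x x<Nπ sin≈0 = by-cases (x < π)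
    (λ x<π → by-cases (0# < x)
      (λ 0<x _ → sin-nonzero 0<x x<π sin≈0)
      (λ x≤0 none → none (0 , ≈-trans (≤-antisym x≤0 0≤x) (≈-sym (≈-trans (*-congʳ fromℚ-0) (zeroˡ π))))))
    (λ π≤x none → sin-zero-below N (x≤y⇒0≤y-x π≤x)
      (<-by (x<y⇒0<y-x x<Nπ) (≈-trans (shift (fromℕ N) π x) (+-congʳ (*-congʳ (≈-sym (fromℕ-suc N))))))
      (≈-trans (sin-- x π) (≈-trans (+-cong (*-congʳ sin≈0) (-‿cong (*-congˡ sin-π)))
        (solve 2 (λ a b → num 0 :* a :- b :* num 0 := num 0) ≈-refl (cos π) (cos x))))
      (λ (k , x-π≈kπ) → none (suc k , ≈-trans (restore x π) (≈-trans (+-congˡ x-π≈kπ)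
        (≈-trans (factor (fromℕ k) π) (*-congʳ (≈-sym (fromℕ-suc k))))))))
    where
    shift : ∀ n p x → n * p - (x - p) ≈ (1# + n) * p - x
    shift = solve 3 (λ n p x → n :* p :- (x :- p) := (num 1 :+ n) :* p :- x) ≈-refl
    restore : ∀ x p → x ≈ p + (x - p)
    restore = solve 2 (λ x p → x := p :+ (x :- p)) ≈-refl
    factor : ∀ k p → p + k * p ≈ (1# + k) * p
    factor = solve 2 (λ k p → p :+ k :* p := (num 1 :+ k) :* p) ≈-refl

  -- Lets the Archimedean bound x < N serve as x < Nπ.
  1≤π : 1# ≤ π
  1≤π = ≤-trans (≤-by (0≤-+ (x≤y⇒0≤y-x (lower (halfπ-error 0))) (0≤-+ (x≤y⇒0≤y-x (lower (halfπ-error 0))) (0≤-const (+ 3 / 2))))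
    (≈-trans (+-congʳ π≈) (solve 1 (λ p → p :+ p :- num 1 :=
      (p :- con (+ 3 / 2) :- :- (num 2 :* con (+ 1 / 8))) :+ ((p :- con (+ 3 / 2) :- :- (num 2 :* con (+ 1 / 8))) :+ con (+ 3 / 2))) ≈-refl halfπ)))
    ≤-refl

  sin-zero-nonneg : ∀ {x} → 0# ≤ x → sin x ≈ 0# → ¬ ¬ (∃[ k ] x ≈ fromℕ k * π)
  sin-zero-nonneg {x} 0≤x = sin-zero-below N 0≤x (<-≤-trans (proj₂ (archimedean x))
    (≤-by (0≤-* (0≤fromℕ N) (x≤y⇒0≤y-x 1≤π)) (factor (fromℕ N) π)))
    where
    N : ℕ
    N = proj₁ (archimedean x)
    factor : ∀ n p → n * p - n ≈ n * (p - 1#)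
    factor = solve 2 (λ n p → n :* p :- n := n :* (p :- num 1)) ≈-refl

  sin-zero : ∀ x → sin x ≈ 0# → ¬ ¬ (∃[ z ] x ≈ fromℤ z * π)
  sin-zero x sin≈0 = by-cases (x < 0#)
    (λ x<0 none → sin-zero-nonneg (<⇒≤ (neg-flip x<0)) (≈-trans (sin-neg x) (≈-trans (-‿cong sin≈0) -0#≈0#))
      (λ (k , -x≈kπ) → none (ℤ.- + k , ≈-trans (≈-sym (-‿involutive x)) (≈-trans (-‿cong -x≈kπ)
        (≈-trans (-‿distribˡ-* _ _) (*-congʳ (≈-sym (fromℤ-neg (+ k)))))))))
    (λ 0≤x none → sin-zero-nonneg 0≤x sin≈0 (λ (k , x≈kπ) → none (+ k , x≈kπ)))

  -- Sines and cosines of the multiples of π/m.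

  -- The parameter m - 1 will be the number n of vertices; as a successor, m is visibly nonzero.
  module Angles (m-1 : ℕ) where
    m : ℕ
    m = suc m-1

    α : Carrier
    α = fromℚ (+ 1 / m) * π

    mα≈π : fromℕ m * α ≈ π
    mα≈π = ≈-trans (≈-sym (*-assoc (fromℕ m) (fromℚ (+ 1 / m)) π)) (≈-trans (*-congʳ (≈-trans (≈-sym (fromℚ-* (+ m / 1) (+ 1 / m)))
      (≈-trans (≈-reflexive (≡.cong fromℚ (reciprocal m))) fromℚ-1))) (*-identityˡ π))

    α≉0 : ¬ α ≈ 0#
    α≉0 α≈0 = <-irrefl (≈-sym (≈-trans (≈-sym mα≈π) (≈-trans (*-congˡ α≈0) (zeroʳ (fromℕ m))))) 0<π

    abstract
      sn cs : ℕ → Carrier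
      sn j = sin (fromℕ j * α)
      cs j = cos (fromℕ j * α)

      angle-+ : ∀ i j → fromℕ (i ℕ.+ j) * α ≈ fromℕ i * α + fromℕ j * α
      angle-+ i j = ≈-trans (*-congʳ (fromℤ-+ (+ i) (+ j))) (distribʳ α _ _)

      angle-0 : fromℕ 0 * α ≈ 0#
      angle-0 = ≈-trans (*-congʳ fromℚ-0) (zeroˡ α)

      sn-+ : ∀ i j → sn (i ℕ.+ j) ≈ sn i * cs j + cs i * sn j
      sn-+ i j = ≈-trans (sin-cong (angle-+ i j)) (sin-+ _ _)

      cs-+ : ∀ i j → cs (i ℕ.+ j) ≈ cs i * cs j - sn i * sn j
      cs-+ i j = ≈-trans (cos-cong (angle-+ i j)) (cos-+ _ _)

      cs²+sn²≈1 : ∀ j → cs j * cs j + sn j * sn j ≈ 1#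
      cs²+sn²≈1 j = cos²+sin²≈1 _

      cs-⊑1 : ∀ j → cs j ⊑ 1#
      cs-⊑1 j = cos-⊑1 _

      sn-0 : sn 0 ≈ 0#
      sn-0 = ≈-trans (sin-cong angle-0) sin-0

      cs-0 : cs 0 ≈ 1#
      cs-0 = ≈-trans (cos-cong angle-0) cos-0

      sn-m : sn m ≈ 0#
      sn-m = ≈-trans (sin-cong mα≈π) sin-π

      cs-m : cs m ≈ - 1#
      cs-m = ≈-trans (cos-cong mα≈π) cos-π

      -- A vanishing sine gives jα = zπ = zmα up to double negation, and α cancels. Divisibility is
      -- decidable, so the double negation disappears.
      sn-zero : ∀ j → sn j ≈ 0# → m ∣ j
      sn-zero j sn≈0 = decidable-stable (m ∣? j) λ m∤j → sin-zero _ sn≈0 λ (z , jα≈zπ) →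
        m∤j (divides ℤ.∣ z ∣ (≡.trans (≡.cong ℤ.∣_∣ (fromℤ-injective {+ j} {z ℤ.* + m}
          (≈-trans (cancel (≈-trans jα≈zπ (≈-trans (*-congˡ (≈-sym mα≈π)) (≈-sym (*-assoc _ _ _))))) (≈-sym (fromℤ-* z (+ m)))))) (ℤ.abs-* z (+ m))))
        where
        cancel : ∀ {a b} → a * α ≈ b * α → a ≈ b
        cancel {a} {b} eq = ≈-trans (solve 2 (λ a b → a := b :+ (a :- b)) ≈-refl a b) (≈-trans (+-congˡ (x*y≈0⇒x≈0 {a - b} {α}
          (≈-trans (solve 3 (λ a b c → (a :- b) :* c := a :* c :- b :* c) ≈-refl a b α) (≈-trans (+-congʳ eq) (-‿inverseʳ _))) α≉0)) (+-identityʳ b))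

    -- The indices u, u + v, u + 2v avoid subtraction. With v = k and u = kj this says that j ↦ sn
    -- (kj) is an eigenvector of the path with eigenvalue 2 cs k.
    sn-three-term : ∀ u v → sn (u ℕ.+ v ℕ.+ v) + sn u ≈ fromℕ 2 * cs v * sn (u ℕ.+ v)
    sn-three-term u v = ≈-trans (+-congʳ (≈-trans (sn-+ (u ℕ.+ v) v) (+-cong (*-congʳ (sn-+ u v)) (*-congʳ (cs-+ u v)))))
      (≈-trans (identity (sn u) (cs u) (sn v) (cs v)) (≈-trans (+-congˡ (≈-trans (*-congˡ (≈-trans (+-congˡ (-‿cong (cs²+sn²≈1 v))) (-‿inverseʳ 1#))) (zeroʳ (sn u))))
        (≈-trans (+-identityʳ _) (*-congˡ (≈-sym (sn-+ u v))))))
      where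
      identity : ∀ s c s′ c′ → (s * c′ + c * s′) * c′ + (c * c′ - s * s′) * s′ + s ≈
        fromℕ 2 * c′ * (s * c′ + c * s′) + s * (1# - (c′ * c′ + s′ * s′))
      identity = solve 4 (λ s c s′ c′ → (s :* c′ :+ c :* s′) :* c′ :+ (c :* c′ :- s :* s′) :* s′ :+ s :=
        num 2 :* c′ :* (s :* c′ :+ c :* s′) :+ s :* (num 1 :- (c′ :* c′ :+ s′ :* s′))) ≈-refl

    cs-three-term : ∀ u v → cs (u ℕ.+ v ℕ.+ v) + cs u ≈ fromℕ 2 * cs v * cs (u ℕ.+ v)
    cs-three-term u v = ≈-trans (+-congʳ (≈-trans (cs-+ (u ℕ.+ v) v) (+-cong (*-congʳ (cs-+ u v)) (-‿cong (*-congʳ (sn-+ u v))))))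
      (≈-trans (identity (sn u) (cs u) (sn v) (cs v)) (≈-trans (+-congˡ (≈-trans (*-congˡ (≈-trans (+-congˡ (-‿cong (cs²+sn²≈1 v))) (-‿inverseʳ 1#))) (zeroʳ (cs u))))
        (≈-trans (+-identityʳ _) (*-congˡ (≈-sym (cs-+ u v))))))
      where
      identity : ∀ s c s′ c′ → (c * c′ - s * s′) * c′ - (s * c′ + c * s′) * s′ + c ≈
        fromℕ 2 * c′ * (c * c′ - s * s′) + c * (1# - (c′ * c′ + s′ * s′))
      identity = solve 4 (λ s c s′ c′ → (c :* c′ :- s :* s′) :* c′ :- (s :* c′ :+ c :* s′) :* s′ :+ c :=
        num 2 :* c′ :* (c :* c′ :- s :* s′) :+ c :* (num 1 :- (c′ :* c′ :+ s′ :* s′))) ≈-refl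

    -- For i + j = m the addition formulas at π are a linear system for sn j and cs j whose matrix
    -- is orthogonal.
    reflect : ∀ {i j} → i ℕ.+ j ≡ m → sn j ≈ sn i × cs j ≈ - cs i
    reflect {i} {j} i+j≡m = sines , cosines
      where
      sn-sum : sn i * cs j + cs i * sn j ≈ 0#
      sn-sum = ≈-trans (≈-sym (sn-+ i j)) (≈-trans (≈-reflexive (≡.cong sn i+j≡m)) sn-m)
      cs-sum : cs i * cs j - sn i * sn j ≈ - 1#
      cs-sum = ≈-trans (≈-sym (cs-+ i j)) (≈-trans (≈-reflexive (≡.cong cs i+j≡m)) cs-m)
      sines : sn j ≈ sn i
      sines = ≈-trans (≈-sym (*-identityˡ (sn j))) (≈-trans (*-congʳ (≈-sym (cs²+sn²≈1 i)))
        (≈-trans (solve 4 (λ s c s′ c′ → (c :* c :+ s :* s) :* s′ := c :* (s :* c′ :+ c :* s′) :- s :* (c :* c′ :- s :* s′)) ≈-refl (sn i) (cs i) (sn j) (cs j))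
        (≈-trans (+-cong (*-congˡ sn-sum) (-‿cong (*-congˡ cs-sum))) (solve 2 (λ c s → c :* num 0 :- s :* :- num 1 := s) ≈-refl (cs i) (sn i)))))
      cosines : cs j ≈ - cs i
      cosines = ≈-trans (≈-sym (*-identityˡ (cs j))) (≈-trans (*-congʳ (≈-sym (cs²+sn²≈1 i)))
        (≈-trans (solve 4 (λ s c s′ c′ → (c :* c :+ s :* s) :* c′ := s :* (s :* c′ :+ c :* s′) :+ c :* (c :* c′ :- s :* s′)) ≈-refl (sn i) (cs i) (sn j) (cs j))
        (≈-trans (+-cong (*-congˡ sn-sum) (*-congˡ cs-sum)) (solve 2 (λ c s → s :* num 0 :+ c :* :- num 1 := :- c) ≈-refl (cs i) (sn i)))))

  -- Rational values of a Chebyshev sequence are integers.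

  fromℤ-^ : ∀ d k → fromℤ (d ℤ.^ k) ≈ fromℤ d ^ k
  fromℤ-^ d zero    = fromℚ-1
  fromℤ-^ d (suc k) = ≈-trans (fromℤ-* d (d ℤ.^ k)) (*-congˡ (fromℤ-^ d k))

  -- With x = n/d in lowest terms, the numbers eₖ = dᵏ cₖ are integers and eₖ ≡ nᵏ modulo d, so d divides n^(h+1).
  module ChebyshevSequence (c : ℕ → Carrier) (x : Carrier) (c-0 : c 0 ≈ fromℕ 2) (c-1 : c 1 ≈ x)
                           (c-suc : ∀ k → c (2 ℕ.+ k) ≈ x * c (suc k) - c k) where

    module _ (n d : ℤ) (dx≈n : fromℤ d * x ≈ fromℤ n) where
      e : ℕ → ℤ
      e 0             = + 2
      e 1             = n
      e (suc (suc k)) = n ℤ.* e (suc k) ℤ.- d ℤ.* d ℤ.* e k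

      e≈dᵏc : ∀ k → fromℤ (e k) ≈ fromℤ d ^ k * c k × fromℤ (e (suc k)) ≈ fromℤ d ^ suc k * c (suc k)
      e≈dᵏc zero = ≈-trans (≈-sym c-0) (≈-sym (*-identityˡ (c 0))) ,
        ≈-trans (≈-sym dx≈n) (≈-trans (*-congˡ (≈-sym c-1)) (*-congʳ (≈-sym (*-identityʳ (fromℤ d)))))
      e≈dᵏc (suc k) = proj₂ (e≈dᵏc k) , ≈-trans (fromℤ-+ (n ℤ.* e (suc k)) (ℤ.- (d ℤ.* d ℤ.* e k)))
        (≈-trans (+-cong (≈-trans (fromℤ-* n (e (suc k))) (*-cong (≈-sym dx≈n) (proj₂ (e≈dᵏc k))))
          (≈-trans (fromℤ-neg (d ℤ.* d ℤ.* e k)) (-‿cong (≈-trans (fromℤ-* (d ℤ.* d) (e k)) (*-cong (fromℤ-* d d) (proj₁ (e≈dᵏc k)))))))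
        (≈-trans (identity (fromℤ d) x (fromℤ d ^ k) (c (suc k)) (c k)) (*-congˡ (≈-sym (c-suc k)))))
        where
        identity : ∀ d x p c′ c → (d * x) * ((d * p) * c′) - (d * d) * (p * c) ≈ (d * (d * p)) * (x * c′ - c)
        identity = solve 5 (λ d x p c′ c → (d :* x) :* ((d :* p) :* c′) :- (d :* d) :* (p :* c) := (d :* (d :* p)) :* (x :* c′ :- c)) ≈-refl

      e≡nᵏ : ∀ k → ∃[ t ] e (suc k) ≡ n ℤ.^ suc k ℤ.+ d ℤ.* t
      e≡nᵏ zero    = + 0 , identity n d
        where
        identity : ∀ n d → n ≡ n ℤ.* + 1 ℤ.+ d ℤ.* + 0
        identity = ℤ-Solver.solve-∀
      e≡nᵏ (suc k) = let t , eq = e≡nᵏ k in n ℤ.* t ℤ.- d ℤ.* e k ,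
        ≡.trans (≡.cong (λ a → n ℤ.* a ℤ.- d ℤ.* d ℤ.* e k) eq) (identity n d (n ℤ.^ suc k) t (e k))
        where
        identity : ∀ n d p t e → n ℤ.* (p ℤ.+ d ℤ.* t) ℤ.- d ℤ.* d ℤ.* e ≡ n ℤ.* p ℤ.+ d ℤ.* (n ℤ.* t ℤ.- d ℤ.* e)
        identity = ℤ-Solver.solve-∀

      -- At an index where c is -2, the integer e equals -2 dʰ⁺¹ and is divisible by d.
      d∣nᵏ : ∀ h → c (suc h) ≈ - fromℕ 2 → ℤ.∣ d ∣ ∣ ℤ.∣ n ℤ.^ suc h ∣
      d∣nᵏ h c-h = divides ℤ.∣ s ∣ (≡.trans (≡.cong ℤ.∣_∣ power≡) (≡.trans (ℤ.abs-* d s) (ℕ.*-comm ℤ.∣ d ∣ ℤ.∣ s ∣)))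
        where
        t : ℤ
        t = proj₁ (e≡nᵏ h)
        s : ℤ
        s = ℤ.- + 2 ℤ.* d ℤ.^ h ℤ.- t
        e-h : e (suc h) ≡ d ℤ.^ suc h ℤ.* (ℤ.- + 2)
        e-h = fromℤ-injective (≈-trans (proj₂ (e≈dᵏc h)) (≈-trans (*-cong (≈-sym (fromℤ-^ d (suc h))) (≈-trans c-h (≈-sym (fromℤ-neg (+ 2)))))
          (≈-sym (fromℤ-* (d ℤ.^ suc h) (ℤ.- + 2)))))
        solve-power : ∀ d p t → d ℤ.* p ℤ.* (ℤ.- + 2) ℤ.- d ℤ.* t ≡ d ℤ.* (ℤ.- + 2 ℤ.* p ℤ.- t)
        solve-power = ℤ-Solver.solve-∀
        isolate : ∀ a b → a ≡ (a ℤ.+ b) ℤ.- b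
        isolate = ℤ-Solver.solve-∀
        power≡ : n ℤ.^ suc h ≡ d ℤ.* s
        power≡ = ≡.trans (isolate (n ℤ.^ suc h) (d ℤ.* t))
          (≡.trans (≡.cong (ℤ._- d ℤ.* t) (≡.trans (≡.sym (proj₂ (e≡nᵏ h))) e-h)) (solve-power d (d ℤ.^ h) t))

    rational⇒integer : ∀ h → c (suc h) ≈ - fromℕ 2 → ∀ D E → ¬ D ≡ + 0 → fromℤ D * x ≈ fromℤ E → ∃[ z ] x ≈ fromℤ z
    rational⇒integer h c-h D E D≢0 Dx≈E = ℚ.↥ q , ≈-trans (≈-sym (*-identityˡ x))
      (≈-trans (*-congʳ (≈-sym (≈-trans (≈-reflexive (≡.cong (λ d → fromℕ d) ↧q≡1)) fromℚ-1))) ↧q*x≈↥q)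
      where
      instance
        D-nonZero : ℚ.NonZero (D / 1)
        D-nonZero = ℚ.≢-nonZero (λ D/1≡0 → D≢0 (/1-injective D/1≡0))
      q : ℚ
      q = (ℚ.1/ (D / 1)) ℚ.* (E / 1)
      x≈q : x ≈ fromℚ q
      x≈q = ≈-trans (≈-sym (*-identityˡ x)) (≈-trans (*-congʳ (≈-sym (≈-trans (≈-sym (fromℚ-* (ℚ.1/ (D / 1)) (D / 1)))
        (≈-trans (≈-reflexive (≡.cong fromℚ (ℚ.*-inverseˡ (D / 1)))) fromℚ-1))))
        (≈-trans (*-assoc _ _ _) (≈-trans (*-congˡ Dx≈E) (≈-sym (fromℚ-* (ℚ.1/ (D / 1)) (E / 1))))))
      ↧q*x≈↥q : fromℤ (ℚ.↧ q) * x ≈ fromℤ (ℚ.↥ q)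
      ↧q*x≈↥q = ≈-trans (*-congˡ x≈q) (≈-trans (≈-sym (fromℚ-* (ℚ.↧ q / 1) q)) (≈-reflexive (≡.cong fromℚ (↧*q≡↥ q))))
      coprime : ∀ q → Coprimality.Coprime (ℚ.↧ₙ q) ℤ.∣ ℚ.↥ q ∣
      coprime (mkℚ _ _ c) = Coprimality.sym (Coprimality.recompute c)
      ↧q≡1 : ℚ.↧ₙ q ≡ 1
      ↧q≡1 = coprime-∣-power (ℚ.↥ q) (suc h) (coprime q) (d∣nᵏ (ℚ.↥ q) (ℚ.↧ q) ↧q*x≈↥q h c-h)

  -- Which paths and vertices admit a transfer.

  module Classification (n : ℕ) where
    open Angles n

    sn-cong : ∀ {i j} → i ≡ j → sn i ≈ sn j
    sn-cong i≡j = ≈-reflexive (≡.cong sn i≡j)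

    cs-cong : ∀ {i j} → i ≡ j → cs i ≈ cs j
    cs-cong i≡j = ≈-reflexive (≡.cong cs i≡j)

    -1^ : ℕ → Carrier
    -1^ k = (- 1#) ^ k

    -1^² : ∀ k → -1^ k * -1^ k ≈ 1#
    -1^² zero    = *-identityˡ 1#
    -1^² (suc k) = ≈-trans (solve 1 (λ p → (:- num 1 :* p) :* (:- num 1 :* p) := p :* p) ≈-refl (-1^ k)) (-1^² k)

    -1^-+ : ∀ j k → -1^ (j ℕ.+ k) ≈ -1^ j * -1^ k
    -1^-+ zero    k = ≈-sym (*-identityˡ _)
    -1^-+ (suc j) k = ≈-trans (*-congˡ (-1^-+ j k)) (≈-sym (*-assoc _ _ _))

    -- The indices ka and kb add up to km, out of reach of `reflect`; the induction adds one pair a,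
    -- b at a time.
    reflect-multiple : ∀ {a b} → a ℕ.+ b ≡ m → ∀ k →
      sn (k ℕ.* b) ≈ - -1^ k * sn (k ℕ.* a) × cs (k ℕ.* b) ≈ -1^ k * cs (k ℕ.* a)
    reflect-multiple a+b≡m zero =
      ≈-trans sn-0 (≈-trans (solve 0 (num 0 := :- num 1 :* num 0) ≈-refl) (*-congˡ (≈-sym sn-0))) , ≈-sym (*-identityˡ _)
    reflect-multiple {a} {b} a+b≡m (suc k) = sines , cosines
      where
      sines : sn (b ℕ.+ k ℕ.* b) ≈ - -1^ (suc k) * sn (a ℕ.+ k ℕ.* a)
      sines = ≈-trans (sn-+ b (k ℕ.* b)) (≈-trans
        (+-cong (*-cong (proj₁ (reflect a+b≡m)) (proj₂ (reflect-multiple a+b≡m k)))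
                (*-cong (proj₂ (reflect a+b≡m)) (proj₁ (reflect-multiple a+b≡m k))))
        (≈-trans (identity _ _ _ _ _) (*-congˡ (≈-sym (sn-+ a (k ℕ.* a))))))
        where
        identity : ∀ s c p s′ c′ → s * (p * c′) + - c * (- p * s′) ≈ - (- 1# * p) * (s * c′ + c * s′)
        identity = solve 5 (λ s c p s′ c′ → s :* (p :* c′) :+ :- c :* (:- p :* s′) := :- (:- num 1 :* p) :* (s :* c′ :+ c :* s′)) ≈-refl
      cosines : cs (b ℕ.+ k ℕ.* b) ≈ -1^ (suc k) * cs (a ℕ.+ k ℕ.* a)
      cosines = ≈-trans (cs-+ b (k ℕ.* b)) (≈-trans
        (+-cong (*-cong (proj₂ (reflect a+b≡m)) (proj₂ (reflect-multiple a+b≡m k)))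
                (-‿cong (*-cong (proj₁ (reflect a+b≡m)) (proj₁ (reflect-multiple a+b≡m k)))))
        (≈-trans (identity _ _ _ _ _) (*-congˡ (≈-sym (cs-+ a (k ℕ.* a))))))
        where
        identity : ∀ s c p s′ c′ → - c * (p * c′) - s * (- p * s′) ≈ (- 1# * p) * (c * c′ - s * s′)
        identity = solve 5 (λ s c p s′ c′ → :- c :* (p :* c′) :- s :* (:- p :* s′) := (:- num 1 :* p) :* (c :* c′ :- s :* s′)) ≈-refl

    -- sin (α + β) sin (β - α) = sin² β - sin² α, with β - α given by the index d.
    sn²-difference : ∀ a d → sn (a ℕ.+ (a ℕ.+ d)) * sn d ≈ sn (a ℕ.+ d) * sn (a ℕ.+ d) - sn a * sn a
    sn²-difference a d = ≈-trans (*-congʳ (≈-trans (sn-+ a (a ℕ.+ d)) (+-cong (*-congˡ (cs-+ a d)) (*-congˡ (sn-+ a d)))))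
      (≈-trans (identity (sn a) (cs a) (sn d) (cs d)) (≈-trans (+-cong
          (≈-sym (*-cong (sn-+ a d) (sn-+ a d)))
          (-‿cong (*-congˡ (≈-trans (+-cong (cs²+sn²≈1 d) ≈-refl) (solve 1 (λ z → num 1 :+ (z :- z) := num 1) ≈-refl 0#)))))
        (+-congˡ (-‿cong (*-identityʳ _)))))
      where
      identity : ∀ s c s′ c′ → (s * (c * c′ - s * s′) + c * (s * c′ + c * s′)) * s′ ≈
        (s * c′ + c * s′) * (s * c′ + c * s′) - s * s * ((c′ * c′ + s′ * s′) + (0# - 0#))
      identity = solve 4 (λ s c s′ c′ → (s :* (c :* c′ :- s :* s′) :+ c :* (s :* c′ :+ c :* s′)) :* s′ :=
        (s :* c′ :+ c :* s′) :* (s :* c′ :+ c :* s′) :- s :* s :* ((c′ :* c′ :+ s′ :* s′) :+ (num 0 :- num 0))) ≈-refl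

    cs-difference : ∀ u v → cs u - cs (u ℕ.+ v ℕ.+ v) ≈ fromℕ 2 * sn v * sn (u ℕ.+ v)
    cs-difference u v = ≈-trans (+-congˡ (-‿cong (≈-trans (cs-+ (u ℕ.+ v) v) (+-cong (*-congʳ (cs-+ u v)) (-‿cong (*-congʳ (sn-+ u v)))))))
      (≈-trans (identity (sn u) (cs u) (sn v) (cs v)) (≈-trans (+-congˡ (≈-trans (*-congˡ (≈-trans (+-congˡ (-‿cong (cs²+sn²≈1 v))) (-‿inverseʳ 1#))) (zeroʳ (cs u))))
        (≈-trans (+-identityʳ _) (*-congˡ (≈-sym (sn-+ u v))))))
      where
      identity : ∀ s c s′ c′ → c - ((c * c′ - s * s′) * c′ - (s * c′ + c * s′) * s′) ≈
        fromℕ 2 * s′ * (s * c′ + c * s′) + c * (1# - (c′ * c′ + s′ * s′))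
      identity = solve 4 (λ s c s′ c′ → c :- ((c :* c′ :- s :* s′) :* c′ :- (s :* c′ :+ c :* s′) :* s′) :=
        num 2 :* s′ :* (s :* c′ :+ c :* s′) :+ c :* (num 1 :- (c′ :* c′ :+ s′ :* s′))) ≈-refl

    eigenvalue : ℕ → Carrier
    eigenvalue k = (fromℕ 2 * cs k) * (fromℕ 2 * cs k)

    -- The eigenvalue θₖ shifted by -2: differences stay the same, and the shifted numbers satisfy
    -- the Chebyshev recursion.
    doubleCos : ℕ → Carrier
    doubleCos k = fromℕ 2 * cs (2 ℕ.* k)

    eigenvalue≈2+doubleCos : ∀ k → eigenvalue k ≈ fromℕ 2 + doubleCos k
    eigenvalue≈2+doubleCos k = ≈-trans (identity (cs k) (sn k)) (≈-trans (+-cong (*-congˡ (cs²+sn²≈1 k))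
      (*-congˡ (≈-trans (≈-sym (cs-+ k k)) (cs-cong (≡.cong (k ℕ.+_) (≡.sym (ℕ.+-identityʳ k)))))))
      (+-congʳ (*-identityʳ (fromℕ 2))))
      where
      identity : ∀ c s → (fromℕ 2 * c) * (fromℕ 2 * c) ≈ fromℕ 2 * (c * c + s * s) + fromℕ 2 * (c * c - s * s)
      identity = solve 2 (λ c s → (num 2 :* c) :* (num 2 :* c) := num 2 :* (c :* c :+ s :* s) :+ num 2 :* (c :* c :- s :* s)) ≈-refl

    x : Carrier
    x = doubleCos 1

    doubleCos-suc : ∀ k → doubleCos (2 ℕ.+ k) ≈ x * doubleCos (suc k) - doubleCos k
    doubleCos-suc k = ≈-trans (isolate _ _) (+-congʳ (≈-trans (≈-sym (distribˡ (fromℕ 2) _ _))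
      (≈-trans (*-congˡ (≈-trans (+-congʳ (cs-cong (index₂ k))) (≈-trans (cs-three-term (2 ℕ.* k) 2) (*-congˡ (cs-cong (index₁ k))))))
      (solve 3 (λ t a b → t :* (t :* a :* b) := t :* a :* (t :* b)) ≈-refl (fromℕ 2) (cs 2) _))))
      where
      isolate : ∀ a b → a ≈ (a + b) - b
      isolate = solve 2 (λ a b → a := (a :+ b) :- b) ≈-refl
      index₁ : ∀ k → 2 ℕ.* k ℕ.+ 2 ≡ 2 ℕ.* suc k
      index₁ = solve-∀
      index₂ : ∀ k → 2 ℕ.* (2 ℕ.+ k) ≡ 2 ℕ.* k ℕ.+ 2 ℕ.+ 2
      index₂ = solve-∀

    x*doubleCos : ∀ k → x * doubleCos (suc k) ≈ doubleCos k + doubleCos (2 ℕ.+ k)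
    x*doubleCos k = ≈-trans (solve 2 (λ a b → a := b :+ (a :- b)) ≈-refl _ (doubleCos k)) (+-congˡ (≈-sym (doubleCos-suc k)))

    open ChebyshevSequence doubleCos x (≈-trans (*-congˡ cs-0) (*-identityʳ (fromℕ 2))) ≈-refl doubleCos-suc public

    -- Together with `sn-6`, turns the values x = 0 and x² = 1 into zeros of the sine, that is, into
    -- divisibility by m.
    sn-4 : sn 4 ≈ x * sn 2
    sn-4 = ≈-trans (≈-trans (≈-sym (+-identityʳ (sn 4))) (+-congˡ (≈-sym sn-0))) (sn-three-term 0 2)

    sn-6 : sn 6 ≈ (x * x - 1#) * sn 2
    sn-6 = ≈-trans (solve 2 (λ a b → a := (a :+ b) :- b) ≈-refl (sn 6) (sn 2))
      (≈-trans (+-congʳ (≈-trans (sn-three-term 2 2) (*-congˡ sn-4)))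
      (solve 2 (λ x s → x :* (x :* s) :- s := (x :* x :- num 1) :* s) ≈-refl x (sn 2)))

    x-⊑2 : x ⊑ fromℕ 2
    x-⊑2 = ⊑-resp ≈-refl (*-identityʳ (fromℕ 2)) (⊑-* (0≤⇒⊑ (0≤fromℕ 2) ≤-refl) (cs-⊑1 2))

    x²≈4⇒m∣2 : x * x ≈ fromℕ 4 → m ∣ 2
    x²≈4⇒m∣2 x²≈4 = sn-zero 2 (≈-stable λ sn≉0 → sn≉0 (x*y≈0⇒x≈0 sn²≈0 sn≉0))
      where
      sn²≈0 : sn 2 * sn 2 ≈ 0#
      sn²≈0 = ≈-trans (solve 2 (λ c s → s :* s := (c :* c :+ s :* s) :- con (+ 1 / 4) :* ((num 2 :* c) :* (num 2 :* c))) ≈-refl (cs 2) (sn 2))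
        (≈-trans (+-cong (cs²+sn²≈1 2) (-‿cong (*-congˡ x²≈4))) (solve 0 (num 1 :- con (+ 1 / 4) :* num 4 := num 0) ≈-refl))

    x²≈1⇒m∣6 : x * x ≈ 1# → m ∣ 6
    x²≈1⇒m∣6 x²≈1 = sn-zero 6 (≈-trans sn-6 (≈-trans (*-congʳ (≈-trans (+-congʳ x²≈1) (-‿inverseʳ 1#))) (zeroˡ (sn 2))))

    -- The square absorbs the sign of x, and |x| ≤ 2 leaves only the squares 0, 1 and 4.
    integer-x² : ∀ k → x * x ≈ fromℕ k * fromℕ k → m ∣ 2 ⊎ m ∣ 4 ⊎ m ∣ 6
    integer-x² 0 x²≈0 = inj₂ (inj₁ (sn-zero 4 (≈-trans sn-4 (≈-trans (*-congʳ x≈0) (zeroˡ (sn 2))))))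
      where
      x≈0 : x ≈ 0#
      x≈0 = ≈-stable λ x≉0 → x≉0 (x*y≈0⇒x≈0 (≈-trans x²≈0 (≈-trans (*-congʳ fromℚ-0) (zeroˡ (fromℕ 0)))) x≉0)
    integer-x² 1 x²≈1 = inj₂ (inj₂ (x²≈1⇒m∣6 (≈-trans x²≈1 (≈-trans (*-cong fromℚ-1 fromℚ-1) (*-identityˡ 1#)))))
    integer-x² 2 x²≈4 = inj₁ (x²≈4⇒m∣2 (≈-trans x²≈4 (solve 0 (num 2 :* num 2 := num 4) ≈-refl)))
    integer-x² (suc (suc (suc k))) x²≈k² = ⊥-elim (≤-trans (≤-resp (≈-sym (fromℕ-* 3 3)) ≈-refl (*-mono-≤ (0≤fromℕ 3) (0≤fromℕ 3) 3≤k 3≤k))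
      (≤-trans (≈⇒≤ (≈-sym x²≈k²)) (≤-resp ≈-refl (≈-sym (fromℕ-* 2 2)) (upper (⊑-* x-⊑2 x-⊑2))))
      (fromℚ-mono-< (toWitness {a? = (+ 4 / 1) ℚ.<? (+ 9 / 1)} _)))
      where
      3≤k : fromℕ 3 ≤ fromℕ (3 ℕ.+ k)
      3≤k = fromℕ-mono-≤ (ℕ.s≤s (ℕ.s≤s (ℕ.s≤s (ℕ.z≤n {k}))))

    integer-x : ∀ z → x ≈ fromℤ z → m ∣ 2 ⊎ m ∣ 4 ⊎ m ∣ 6
    integer-x z x≈z = integer-x² ℤ.∣ z ∣ (≈-trans (*-cong x≈z x≈z) (square z))
      where
      square : ∀ z → fromℤ z * fromℤ z ≈ fromℕ ℤ.∣ z ∣ * fromℕ ℤ.∣ z ∣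
      square (+ k)    = ≈-refl
      square -[1+ k ] = ≈-trans (*-cong (fromℤ-neg (+ suc k)) (fromℤ-neg (+ suc k)))
        (solve 1 (λ z → :- z :* :- z := z :* z) ≈-refl (fromℕ (suc k)))

    nonzero : ∀ {j} → ¬ m ∣ j → ¬ sn j ≈ 0#
    nonzero {j} m∤j sn≈0 = m∤j (sn-zero j sn≈0)

    2sinks≈0 : ∀ {y} → y ≈ - y → y ≈ 0#
    2sinks≈0 {y} y≈-y = ≈-trans (solve 1 (λ y → y := con ½ :* (y :- :- y)) ≈-refl y)
      (≈-trans (*-congˡ (+-congˡ (-‿cong (≈-sym y≈-y)))) (solve 1 (λ y → con ½ :* (y :- y) := num 0) ≈-refl y))

    -- With b = a + d the difference of the squares is sn (a + b) sn d. As 0 < d < m the second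
    -- factor is nonzero, so m divides a + b, which lies strictly between 0 and 2m.
    ordered-sum≡m : ∀ a d → 0 ℕ.< a → 0 ℕ.< d → a ℕ.+ d ℕ.≤ n → sn (a ℕ.+ d) * sn (a ℕ.+ d) ≈ sn a * sn a → a ℕ.+ (a ℕ.+ d) ≡ m
    ordered-sum≡m a d 0<a 0<d a+d≤n squares≈ = once (sn-zero _ (x*y≈0⇒x≈0
        (≈-trans (sn²-difference a d) (≈-trans (+-congʳ squares≈) (-‿inverseʳ _)))
        (nonzero (λ m∣d → ℕ.<⇒≱ (ℕ.s≤s (ℕ.≤-trans (ℕ.m≤n+m d a) a+d≤n)) (∣⇒≤ {{ℕ.>-nonZero 0<d}} m∣d)))))
      where
      once : m ∣ a ℕ.+ (a ℕ.+ d) → a ℕ.+ (a ℕ.+ d) ≡ m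
      once (divides 0 eq) = ⊥-elim (ℕ.<⇒≢ (ℕ.<-≤-trans 0<a (ℕ.m≤m+n a (a ℕ.+ d))) (≡.sym eq))
      once (divides 1 eq) = ≡.trans eq (ℕ.*-identityˡ m)
      once (divides (suc (suc q)) eq) = ⊥-elim (ℕ.<⇒≱
        (ℕ.+-mono-< (ℕ.s≤s (ℕ.≤-trans (ℕ.m≤m+n a d) a+d≤n)) (ℕ.s≤s a+d≤n))
        (≡.subst (m ℕ.+ m ℕ.≤_) (≡.sym eq) (ℕ.+-monoʳ-≤ m (ℕ.m≤m+n m (q ℕ.* m)))))

    -- All that the classification takes from a transfer: the equation exp (-iτθₖ) sn (ka) = γ sn
    -- (kb) for γ = γ₁ - iγ₂, separated into real and negated imaginary part.
    module Transfer {τ γ₁ γ₂ : Carrier} (0<τ : 0# < τ) (|γ|≈1 : γ₁ * γ₁ + γ₂ * γ₂ ≈ 1#)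
      {a b : ℕ} (0<a : 0 ℕ.< a) (0<b : 0 ℕ.< b) (a≤n : a ℕ.≤ n) (b≤n : b ℕ.≤ n) (a≢b : a ≢ b)
      (cos-phase : ∀ k → cos (τ * eigenvalue k) * sn (k ℕ.* a) ≈ γ₁ * sn (k ℕ.* b))
      (sin-phase : ∀ k → sin (τ * eigenvalue k) * sn (k ℕ.* a) ≈ γ₂ * sn (k ℕ.* b)) where

      squares : ∀ k → sn (k ℕ.* a) * sn (k ℕ.* a) ≈ sn (k ℕ.* b) * sn (k ℕ.* b)
      squares k = ≈-trans (≈-sym (*-identityˡ _)) (≈-trans (*-congʳ (≈-sym (cos²+sin²≈1 (τ * eigenvalue k))))
        (≈-trans (expand _ _ _) (≈-trans (+-cong (*-cong (cos-phase k) (cos-phase k)) (*-cong (sin-phase k) (sin-phase k)))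
        (≈-trans (≈-sym (expand _ _ _)) (≈-trans (*-congʳ |γ|≈1) (*-identityˡ _))))))
        where
        expand : ∀ c s z → (c * c + s * s) * (z * z) ≈ (c * z) * (c * z) + (s * z) * (s * z)
        expand = solve 3 (λ c s z → (c :* c :+ s :* s) :* (z :* z) := (c :* z) :* (c :* z) :+ (s :* z) :* (s :* z)) ≈-refl

      squares₁ : sn a * sn a ≈ sn b * sn b
      squares₁ = ≈-trans (*-cong 1a 1a) (≈-trans (squares 1) (≈-sym (*-cong 1b 1b)))
        where
        1a : sn a ≈ sn (1 ℕ.* a)
        1a = sn-cong (≡.sym (ℕ.*-identityˡ a))
        1b : sn b ≈ sn (1 ℕ.* b)
        1b = sn-cong (≡.sym (ℕ.*-identityˡ b))

      a+b≡m : a ℕ.+ b ≡ m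
      a+b≡m with ℕ.<-cmp a b
      ... | tri≈ _ a≡b _ = ⊥-elim (a≢b a≡b)
      ... | tri< a<b _ _ = ≡.trans (≡.cong (a ℕ.+_) (≡.sym b≡)) (ordered-sum≡m a (b ℕ.∸ a) 0<a (ℕ.m<n⇒0<n∸m a<b)
              (≡.subst (ℕ._≤ n) (≡.sym b≡) b≤n) (≡.subst (λ j → sn j * sn j ≈ sn a * sn a) (≡.sym b≡) (≈-sym squares₁)))
        where
        b≡ : a ℕ.+ (b ℕ.∸ a) ≡ b
        b≡ = ℕ.m+[n∸m]≡n (ℕ.<⇒≤ a<b)
      ... | tri> _ _ b<a = ≡.trans (ℕ.+-comm a b) (≡.trans (≡.cong (b ℕ.+_) (≡.sym a≡)) (ordered-sum≡m b (a ℕ.∸ b) 0<b (ℕ.m<n⇒0<n∸m b<a)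
              (≡.subst (ℕ._≤ n) (≡.sym a≡) a≤n) (≡.subst (λ j → sn j * sn j ≈ sn b * sn b) (≡.sym a≡) squares₁)))
        where
        a≡ : b ℕ.+ (a ℕ.∸ b) ≡ a
        a≡ = ℕ.m+[n∸m]≡n (ℕ.<⇒≤ b<a)

      -- The eigenvalues for k = 1 and k = n coincide, while the two eigenvectors are proportional
      -- with factors of opposite sign at a and b when a + b is odd.
      opposite : -1^ a * -1^ b ≈ - 1# → ∀ {c g} → c * sn (1 ℕ.* a) ≈ g * sn (1 ℕ.* b) → c * sn (n ℕ.* a) ≈ g * sn (n ℕ.* b) → g ≈ 0#
      opposite odd {c} {g} first last = x*y≈0⇒x≈0 (2sinks≈0 (≈-trans (≈-sym first) (≈-trans (≈-sym (*-identityˡ _))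
          (≈-trans (*-congʳ (≈-sym (-1^² a))) (≈-trans (identity₁ _ _ _) (≈-trans (*-congˡ (-‿cong last′))
          (≈-trans (identity₂ _ _ _ _) (≈-trans (*-congʳ odd) (identity₃ _)))))))))
        (nonzero (λ m∣b → ℕ.<⇒≱ (ℕ.s≤s b≤n) (∣⇒≤ {{ℕ.>-nonZero 0<b}} (≡.subst (m ∣_) (ℕ.*-identityˡ b) m∣b))))
        where
        end : ∀ j → sn (n ℕ.* j) ≈ - -1^ j * sn (1 ℕ.* j)
        end j = ≈-trans (sn-cong (ℕ.*-comm n j)) (≈-trans (proj₁ (reflect-multiple {1} {n} ≡.refl j)) (*-congˡ (sn-cong (ℕ.*-comm j 1))))
        last′ : c * (- -1^ a * sn (1 ℕ.* a)) ≈ g * (- -1^ b * sn (1 ℕ.* b))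
        last′ = ≈-trans (*-congˡ (≈-sym (end a))) (≈-trans last (*-congˡ (end b)))
        identity₁ : ∀ p c s → (p * p) * (c * s) ≈ p * - (c * (- p * s))
        identity₁ = solve 3 (λ p c s → (p :* p) :* (c :* s) := p :* :- (c :* (:- p :* s))) ≈-refl
        identity₂ : ∀ p q g s → p * - (g * (- q * s)) ≈ (p * q) * (g * s)
        identity₂ = solve 4 (λ p q g s → p :* :- (g :* (:- q :* s)) := (p :* q) :* (g :* s)) ≈-refl
        identity₃ : ∀ y → - 1# * y ≈ - y
        identity₃ = solve 1 (λ y → :- num 1 :* y := :- y) ≈-refl

      -- For odd m also a + b is odd, and `opposite` annihilates both parts of γ, against |γ| = 1.
      m-even : ∃[ h ] m ≡ 2 ℕ.* h
      m-even with even-or-odd m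
      ... | inj₁ even = even
      ... | inj₂ (h , m≡) = ⊥-elim (<-irrefl (≈-trans (≈-sym 0≈γ²) |γ|≈1) 0<1)
        where
        odd : -1^ a * -1^ b ≈ - 1#
        odd = ≈-trans (≈-sym (-1^-+ a b)) (≈-trans (≈-reflexive (≡.cong -1^ (≡.trans a+b≡m m≡)))
          (≈-trans (*-congˡ (≈-trans (-1^-+ h (h ℕ.+ 0)) (≈-trans (*-congˡ (≈-reflexive (≡.cong -1^ (ℕ.+-identityʳ h)))) (-1^² h)))) (*-identityʳ (- 1#))))
        same-eigenvalue : eigenvalue n ≈ eigenvalue 1
        same-eigenvalue = ≈-trans (*-cong (*-congˡ cs-n) (*-congˡ cs-n)) (solve 1 (λ c → (num 2 :* :- c) :* (num 2 :* :- c) := (num 2 :* c) :* (num 2 :* c)) ≈-refl (cs 1))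
          where
          cs-n : cs n ≈ - cs 1
          cs-n = proj₂ (reflect {1} {n} ≡.refl)
        γ₁≈0 : γ₁ ≈ 0#
        γ₁≈0 = opposite odd (cos-phase 1) (≈-trans (*-congʳ (cos-cong (*-congˡ (≈-sym same-eigenvalue)))) (cos-phase n))
        γ₂≈0 : γ₂ ≈ 0#
        γ₂≈0 = opposite odd (sin-phase 1) (≈-trans (*-congʳ (sin-cong (*-congˡ (≈-sym same-eigenvalue)))) (sin-phase n))
        0≈γ² : γ₁ * γ₁ + γ₂ * γ₂ ≈ 0#
        0≈γ² = ≈-trans (+-cong (*-congʳ γ₁≈0) (*-congʳ γ₂≈0)) (solve 2 (λ a b → num 0 :* a :+ num 0 :* b := num 0) ≈-refl γ₁ γ₂)

      phase : ∀ k → ¬ m ∣ k ℕ.* a → cos (τ * eigenvalue k) ≈ γ₁ * - -1^ k × sin (τ * eigenvalue k) ≈ γ₂ * - -1^ k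
      phase k m∤ka = cancel (cos-phase k) , cancel (sin-phase k)
        where
        cancel : ∀ {c g} → c * sn (k ℕ.* a) ≈ g * sn (k ℕ.* b) → c ≈ g * - -1^ k
        cancel {c} {g} eq = ≈-trans (solve 2 (λ c d → c := d :+ (c :- d)) ≈-refl c (g * - -1^ k))
          (≈-trans (+-congˡ (x*y≈0⇒x≈0 {c - g * - -1^ k} {sn (k ℕ.* a)} (≈-trans (expand c g (-1^ k) (sn (k ℕ.* a))) (≈-trans
            (+-cong eq (-‿cong (*-congˡ (≈-sym (proj₁ (reflect-multiple a+b≡m k)))))) (-‿inverseʳ _))) (nonzero m∤ka))) (+-identityʳ _))
          where
          expand : ∀ c g p s → (c - g * - p) * s ≈ c * s - g * (- p * s)
          expand = solve 4 (λ c g p s → (c :- g :* :- p) :* s := c :* s :- g :* (:- p :* s)) ≈-refl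

      angle≈ : ∀ k l → τ * eigenvalue k - τ * eigenvalue l ≈ τ * (doubleCos k - doubleCos l)
      angle≈ k l = ≈-trans (+-cong (*-congˡ (eigenvalue≈2+doubleCos k)) (-‿cong (*-congˡ (eigenvalue≈2+doubleCos l))))
        (solve 3 (λ t c d → t :* (num 2 :+ c) :- t :* (num 2 :+ d) := t :* (c :- d)) ≈-refl τ (doubleCos k) (doubleCos l))

      sin-difference : ∀ k l → ¬ m ∣ k ℕ.* a → ¬ m ∣ l ℕ.* a → sin (τ * (doubleCos k - doubleCos l)) ≈ 0#
      sin-difference k l m∤ka m∤la = ≈-trans (sin-cong (≈-sym (angle≈ k l))) (≈-trans (sin-- _ _) (≈-trans
        (+-cong (*-cong (proj₂ (phase k m∤ka)) (proj₁ (phase l m∤la))) (-‿cong (*-cong (proj₁ (phase k m∤ka)) (proj₂ (phase l m∤la)))))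
        (solve 4 (λ g h p q → (h :* :- p) :* (g :* :- q) :- (g :* :- p) :* (h :* :- q) := num 0) ≈-refl γ₁ γ₂ (-1^ k) (-1^ l))))

      cos-difference : ∀ k l → ¬ m ∣ k ℕ.* a → ¬ m ∣ l ℕ.* a → cos (τ * (doubleCos k - doubleCos l)) ≈ -1^ k * -1^ l
      cos-difference k l m∤ka m∤la = ≈-trans (cos-cong (≈-sym (angle≈ k l))) (≈-trans (cos-- _ _) (≈-trans
        (+-cong (*-cong (proj₁ (phase k m∤ka)) (proj₁ (phase l m∤la))) (*-cong (proj₂ (phase k m∤ka)) (proj₂ (phase l m∤la))))
        (≈-trans (solve 4 (λ g h p q → (g :* :- p) :* (g :* :- q) :+ (h :* :- p) :* (h :* :- q) := (g :* g :+ h :* h) :* (p :* q)) ≈-refl γ₁ γ₂ (-1^ k) (-1^ l))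
        (≈-trans (*-congʳ |γ|≈1) (*-identityˡ _)))))

      half : ℕ
      half = proj₁ m-even

      doubleCos-half : doubleCos half ≈ - fromℕ 2
      doubleCos-half = ≈-trans (*-congˡ (≈-trans (cs-cong (≡.sym (proj₂ m-even))) cs-m)) (solve 0 (num 2 :* :- num 1 := :- num 2) ≈-refl)

      τy≈0⇒y≈0 : ∀ {y} → τ * y ≈ 0# → y ≈ 0#
      τy≈0⇒y≈0 {y} τy≈0 = x*y≈0⇒x≈0 (≈-trans (*-comm y τ) τy≈0) (λ τ≈0 → <-irrefl (≈-sym τ≈0) 0<τ)

      -- τd = Dπ and τz = Eπ with integers D and E; from dx = z both τ and π cancel, so Dx = E. Here
      -- D ≠ 0 because d does not vanish.
      rational-x : ∀ z {d} → d * x ≈ z → ¬ d ≈ 0# → sin (τ * d) ≈ 0# → sin (τ * z) ≈ 0# → ¬ ¬ (m ∣ 2 ⊎ m ∣ 4 ⊎ m ∣ 6)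
      rational-x z {d} dx≈z d≉0 sin-d sin-z none = sin-zero _ sin-d λ (D , τd≈Dπ) → sin-zero _ sin-z λ (E , τz≈Eπ) →
        none (integral half ≡.refl D E
          (λ D≡0 → d≉0 (τy≈0⇒y≈0 (≈-trans τd≈Dπ (≈-trans (*-congʳ (≈-trans (≈-reflexive (≡.cong fromℤ D≡0)) fromℚ-0)) (zeroˡ π)))))
          (cancel-π (≈-trans (rearrange (fromℤ D) x π) (≈-trans (*-congʳ (≈-sym τd≈Dπ))
            (≈-trans (*-assoc τ d x) (≈-trans (*-congˡ dx≈z) τz≈Eπ))))))
        where
        rearrange : ∀ d x p → (d * x) * p ≈ (d * p) * x
        rearrange = solve 3 (λ d x p → (d :* x) :* p := (d :* p) :* x) ≈-refl
        cancel-π : ∀ {u v} → u * π ≈ v * π → u ≈ v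
        cancel-π uπ≈vπ = *-cancel-≈ 0<π (≈-trans (*-comm π _) (≈-trans uπ≈vπ (*-comm _ π)))
        integral : ∀ h → h ≡ half → ∀ D E → ¬ D ≡ + 0 → fromℤ D * x ≈ fromℤ E → m ∣ 2 ⊎ m ∣ 4 ⊎ m ∣ 6
        integral zero    h≡ = ⊥-elim (ℕ.1+n≢0 (≡.trans (proj₂ m-even) (≡.cong (2 ℕ.*_) (≡.sym h≡))))
        integral (suc h) h≡ D E D≢0 Dx≈E = let z , x≈z = rational⇒integer h (≈-trans (≈-reflexive (≡.cong doubleCos h≡)) doubleCos-half) D E D≢0 Dx≈E
          in integer-x z x≈z

      sin-sum : ∀ {u v} → sin (τ * u) ≈ 0# → sin (τ * v) ≈ 0# → sin (τ * (u + v)) ≈ 0#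
      sin-sum {u} {v} sin-u sin-v = ≈-trans (sin-cong (distribˡ τ u v)) (≈-trans (sin-+ _ _)
        (≈-trans (+-cong (*-congʳ sin-u) (*-congˡ sin-v)) (solve 2 (λ a b → num 0 :* a :+ b :* num 0 := num 0) ≈-refl (cos (τ * v)) (cos (τ * u)))))

      a<m : a ℕ.< m
      a<m = ℕ.s≤s a≤n

      m∤a : ¬ m ∣ 1 ℕ.* a
      m∤a m∣a = ℕ.<⇒≱ a<m (∣⇒≤ {{ℕ.>-nonZero 0<a}} (≡.subst (m ∣_) (ℕ.*-identityˡ a) m∣a))

      -- 2a lies strictly between 0 and 2m, and 2a = m would mean a = b, as a + b = m.
      m∤2a : ¬ m ∣ 2 ℕ.* a
      m∤2a (divides 0 eq) = ℕ.<⇒≢ (ℕ.<-≤-trans 0<a (ℕ.m≤m+n a _)) (≡.sym eq)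
      m∤2a (divides 1 eq) = a≢b (ℕ.+-cancelˡ-≡ a a b (≡.trans (≡.cong (a ℕ.+_) (≡.sym (ℕ.+-identityʳ a)))
        (≡.trans eq (≡.trans (ℕ.*-identityˡ m) (≡.sym a+b≡m)))))
      m∤2a (divides (suc (suc q)) eq) = ℕ.<⇒≱ (ℕ.+-mono-< a<m (≡.subst (ℕ._< m) (≡.sym (ℕ.+-identityʳ a)) a<m))
        (≡.subst (m ℕ.+ m ℕ.≤_) (≡.sym eq) (ℕ.+-monoʳ-≤ m (ℕ.m≤m+n m (q ℕ.* m))))

      ∤-+ : ∀ j k → m ∣ j ℕ.* a → ¬ m ∣ k ℕ.* a → ¬ m ∣ (j ℕ.+ k) ℕ.* a
      ∤-+ j k m∣ja m∤ka m∣ = m∤ka (∣m+n∣m⇒∣n (≡.subst (m ∣_) (ℕ.*-distribʳ-+ a j k) m∣) m∣ja)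

      -- Two distinct vertices give m ≥ 3, and m is even.
      4≤m : 4 ℕ.≤ m
      4≤m = even half (proj₂ m-even)
        where
        3≤m : 3 ℕ.≤ m
        3≤m = ℕ.s≤s (two-vertices 0<a 0<b a≤n b≤n a≢b)
          where
          two-vertices : ∀ {a b n} → 0 ℕ.< a → 0 ℕ.< b → a ℕ.≤ n → b ℕ.≤ n → a ≢ b → 2 ℕ.≤ n
          two-vertices {suc zero} {suc zero} _ _ _ _ a≢b = ⊥-elim (a≢b ≡.refl)
          two-vertices {suc (suc _)} _ _ a≤n _ _ = ℕ.≤-trans (ℕ.s≤s (ℕ.s≤s ℕ.z≤n)) a≤n
          two-vertices {suc zero} {suc (suc _)} _ _ _ b≤n _ = ℕ.≤-trans (ℕ.s≤s (ℕ.s≤s ℕ.z≤n)) b≤n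
        even : ∀ h → m ≡ 2 ℕ.* h → 4 ℕ.≤ m
        even 0 m≡ = ⊥-elim (ℕ.1+n≢0 m≡)
        even 1 m≡ = ⊥-elim (ℕ.<⇒≱ 3≤m (ℕ.≤-reflexive m≡))
        even (suc (suc h)) m≡ = ≡.subst (4 ℕ.≤_) (≡.sym m≡) (ℕ.*-monoʳ-≤ 2 (ℕ.s≤s (ℕ.s≤s (ℕ.z≤n {h}))))

      m∤2 : ¬ m ∣ 2
      m∤2 m∣2 = ℕ.<⇒≱ 4≤m (ℕ.≤-trans (∣⇒≤ m∣2) (ℕ.s≤s (ℕ.s≤s ℕ.z≤n)))

      at-4 : m ∣ 4 → Exceptional n a b
      at-4 m∣4 = ≡.subst (λ n → Exceptional n a b) (≡.sym (ℕ.suc-injective m≡4)) (vertices-4 a b 0<a 0<b a≢b (≡.trans a+b≡m m≡4))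
        where
        m≡4 : m ≡ 4
        m≡4 = ∣4⇒≡4 4≤m m∣4

      at-6 : m ∣ 3 ℕ.* a ⊎ m ∣ 4 ℕ.* a → m ∣ 6 → Exceptional n a b
      at-6 m∣ m∣6 = ≡.subst (λ n → Exceptional n a b) (≡.sym (ℕ.suc-injective m≡6)) (vertices-6 a b 0<a 0<b a≢b (≡.trans a+b≡m m≡6)
        (≡.subst (λ m → m ∣ 3 ℕ.* a ⊎ m ∣ 4 ℕ.* a) m≡6 m∣))
        where
        m≡6 : m ≡ 6
        m≡6 = ∣6⇒≡6 4≤m m∣6

      at-8 : m ∣ 4 ℕ.* a → m ∣ 8 → Exceptional n a b
      at-8 m∣4a m∣8 with ∣8⇒≡4⊎≡8 4≤m m∣8
      ... | inj₁ m≡4 = at-4 (≡.subst (m ∣_) m≡4 ∣-refl)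
      ... | inj₂ m≡8 = ≡.subst (λ n → Exceptional n a b) (≡.sym (ℕ.suc-injective m≡8)) (vertices-8 a b 0<a 0<b a≢b (≡.trans a+b≡m m≡8)
        (≡.subst (λ m → m ∣ 4 ℕ.* a) m≡8 m∣4a))

      zero-difference : ∀ {u v} → u - v ≈ 0# → u ≈ v
      zero-difference {u} {v} u-v≈0 = ≈-trans (solve 2 (λ u v → u := v :+ (u :- v)) ≈-refl u v) (≈-trans (+-congˡ u-v≈0) (+-identityʳ v))

      -- Here the indices 1 to 4 all carry a phase. The phases of 2 and 3 are opposite, so the
      -- cosine of τ times their difference is -1 and the difference is nonzero; the resulting
      -- divisors 2, 4 and 6 are then refuted one by one.
      generic-impossible : ¬ m ∣ 3 ℕ.* a → ¬ m ∣ 4 ℕ.* a → ⊥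
      generic-impossible m∤3a m∤4a = rational-x ((doubleCos 1 - doubleCos 2) + (doubleCos 3 - doubleCos 4)) relation
          (λ d≈0 → -1≉1 (≈-trans (≈-sym cos-23) (≈-trans (cos-cong (≈-trans (*-congˡ d≈0) (zeroʳ τ))) cos-0)))
          (sin-difference 2 3 m∤2a m∤3a) (sin-sum (sin-difference 1 2 m∤a m∤2a) (sin-difference 3 4 m∤3a m∤4a))
          λ where
            (inj₁ m∣2) → m∤2 m∣2
            (inj₂ (inj₁ m∣4)) → m∤4a (∣m⇒∣m*n a m∣4)
            (inj₂ (inj₂ m∣6)) → m≢6 (∣6⇒≡6 4≤m m∣6)
        where
        relation : (doubleCos 2 - doubleCos 3) * x ≈ (doubleCos 1 - doubleCos 2) + (doubleCos 3 - doubleCos 4)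
        relation = ≈-trans (solve 3 (λ c d x → (c :- d) :* x := x :* c :- x :* d) ≈-refl _ _ x)
          (≈-trans (+-cong (x*doubleCos 1) (-‿cong (x*doubleCos 2)))
          (solve 4 (λ c d e f → (c :+ e) :- (d :+ f) := (c :- d) :+ (e :- f)) ≈-refl _ _ _ _))
        -1≉1 : ¬ - 1# ≈ 1#
        -1≉1 -1≈1 = <-irrefl (≈-trans (solve 0 (num 0 := num 1 :+ :- num 1) ≈-refl) (≈-trans (+-congˡ -1≈1) ≈-refl)) (0<-+-≤ 0<1 (<⇒≤ 0<1))
        cos-12 : cos (τ * (doubleCos 1 - doubleCos 2)) ≈ - 1#
        cos-12 = ≈-trans (cos-difference 1 2 m∤a m∤2a) (solve 0 ((:- num 1 :* num 1) :* (:- num 1 :* (:- num 1 :* num 1)) := :- num 1) ≈-refl)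
        cos-23 : cos (τ * (doubleCos 2 - doubleCos 3)) ≈ - 1#
        cos-23 = ≈-trans (cos-difference 2 3 m∤2a m∤3a)
          (solve 0 ((:- num 1 :* (:- num 1 :* num 1)) :* (:- num 1 :* (:- num 1 :* (:- num 1 :* num 1))) := :- num 1) ≈-refl)
        -- For m = 6 the numbers doubleCos 1, 2, 3 are 1, -1, -2, so the first difference is twice the second.
        m≢6 : m ≢ 6
        m≢6 m≡6 = -1≉1 (≈-trans (≈-sym cos-12) (≈-trans (cos-cong (≈-trans (*-congˡ twice) (distribˡ τ u u)))
            (≈-trans (cos-+ (τ * u) (τ * u)) (≈-trans (+-cong (*-cong cos-23 cos-23) (-‿cong (*-congʳ (sin-difference 2 3 m∤2a m∤3a))))
            (solve 1 (λ s → :- num 1 :* :- num 1 :- num 0 :* s := num 1) ≈-refl (sin (τ * u)))))))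
          where
          u : Carrier
          u = doubleCos 2 - doubleCos 3
          x²≈1 : x * x ≈ 1#
          x²≈1 = zero-difference (x*y≈0⇒x≈0 (≈-trans (≈-sym sn-6) (≈-trans (sn-cong (≡.sym m≡6)) sn-m)) (nonzero m∤2))
          c₂ : doubleCos 2 ≈ x * x - fromℕ 2
          c₂ = ≈-trans (doubleCos-suc 0) (+-congˡ (-‿cong (≈-trans (*-congˡ cs-0) (*-identityʳ (fromℕ 2)))))
          c₃ : doubleCos 3 ≈ - fromℕ 2
          c₃ = ≈-trans (*-congˡ (≈-trans (cs-cong (≡.sym m≡6)) cs-m)) (solve 0 (num 2 :* :- num 1 := :- num 2) ≈-refl)
          c₃′ : doubleCos 3 ≈ - (fromℕ 2 * x)
          c₃′ = ≈-trans (doubleCos-suc 1) (≈-trans (+-congʳ (*-congˡ c₂)) (≈-trans (+-congʳ (*-congˡ (+-congʳ x²≈1)))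
            (solve 1 (λ x → x :* (num 1 :- num 2) :- x := :- (num 2 :* x)) ≈-refl x)))
          x≈1 : x ≈ 1#
          x≈1 = ≈-trans (solve 1 (λ x → x := con (ℚ.- ½) :* :- (num 2 :* x)) ≈-refl x) (≈-trans (*-congˡ (≈-trans (≈-sym c₃′) c₃))
            (solve 0 (con (ℚ.- ½) :* :- num 2 := num 1) ≈-refl))
          twice : doubleCos 1 - doubleCos 2 ≈ u + u
          twice = ≈-trans (+-cong x≈1 (-‿cong c₂′)) (≈-trans (solve 0 (num 1 :- (num 1 :- num 2) := (num 1 :- num 2 :- :- num 2) :+ (num 1 :- num 2 :- :- num 2)) ≈-refl)
            (≈-sym (+-cong u≈ u≈)))
            where
            c₂′ : doubleCos 2 ≈ 1# - fromℕ 2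
            c₂′ = ≈-trans c₂ (+-congʳ x²≈1)
            u≈ : u ≈ 1# - fromℕ 2 - - fromℕ 2
            u≈ = +-cong c₂′ (-‿cong c₃)

      -- Index 3 carries no phase, but it cancels when the difference of the indices 2 and 4 is
      -- multiplied by x, leaving 1 and 5. If that difference is zero, then sn 6 sn 2 = 0 and m ∣ 6.
      third : m ∣ 3 ℕ.* a → ¬ ¬ Exceptional n a b
      third m∣3a = by-cases (doubleCos 2 - doubleCos 4 ≈ 0#)
        (λ d≈0 none → none (at-6 (inj₁ m∣3a) (sn-zero 6 (x*y≈0⇒x≈0 (sines d≈0) (nonzero m∤2)))))
        (λ d≉0 none → rational-x (doubleCos 1 - doubleCos 5) relation d≉0 (sin-difference 2 4 m∤2a m∤4a) (sin-difference 1 5 m∤a m∤5a)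
          λ where
            (inj₁ m∣2) → m∤2 m∣2
            (inj₂ (inj₁ m∣4)) → none (at-4 m∣4)
            (inj₂ (inj₂ m∣6)) → none (at-6 (inj₁ m∣3a) m∣6))
        where
        m∤4a : ¬ m ∣ 4 ℕ.* a
        m∤4a = ∤-+ 3 1 m∣3a m∤a
        m∤5a : ¬ m ∣ 5 ℕ.* a
        m∤5a = ∤-+ 3 2 m∣3a m∤2a
        relation : (doubleCos 2 - doubleCos 4) * x ≈ doubleCos 1 - doubleCos 5
        relation = ≈-trans (solve 3 (λ c d x → (c :- d) :* x := x :* c :- x :* d) ≈-refl _ _ x)
          (≈-trans (+-cong (x*doubleCos 1) (-‿cong (x*doubleCos 3)))
          (solve 3 (λ c d e → (c :+ d) :- (d :+ e) := c :- e) ≈-refl _ _ _))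
        sines : doubleCos 2 - doubleCos 4 ≈ 0# → sn 6 * sn 2 ≈ 0#
        sines d≈0 = ≈-trans (solve 2 (λ s t → s :* t := con (+ 1 / 4) :* (num 2 :* (num 2 :* t :* s))) ≈-refl (sn 6) (sn 2))
          (≈-trans (*-congˡ (≈-trans (*-congˡ (≈-sym (cs-difference 4 2))) (solve 3 (λ t c d → t :* (c :- d) := t :* c :- t :* d) ≈-refl (fromℕ 2) (cs 4) (cs 8))))
          (≈-trans (*-congˡ d≈0) (zeroʳ _)))

      -- Index 4 carries no phase. The neighbours of the indices 2 and 6 are 1, 3, 5, 7, which avoid
      -- it. If their difference is zero, then sn 8 sn 4 = 0, so m ∣ 4 or m ∣ 8.
      quarter : m ∣ 4 ℕ.* a → ¬ ¬ Exceptional n a b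
      quarter m∣4a = by-cases (doubleCos 2 - doubleCos 6 ≈ 0#)
        -- `by-cases` proves negations only; to reach ⊥ itself, the statement negated is the true
        -- equation of 0# with itself, supplied as the last argument.
        (λ d≈0 none → by-cases (sn 4 ≈ 0#)
          (λ sn4≈0 _ → none (at-4 (sn-zero 4 sn4≈0)))
          (λ sn4≉0 _ → none (at-8 m∣4a (sn-zero 8 (x*y≈0⇒x≈0 (sines d≈0) sn4≉0)))) (≈-refl {0#}))
        (λ d≉0 none → rational-x ((doubleCos 1 - doubleCos 5) + (doubleCos 3 - doubleCos 7)) relation d≉0 (sin-difference 2 6 m∤2a m∤6a)
          (sin-sum (sin-difference 1 5 m∤a m∤5a) (sin-difference 3 7 m∤3a m∤7a))
          λ where
            (inj₁ m∣2) → m∤2 m∣2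
            (inj₂ (inj₁ m∣4)) → none (at-4 m∣4)
            (inj₂ (inj₂ m∣6)) → none (at-6 (inj₂ m∣4a) m∣6))
        where
        m∤3a : ¬ m ∣ 3 ℕ.* a
        m∤3a m∣3a = ∤-+ 3 1 m∣3a m∤a m∣4a
        m∤5a : ¬ m ∣ 5 ℕ.* a
        m∤5a = ∤-+ 4 1 m∣4a m∤a
        m∤6a : ¬ m ∣ 6 ℕ.* a
        m∤6a = ∤-+ 4 2 m∣4a m∤2a
        m∤7a : ¬ m ∣ 7 ℕ.* a
        m∤7a = ∤-+ 4 3 m∣4a m∤3a
        relation : (doubleCos 2 - doubleCos 6) * x ≈ (doubleCos 1 - doubleCos 5) + (doubleCos 3 - doubleCos 7)
        relation = ≈-trans (solve 3 (λ c d x → (c :- d) :* x := x :* c :- x :* d) ≈-refl _ _ x)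
          (≈-trans (+-cong (x*doubleCos 1) (-‿cong (x*doubleCos 5)))
          (solve 4 (λ c d e f → (c :+ e) :- (d :+ f) := (c :- d) :+ (e :- f)) ≈-refl _ _ _ _))
        sines : doubleCos 2 - doubleCos 6 ≈ 0# → sn 8 * sn 4 ≈ 0#
        sines d≈0 = ≈-trans (solve 2 (λ s t → s :* t := con (+ 1 / 4) :* (num 2 :* (num 2 :* t :* s))) ≈-refl (sn 8) (sn 4))
          (≈-trans (*-congˡ (≈-trans (*-congˡ (≈-sym (cs-difference 4 4))) (solve 3 (λ t c d → t :* (c :- d) := t :* c :- t :* d) ≈-refl (fromℕ 2) (cs 4) (cs 12))))
          (≈-trans (*-congˡ d≈0) (zeroʳ _)))

      exceptional : ¬ ¬ Exceptional n a b
      exceptional none = by-cases (m ∣ 3 ℕ.* a)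
        (λ m∣3a _ → third m∣3a none)
        (λ m∤3a _ → by-cases (m ∣ 4 ℕ.* a)
          (λ m∣4a _ → quarter m∣4a none)
          (λ m∤4a _ → generic-impossible m∤3a m∤4a) (≈-refl {0#}))
        (≈-refl {0#})

  -- Matrices and perfect state transfer

  module Mat = Matrices (RawRing.rawSemiring rawRing)
  open Mat using (Matrix; basis; _⊗_; _⊗ᵛ_; _^ᴹ_)
  private module Sum = SemiringSum semiring

  sum-cong : ∀ {n} {f g : Fin n → Carrier} → (∀ i → f i ≈ g i) → sum f ≈ sum g
  sum-cong f≈g = Sum.sum-cong-≋ f≈g

  sum-scale : ∀ {n} c (f : Fin n → Carrier) → sum (λ i → c * f i) ≈ c * sum f
  sum-scale c f = ≈-sym (Sum.*-distribˡ-sum c f)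

  sum-+ : ∀ {n} (f g : Fin n → Carrier) → sum (λ i → f i + g i) ≈ sum f + sum g
  sum-+ = Sum.∑-distrib-+

  sum-swap : ∀ {m n} (f : Fin m → Fin n → Carrier) → sum (λ i → sum (f i)) ≈ sum (λ j → sum (λ i → f i j))
  sum-swap = Sum.∑-comm

  sum-basis : ∀ {n} (v : Fin n) (f : Fin n → Carrier) → sum (λ k → f k * basis v k) ≈ f v
  sum-basis {suc n} zero f = ≈-trans (+-cong (*-identityʳ (f zero))
    (≈-trans (sum-cong {g = λ i → 0# * f (suc i)} (λ i → *-comm (f (suc i)) 0#)) (≈-trans (sum-scale 0# (f ∘ suc)) (zeroˡ _)))) (+-identityʳ (f zero))
  sum-basis {suc n} (suc v) f = ≈-trans (+-cong (zeroʳ (f zero)) (sum-basis v (f ∘ suc))) (+-identityˡ (f (suc v)))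

  sum-⊑ : ∀ {n} (f : Fin n → Carrier) {b} → (∀ i → f i ⊑ b) → sum f ⊑ fromℕ n * b
  sum-⊑ {zero}  f {b} f⊑b = ⊑-resp ≈-refl (≈-sym (≈-trans (*-congʳ fromℚ-0) (zeroˡ b))) (0≤⇒⊑ ≤-refl ≤-refl)
  sum-⊑ {suc n} f {b} f⊑b = ⊑-resp ≈-refl (≈-trans (solve 2 (λ n b → b :+ n :* b := (num 1 :+ n) :* b) ≈-refl (fromℕ n) b) (*-congʳ (≈-sym (fromℕ-suc n))))
    (⊑-+ (f⊑b zero) (sum-⊑ (f ∘ suc) (f⊑b ∘ suc)))

  ⟶-sum : ∀ {n} {s : Fin n → ℕ → Carrier} {l : Fin n → Carrier} → (∀ i → s i ⟶ l i) → (λ N → sum (λ i → s i N)) ⟶ sum l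
  ⟶-sum {zero}  s⟶l = ⟶-const 0#
  ⟶-sum {suc n} s⟶l = ⟶-+ (s⟶l zero) (⟶-sum (s⟶l ∘ suc))

  module _ {n : ℕ} (K : Matrix n) where
    Eigenvector : (Fin n → Carrier) → Carrier → Set
    Eigenvector w θ = ∀ i → (K ⊗ᵛ w) i ≈ θ * w i

    power-⊗ᵛ : ∀ {w θ} → Eigenvector w θ → ∀ k i → ((K ^ᴹ k) ⊗ᵛ w) i ≈ θ ^ k * w i
    power-⊗ᵛ {w} eigen zero i = ≈-trans (sum-cong {g = λ j → w j * basis i j} (λ j → ≈-trans (*-comm _ (w j)) (*-congˡ (basis-sym i j)))) (≈-trans (sum-basis i w) (≈-sym (*-identityˡ (w i))))
      where
      basis-sym : ∀ {n} (i j : Fin n) → basis j i ≈ basis i j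
      basis-sym zero    zero    = ≈-refl
      basis-sym zero    (suc j) = ≈-refl
      basis-sym (suc i) zero    = ≈-refl
      basis-sym (suc i) (suc j) = basis-sym i j
    power-⊗ᵛ {w} {θ} eigen (suc k) i = ≈-trans
      (sum-cong {g = λ j → sum (λ l → K i l * ((K ^ᴹ k) l j * w j))}
        (λ j → ≈-trans (Sum.*-distribʳ-sum (w j) (λ l → K i l * (K ^ᴹ k) l j)) (sum-cong {n} (λ l → *-assoc (K i l) ((K ^ᴹ k) l j) (w j)))))
      (≈-trans (sum-swap (λ j l → K i l * ((K ^ᴹ k) l j * w j)))
      (≈-trans (sum-cong {g = λ l → θ ^ k * (K i l * w l)} (λ l → ≈-trans (sum-scale (K i l) (λ j → (K ^ᴹ k) l j * w j))
        (≈-trans (*-congˡ (power-⊗ᵛ eigen k l)) (swap (K i l) (θ ^ k) (w l)))))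
      (≈-trans (sum-scale (θ ^ k) (λ l → K i l * w l)) (≈-trans (*-congˡ (eigen i))
      (solve 3 (λ p t w → p :* (t :* w) := (t :* p) :* w) ≈-refl (θ ^ k) θ (w i))))))
      where
      swap : ∀ a b c → a * (b * c) ≈ b * (a * c)
      swap = solve 3 (λ a b c → a :* (b :* c) := b :* (a :* c)) ≈-refl

    -- The version for row vectors: it pairs the columns of the powers with w, symmetry making w a
    -- left eigenvector.
    ⊗ᵛ-power : (∀ i j → K i j ≈ K j i) → ∀ {w θ} → Eigenvector w θ → ∀ k j → sum (λ i → w i * (K ^ᴹ k) i j) ≈ θ ^ k * w j
    ⊗ᵛ-power symmetric {w} eigen zero j = ≈-trans (sum-basis j w) (≈-sym (*-identityˡ (w j)))
    ⊗ᵛ-power symmetric {w} {θ} eigen (suc k) j = ≈-trans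
      (sum-cong {g = λ i → sum (λ l → w i * (K i l * (K ^ᴹ k) l j))} (λ i → ≈-sym (sum-scale (w i) (λ l → K i l * (K ^ᴹ k) l j))))
      (≈-trans (sum-swap (λ i l → w i * (K i l * (K ^ᴹ k) l j)))
      (≈-trans (sum-cong {g = λ l → θ * (w l * (K ^ᴹ k) l j)} (λ l → ≈-trans
        (sum-cong {g = λ i → (K ^ᴹ k) l j * (K l i * w i)} (λ i → ≈-trans (*-congˡ (*-congʳ (symmetric i l))) (swap (w i) (K l i) ((K ^ᴹ k) l j))))
        (≈-trans (sum-scale ((K ^ᴹ k) l j) (λ i → K l i * w i)) (≈-trans (*-congˡ (eigen l)) (swap′ ((K ^ᴹ k) l j) θ (w l))))))
      (≈-trans (sum-scale θ (λ l → w l * (K ^ᴹ k) l j)) (≈-trans (*-congˡ (⊗ᵛ-power symmetric eigen k j)) (≈-sym (*-assoc θ (θ ^ k) (w j)))))))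
      where
      swap : ∀ a b c → a * (b * c) ≈ c * (b * a)
      swap = solve 3 (λ a b c → a :* (b :* c) := c :* (b :* a)) ≈-refl
      swap′ : ∀ a b c → a * (b * c) ≈ b * (c * a)
      swap′ = solve 3 (λ a b c → a :* (b :* c) := b :* (c :* a)) ≈-refl

    -- Geometric growth of the entries is the domination asked for by
    -- `exponential-series-converges`.
    power-⊑ : ∀ {κ} → (∀ i j → K i j ⊑ κ) → ∀ k i j → (K ^ᴹ k) i j ⊑ (fromℕ n * κ) ^ k
    power-⊑ K⊑κ zero    i j = basis-⊑ i j
      where
      basis-⊑ : ∀ {n} (i j : Fin n) → basis j i ⊑ 1#
      basis-⊑ zero    zero    = 0≤⇒⊑ (<⇒≤ 0<1) ≤-refl
      basis-⊑ zero    (suc j) = 0≤⇒⊑ ≤-refl (<⇒≤ 0<1)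
      basis-⊑ (suc i) zero    = 0≤⇒⊑ ≤-refl (<⇒≤ 0<1)
      basis-⊑ (suc i) (suc j) = basis-⊑ i j
    power-⊑ {κ} K⊑κ (suc k) i j = ⊑-resp ≈-refl (≈-sym (*-assoc (fromℕ n) κ _))
      (sum-⊑ (λ l → K i l * (K ^ᴹ k) l j) (λ l → ⊑-* (K⊑κ i l) (power-⊑ K⊑κ k l j)))

    -- The real and minus the imaginary part of the entries of the series of exp (-iτK), for e = reI and e = imI.
    entrySeries : (ℕ → Carrier) → Carrier → Fin n → Fin n → ℕ → Carrier
    entrySeries e τ i j N = ∑ N (λ k → e k * (dividedPower k τ * (K ^ᴹ k) i j))

    entrySeries-converges : ∀ {κ} → (∀ i j → K i j ⊑ κ) → ∀ e → (∀ k → e k ⊑ 1#) → ∀ τ i j → ∃[ l ] entrySeries e τ i j ⟶ l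
    entrySeries-converges {κ} K⊑κ e e⊑1 τ i j = proj₁ sums , ⟶-resp
        (λ N → ∑-cong N {λ k → inverseFactorial k * (e k * (τ ^ k * (K ^ᴹ k) i j))} {λ k → e k * (dividedPower k τ * (K ^ᴹ k) i j)}
          (λ k → swap (inverseFactorial k) (e k) (τ ^ k) ((K ^ᴹ k) i j)))
        ≈-refl (proj₂ sums)
      where
      swap : ∀ f e t p → f * (e * (t * p)) ≈ e * ((f * t) * p)
      swap = solve 4 (λ f e t p → f :* (e :* (t :* p)) := e :* ((f :* t) :* p)) ≈-refl
      T : ∃[ T ] τ ⊑ fromℕ (suc T)
      T = ⊑-fromℕ τ
      B : Carrier
      B = fromℕ (suc (proj₁ T)) * (fromℕ n * κ)
      ^-* : ∀ k x y → x ^ k * y ^ k ≈ (x * y) ^ k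
      ^-* zero    x y = *-identityˡ 1#
      ^-* (suc k) x y = ≈-trans (solve 4 (λ x p y q → (x :* p) :* (y :* q) := (x :* y) :* (p :* q)) ≈-refl x (x ^ k) y (y ^ k)) (*-congˡ (^-* k x y))
      0≤B : 0# ≤ B
      0≤B = 0≤-* (0≤fromℕ (suc (proj₁ T))) (0≤-* (0≤fromℕ n) (⊑⇒0≤ (K⊑κ i j)))
      sums : ∃[ l ] (λ N → ∑ N (λ k → inverseFactorial k * (e k * (τ ^ k * (K ^ᴹ k) i j)))) ⟶ l
      sums = exponential-series-converges 0≤B (λ k → e k * (τ ^ k * (K ^ᴹ k) i j)) (λ k →
        ⊑-resp ≈-refl (≈-trans (*-identityˡ _) (^-* k _ _)) (⊑-* (e⊑1 k) (⊑-* (^-⊑ k (proj₂ T)) (power-⊑ K⊑κ k i j))))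

    powerSeries-eigenvalue : ∀ e τ θ z N → ∑ N (λ k → e k * (dividedPower k τ * (θ ^ k * z))) ≈ powerSeries e (τ * θ) N * z
    powerSeries-eigenvalue e τ θ z N = ≈-trans (∑-cong N {g = λ k → z * (e k * dividedPower k (τ * θ))} (λ k →
        ≈-trans (rearrange (e k) (inverseFactorial k) (τ ^ k) (θ ^ k) z) (*-congˡ (*-congˡ (*-congˡ (^-* k))))))
      (≈-trans (∑-scale N z (λ k → e k * dividedPower k (τ * θ))) (*-comm z _))
      where
      rearrange : ∀ e f t p z → e * ((f * t) * (p * z)) ≈ z * (e * (f * (t * p)))
      rearrange = solve 5 (λ e f t p z → e :* ((f :* t) :* (p :* z)) := z :* (e :* (f :* (t :* p)))) ≈-refl
      ^-* : ∀ k → τ ^ k * θ ^ k ≈ (τ * θ) ^ k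
      ^-* zero    = *-identityˡ 1#
      ^-* (suc k) = ≈-trans (solve 4 (λ x p y q → (x :* p) :* (y :* q) := (x :* y) :* (p :* q)) ≈-refl τ (τ ^ k) θ (θ ^ k)) (*-congˡ (^-* k))

    -- Testing exp (-iτK) eₐ = γ e_b against an eigenvector.
    transfer-phase : (∀ i j → K i j ≈ K j i) → ∀ e {τ L g} {P : Fin n → Carrier} {w θ} {a b : Fin n} → Eigenvector w θ →
      powerSeries e (τ * θ) ⟶ L → (∀ i → entrySeries e τ i a ⟶ P i) → (∀ i → P i ≈ g * basis b i) → L * w a ≈ g * w b
    transfer-phase symmetric e {τ} {L} {g} {P} {w} {θ} {a} {b} eigen series⟶L entries⟶P P≈ = ⟶-unique
      (⟶-resp partial-sums ≈-refl (⟶-* series⟶L (⟶-const (w a))))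
      (⟶-resp (λ _ → ≈-refl) limit≈ (⟶-sum (λ i → ⟶-scale (w i) (entries⟶P i))))
      where
      limit≈ : sum (λ i → w i * P i) ≈ g * w b
      limit≈ = ≈-trans (sum-cong {g = λ i → g * (w i * basis b i)} (λ i → ≈-trans (*-congˡ (P≈ i)) (swap (w i) g (basis b i))))
        (≈-trans (sum-scale g (λ i → w i * basis b i)) (*-congˡ (sum-basis b w)))
        where
        swap : ∀ a b c → a * (b * c) ≈ b * (a * c)
        swap = solve 3 (λ a b c → a :* (b :* c) := b :* (a :* c)) ≈-refl
      partial-sums : ∀ N → powerSeries e (τ * θ) N * w a ≈ sum (λ i → w i * entrySeries e τ i a N)
      partial-sums N = ≈-sym (≈-trans
        (sum-cong {g = λ i → ∑ N (λ k → w i * (e k * (dividedPower k τ * (K ^ᴹ k) i a)))} (λ i → ≈-sym (∑-scale N (w i) (λ k → e k * (dividedPower k τ * (K ^ᴹ k) i a)))))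
        (≈-trans (sum-swap {n} {N} (λ i k → w i * (e (toℕ k) * (dividedPower (toℕ k) τ * (K ^ᴹ toℕ k) i a))))
        (≈-trans (∑-cong N {λ k → sum (λ i → w i * (e k * (dividedPower k τ * (K ^ᴹ k) i a)))} {λ k → e k * (dividedPower k τ * (θ ^ k * w a))} (λ k → ≈-trans
          (sum-cong {g = λ i → (e k * dividedPower k τ) * (w i * (K ^ᴹ k) i a)} (λ i → rearrange (w i) (e k) (dividedPower k τ) ((K ^ᴹ k) i a)))
          (≈-trans (sum-scale (e k * dividedPower k τ) (λ i → w i * (K ^ᴹ k) i a)) (≈-trans (*-congˡ (⊗ᵛ-power symmetric eigen k a)) (*-assoc _ _ _)))))
        (powerSeries-eigenvalue e τ θ (w a) N))))
        where
        rearrange : ∀ w e d p → w * (e * (d * p)) ≈ (e * d) * (w * p)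
        rearrange = solve 4 (λ w e d p → w :* (e :* (d :* p)) := (e :* d) :* (w :* p)) ≈-refl

    -- exp (-iτK) u = (g - ih) v
    record Evolves (τ g h : Carrier) (u v : Fin n → Carrier) : Set where
      constructor evolves
      field
        re-part : ∀ i → (λ N → ∑ N (λ k → reI k * (dividedPower k τ * ((K ^ᴹ k) ⊗ᵛ u) i))) ⟶ g * v i
        im-part : ∀ i → (λ N → ∑ N (λ k → imI k * (dividedPower k τ * ((K ^ᴹ k) ⊗ᵛ u) i))) ⟶ h * v i
    open Evolves public

    module _ {τ g h : Carrier} where
      -- The factor ε, in use 1 or -1, moves a sign from the phase into the vector. Eigenvectors of
      -- opposite phase then share the same g - ih and can be added.
      evolves-eigenvector : ∀ {w θ ε} → Eigenvector w θ → cos (τ * θ) ≈ g * ε → sin (τ * θ) ≈ h * ε →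
        Evolves τ g h w (λ i → ε * w i)
      evolves-eigenvector {w} {θ} {ε} eigen cos≈ sin≈ = evolves
        (part reI (cos-limit (τ * θ)) cos≈) (part imI (sin-limit (τ * θ)) sin≈)
        where
        part : ∀ e {L f} → powerSeries e (τ * θ) ⟶ L → L ≈ f * ε → ∀ i →
          (λ N → ∑ N (λ k → e k * (dividedPower k τ * ((K ^ᴹ k) ⊗ᵛ w) i))) ⟶ f * (ε * w i)
        part e {f = f} series⟶L L≈ i = ⟶-resp
          (λ N → ≈-trans (≈-sym (powerSeries-eigenvalue e τ θ (w i) N)) (∑-cong N {λ k → e k * (dividedPower k τ * (θ ^ k * w i))}
            {λ k → e k * (dividedPower k τ * ((K ^ᴹ k) ⊗ᵛ w) i)} (λ k → *-congˡ (*-congˡ (≈-sym (power-⊗ᵛ eigen k i))))))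
          (≈-trans (*-congʳ L≈) (*-assoc f ε (w i))) (⟶-* series⟶L (⟶-const (w i)))

      evolves-+ : ∀ {u v u′ v′} → Evolves τ g h u v → Evolves τ g h u′ v′ → Evolves τ g h (λ i → u i + u′ i) (λ i → v i + v′ i)
      evolves-+ {u} {v} {u′} {v′} E E′ = evolves (λ i → part reI i (re-part E i) (re-part E′ i)) (λ i → part imI i (im-part E i) (im-part E′ i))
        where
        part : ∀ e i {f} → (λ N → ∑ N (λ k → e k * (dividedPower k τ * ((K ^ᴹ k) ⊗ᵛ u) i))) ⟶ f * v i →
          (λ N → ∑ N (λ k → e k * (dividedPower k τ * ((K ^ᴹ k) ⊗ᵛ u′) i))) ⟶ f * v′ i →
          (λ N → ∑ N (λ k → e k * (dividedPower k τ * ((K ^ᴹ k) ⊗ᵛ (λ j → u j + u′ j)) i))) ⟶ f * (v i + v′ i)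
        part e i {f} s s′ = ⟶-resp (λ N → ≈-trans
            (≈-sym (∑-+ N (λ k → e k * (dividedPower k τ * ((K ^ᴹ k) ⊗ᵛ u) i)) (λ k → e k * (dividedPower k τ * ((K ^ᴹ k) ⊗ᵛ u′) i))))
            (∑-cong N (λ k → ≈-trans (factor (e k) (dividedPower k τ) _ _)
            (*-congˡ (*-congˡ (≈-trans (≈-sym (sum-+ (λ j → (K ^ᴹ k) i j * u j) (λ j → (K ^ᴹ k) i j * u′ j)))
              (sum-cong {n} (λ j → ≈-sym (distribˡ ((K ^ᴹ k) i j) (u j) (u′ j))))))))))
          (≈-sym (distribˡ f (v i) (v′ i))) (⟶-+ s s′)
          where
          factor : ∀ e d a b → e * (d * a) + e * (d * b) ≈ e * (d * (a + b))
          factor = solve 4 (λ e d a b → e :* (d :* a) :+ e :* (d :* b) := e :* (d :* (a :+ b))) ≈-refl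

      evolves-scale : ∀ c {u v} → Evolves τ g h u v → Evolves τ g h (λ i → c * u i) (λ i → c * v i)
      evolves-scale c {u} {v} E = evolves (λ i → part reI i (re-part E i)) (λ i → part imI i (im-part E i))
        where
        rotate : ∀ a b c → a * (b * c) ≈ b * (a * c)
        rotate = solve 3 (λ a b c → a :* (b :* c) := b :* (a :* c)) ≈-refl
        part : ∀ e i {f} → (λ N → ∑ N (λ k → e k * (dividedPower k τ * ((K ^ᴹ k) ⊗ᵛ u) i))) ⟶ f * v i →
          (λ N → ∑ N (λ k → e k * (dividedPower k τ * ((K ^ᴹ k) ⊗ᵛ (λ j → c * u j)) i))) ⟶ f * (c * v i)
        part e i {f} s = ⟶-resp (λ N → ≈-trans (≈-sym (∑-scale N c (λ k → e k * (dividedPower k τ * ((K ^ᴹ k) ⊗ᵛ u) i))))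
            (∑-cong N (λ k → ≈-trans (rotate c (e k) (dividedPower k τ * ((K ^ᴹ k) ⊗ᵛ u) i)) (*-congˡ {e k} (≈-trans (rotate c (dividedPower k τ) (((K ^ᴹ k) ⊗ᵛ u) i))
              (*-congˡ {dividedPower k τ} (≈-trans (≈-sym (sum-scale c (λ j → (K ^ᴹ k) i j * u j))) (sum-cong {n} (λ j → rotate c ((K ^ᴹ k) i j) (u j))))))))))
          (rotate c f (v i)) (⟶-scale c s)

      evolves-cong : ∀ {u v u′ v′} → (∀ i → u i ≈ u′ i) → (∀ i → v i ≈ v′ i) → Evolves τ g h u v → Evolves τ g h u′ v′
      evolves-cong {u} {u′ = u′} u≈u′ v≈v′ E = evolves
        (λ i → ⟶-resp (series≈ reI i) (*-congˡ (v≈v′ i)) (re-part E i)) (λ i → ⟶-resp (series≈ imI i) (*-congˡ (v≈v′ i)) (im-part E i))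
        where
        series≈ : ∀ e i N → ∑ N (λ k → e k * (dividedPower k τ * ((K ^ᴹ k) ⊗ᵛ u) i)) ≈ ∑ N (λ k → e k * (dividedPower k τ * ((K ^ᴹ k) ⊗ᵛ u′) i))
        series≈ e i N = ∑-cong N (λ k → *-congˡ {e k} (*-congˡ {dividedPower k τ} (sum-cong {n} (λ j → *-congˡ {(K ^ᴹ k) i j} (u≈u′ j)))))

      evolves-basis : ∀ {a} {v} → Evolves τ g h (basis a) v → ∀ i → entrySeries reI τ i a ⟶ g * v i × entrySeries imI τ i a ⟶ h * v i
      evolves-basis {a} E i = ⟶-resp (series≈ reI) ≈-refl (re-part E i) , ⟶-resp (series≈ imI) ≈-refl (im-part E i)
        where
        series≈ : ∀ e N → ∑ N (λ k → e k * (dividedPower k τ * ((K ^ᴹ k) ⊗ᵛ basis a) i)) ≈ entrySeries e τ i a N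
        series≈ e N = ∑-cong N (λ k → *-congˡ {e k} (*-congˡ {dividedPower k τ} (sum-basis a ((K ^ᴹ k) i))))

  -- The square of the adjacency matrix of a path.

  adjacency : ∀ n → Matrix n
  adjacency n i j = if does (ℕ.∣ label i - label j ∣ ℕ.≟ 1) then fromℕ 1 else fromℕ 0

  adjacency² : ∀ n → Matrix n
  adjacency² n = adjacency n ^ᴹ 2

  adjacency-symmetric : ∀ {n} (i j : Fin n) → adjacency n i j ≈ adjacency n j i
  adjacency-symmetric i j = ≈-reflexive (≡.cong (λ d → if does (d ℕ.≟ 1) then fromℕ 1 else fromℕ 0) (ℕ.∣-∣-comm (label i) (label j)))

  adjacency-⊑ : ∀ {n} (i j : Fin n) → adjacency n i j ⊑ 1#
  adjacency-⊑ i j with does (ℕ.∣ label i - label j ∣ ℕ.≟ 1)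
  ... | true  = 0≤⇒⊑ (0≤fromℕ 1) (≈⇒≤ fromℚ-1)
  ... | false = 0≤⇒⊑ (0≤fromℕ 0) (<⇒≤ (<-respˡ (≈-sym fromℚ-0) 0<1))

  adjacency²≈ : ∀ {n} (i j : Fin n) → adjacency² n i j ≈ sum (λ k → adjacency n i k * adjacency n k j)
  adjacency²≈ {n} i j = sum-cong {n} (λ k → *-congˡ (≈-trans
    (sum-cong {n} {g = λ l → adjacency n k l * basis j l} (λ l → ≈-refl)) (sum-basis j (adjacency n k))))

  adjacency²-symmetric : ∀ {n} (i j : Fin n) → adjacency² n i j ≈ adjacency² n j i
  adjacency²-symmetric {n} i j = ≈-trans (adjacency²≈ i j) (≈-trans
    (sum-cong {n} (λ k → ≈-trans (*-comm _ _) (*-cong (adjacency-symmetric k j) (adjacency-symmetric i k))))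
    (≈-sym (adjacency²≈ j i)))

  adjacency²-⊑ : ∀ {n} (i j : Fin n) → adjacency² n i j ⊑ fromℕ n * (1# * 1#)
  adjacency²-⊑ {n} i j = ⊑-resp (≈-sym (adjacency²≈ i j)) ≈-refl
    (sum-⊑ {n} (λ k → adjacency n i k * adjacency n k j) (λ k → ⊑-* (adjacency-⊑ i k) (adjacency-⊑ k j)))

  neighbour : ℕ → ℕ → Carrier
  neighbour J I = if does (ℕ.∣ J - I ∣ ℕ.≟ 1) then fromℕ 1 else fromℕ 0

  predecessor : (ℕ → Carrier) → ℕ → Carrier
  predecessor f zero    = 0#
  predecessor f (suc J) = f J

  -- J counts from 0. The two missing neighbours at the ends are represented by zeros: the one on
  -- the left by `predecessor`, the one on the right by the hypothesis on f n.
  neighbours : ∀ n J f → J ℕ.< n → f n ≈ 0# → ∑ n (λ I → neighbour J I * f I) ≈ predecessor f J + f (suc J)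
  neighbours (suc zero) zero f _ f-end = ≈-trans (+-identityʳ _)
    (≈-trans (≈-trans (*-congʳ fromℚ-0) (zeroˡ (f 0))) (≈-trans (≈-sym f-end) (≈-sym (+-identityˡ (f 1)))))
  neighbours (suc (suc n)) zero f _ _ = ≈-trans
    (+-cong (≈-trans (*-congʳ fromℚ-0) (zeroˡ (f 0))) (≈-trans
      (+-cong (≈-trans (*-congʳ fromℚ-1) (*-identityˡ (f 1))) (≈-trans
        (∑-scale n (fromℕ 0) (λ I → f (2 ℕ.+ I))) (≈-trans (*-congʳ fromℚ-0) (zeroˡ (∑ n (λ I → f (2 ℕ.+ I)))))))
      (+-identityʳ (f 1))))
    ≈-refl
  neighbours (suc n) (suc zero) f (ℕ.s≤s J<n) f-end = +-cong (≈-trans (*-congʳ fromℚ-1) (*-identityˡ (f 0)))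
    (≈-trans (neighbours n zero (f ∘ suc) J<n f-end) (+-identityˡ (f 2)))
  neighbours (suc n) (suc (suc J)) f (ℕ.s≤s J<n) f-end = ≈-trans
    (+-cong (≈-trans (*-congʳ fromℚ-0) (zeroˡ (f 0))) (neighbours n (suc J) (f ∘ suc) J<n f-end)) (+-identityˡ _)

  path-action : ∀ {n} (u : ℕ → Carrier) → u 0 ≈ 0# → u (suc n) ≈ 0# → ∀ (j : Fin n) →
    (adjacency n ⊗ᵛ (u ∘ label)) j ≈ u (toℕ j) + u (2 ℕ.+ toℕ j)
  path-action {n} u u-start u-end j = ≈-trans (neighbours n (toℕ j) (u ∘ suc) (Fin.toℕ<n j) u-end) (+-congʳ (first (toℕ j)))
    where
    first : ∀ J → predecessor (u ∘ suc) J ≈ u J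
    first zero    = ≈-sym u-start
    first (suc J) = ≈-refl

  -- The equation A² u = θ u is split at v = A u. Thus u may fail to be an eigenvector of A, and
  -- only θ, not its square root, has to lie in the field of coefficients: for n = 5 and θ = 3 all
  -- entries are rational.
  record PathEigenvector (n : ℕ) (θ : Carrier) (u v : ℕ → Carrier) : Set where
    constructor pathEigenvector
    field
      u-start : u 0 ≈ 0#
      u-end   : u (suc n) ≈ 0#
      v-start : v 0 ≈ 0#
      v-end   : v (suc n) ≈ 0#
      u⇒v     : ∀ (j : Fin n) → u (toℕ j) + u (2 ℕ.+ toℕ j) ≈ v (label j)
      v⇒θu    : ∀ (j : Fin n) → v (toℕ j) + v (2 ℕ.+ toℕ j) ≈ θ * u (label j)

  path-eigenvector : ∀ {n θ u v} → PathEigenvector n θ u v → Eigenvector (adjacency² n) (u ∘ label) θ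
  path-eigenvector {n} {θ} {u} {v} (pathEigenvector u₀ u₁ v₀ v₁ u⇒v v⇒θu) i = ≈-trans
    (sum-cong {n} {g = λ j → sum (λ k → adjacency n i k * (adjacency n k j * u (label j)))} (λ j →
      ≈-trans (*-congʳ (adjacency²≈ i j)) (≈-trans (*-comm _ (u (label j)))
      (≈-trans (≈-sym (sum-scale (u (label j)) (λ k → adjacency n i k * adjacency n k j)))
        (sum-cong {n} (λ k → rotate (u (label j)) (adjacency n i k) (adjacency n k j)))))))
    (≈-trans (sum-swap (λ j k → adjacency n i k * (adjacency n k j * u (label j))))
    (≈-trans (sum-cong {n} {g = λ k → adjacency n i k * v (label k)} (λ k → ≈-trans
      (sum-scale (adjacency n i k) (λ j → adjacency n k j * u (label j))) (*-congˡ (≈-trans (path-action u u₀ u₁ k) (u⇒v k)))))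
    (≈-trans (path-action v v₀ v₁ i) (v⇒θu i))))
    where
    rotate : ∀ a b c → a * (b * c) ≈ b * (c * a)
    rotate = solve 3 (λ a b c → a :* (b :* c) := b :* (c :* a)) ≈-refl

  -- Perfect state transfer in real terms, and the bound on its time.

  -- The real content of PSTAt: exp (-iτK) = P - iQ and γ = g - ih.
  record TransferAt {n} (K : Matrix n) (a b : Fin n) (τ : Carrier) : Set where
    field
      positive      : 0# < τ
      P Q           : Matrix n
      P-limit       : ∀ i j → entrySeries K reI τ i j ⟶ P i j
      Q-limit       : ∀ i j → entrySeries K imI τ i j ⟶ Q i j
      g h           : Carrier
      unit          : g * g + h * h ≈ 1#
      P-column      : ∀ i → P i a ≈ g * basis b i
      Q-column      : ∀ i → Q i a ≈ h * basis b i

  module _ {n : ℕ} {K : Matrix n} (symmetric : ∀ i j → K i j ≈ K j i) {a b : Fin n} {τ : Carrier} (T : TransferAt K a b τ) where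
    open TransferAt T

    cos-equation : ∀ {w θ} → Eigenvector K w θ → cos (τ * θ) * w a ≈ g * w b
    cos-equation {θ = θ} eigen = transfer-phase K symmetric reI eigen (cos-limit (τ * θ)) (λ i → P-limit i a) P-column

    sin-equation : ∀ {w θ} → Eigenvector K w θ → sin (τ * θ) * w a ≈ h * w b
    sin-equation {θ = θ} eigen = transfer-phase K symmetric imI eigen (sin-limit (τ * θ)) (λ i → Q-limit i a) Q-column

    -- The even vector gives exp (-iτθ) = γ, the odd one exp (-iτθ′) = -γ, so sin (τd) = 0. The sine
    -- has no zero strictly between 0 and π = td, which excludes τ < t.
    transfer-time-bound : ∀ {w θ w′ θ′ d t} → Eigenvector K w θ → Eigenvector K w′ θ′ →
      w b ≈ w a → w′ b ≈ - w′ a → ¬ w a ≈ 0# → ¬ w′ a ≈ 0# → θ - θ′ ≈ d → 0# < d → t * d ≈ π → t ≤ τ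
    transfer-time-bound {w} {θ} {w′} {θ′} {d} {t} eigen eigen′ even odd w≉0 w′≉0 θ-θ′ 0<d td≈π τ<t =
      sin-nonzero (*-pos positive 0<d) (<-respʳ td≈π (<-by (*-pos (x<y⇒0<y-x τ<t) 0<d)
        (solve 3 (λ t s d → t :* d :- s :* d := (t :- s) :* d) ≈-refl t τ d))) sin≈0
      where
      cancel : ∀ {c f y z} → c * y ≈ f * z → z ≈ y → ¬ y ≈ 0# → c ≈ f
      cancel {c} {f} {y} cy≈fz z≈y y≉0 = ≈-trans (solve 2 (λ c f → c := f :+ (c :- f)) ≈-refl c f)
        (≈-trans (+-congˡ (x*y≈0⇒x≈0 {c - f} {y} (≈-trans (solve 3 (λ c f y → (c :- f) :* y := c :* y :- f :* y) ≈-refl c f y)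
          (≈-trans (+-congʳ (≈-trans cy≈fz (*-congˡ z≈y))) (-‿inverseʳ _))) y≉0)) (+-identityʳ f))
      flip : ∀ {f z y} → z ≈ - y → f * z ≈ (- f) * y
      flip {f} {z} {y} z≈-y = ≈-trans (*-congˡ z≈-y) (solve 2 (λ f y → f :* :- y := :- f :* y) ≈-refl f y)
      sin≈0 : sin (τ * d) ≈ 0#
      sin≈0 = ≈-trans (sin-cong (≈-trans (*-congˡ (≈-sym θ-θ′)) (solve 3 (λ t p q → t :* (p :- q) := t :* p :- t :* q) ≈-refl τ θ θ′)))
        (≈-trans (sin-- (τ * θ) (τ * θ′)) (≈-trans (+-cong
          (*-cong (cancel (sin-equation eigen) even w≉0) (cancel (≈-trans (cos-equation eigen′) (flip odd)) ≈-refl w′≉0))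
          (-‿cong (*-cong (cancel (cos-equation eigen) even w≉0) (cancel (≈-trans (sin-equation eigen′) (flip odd)) ≈-refl w′≉0))))
        (solve 2 (λ g h → h :* :- g :- g :* :- h := num 0) ≈-refl g h)))

  module _ (n : ℕ) where
    open Angles n
    open Classification n using (eigenvalue; sn-cong; module Transfer)

    sn-multiple : ∀ k → sn (k ℕ.* m) ≈ 0#
    sn-multiple zero    = sn-0
    sn-multiple (suc k) = ≈-trans (sn-+ m (k ℕ.* m)) (≈-trans (+-cong (*-congʳ sn-m) (*-congˡ (sn-multiple k)))
      (solve 2 (λ a b → num 0 :* a :+ b :* num 0 := num 0) ≈-refl _ _))

    sine-eigenvector : ∀ k → PathEigenvector n (eigenvalue k) (λ j → sn (k ℕ.* j)) (λ j → fromℕ 2 * cs k * sn (k ℕ.* j))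
    sine-eigenvector k = pathEigenvector u-start (sn-multiple k) (scaled u-start) (scaled (sn-multiple k)) (λ j → step (toℕ j))
        (λ j → ≈-trans (≈-sym (distribˡ _ _ _)) (≈-trans (*-congˡ (step (toℕ j))) (≈-sym (*-assoc _ _ _))))
      where
      u-start : sn (k ℕ.* 0) ≈ 0#
      u-start = ≈-trans (sn-cong (ℕ.*-zeroʳ k)) sn-0
      scaled : ∀ {z} → z ≈ 0# → fromℕ 2 * cs k * z ≈ 0#
      scaled z≈0 = ≈-trans (*-congˡ z≈0) (zeroʳ _)
      index₁ : ∀ k J → k ℕ.* suc J ≡ k ℕ.* J ℕ.+ k
      index₁ = solve-∀
      index₂ : ∀ k J → k ℕ.* (2 ℕ.+ J) ≡ k ℕ.* J ℕ.+ k ℕ.+ k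
      index₂ = solve-∀
      step : ∀ J → sn (k ℕ.* J) + sn (k ℕ.* (2 ℕ.+ J)) ≈ fromℕ 2 * cs k * sn (k ℕ.* suc J)
      step J = ≈-trans (+-comm _ _) (≈-trans (+-congʳ (sn-cong (index₂ k J))) (≈-trans (sn-three-term (k ℕ.* J) k) (*-congˡ (sn-cong (≡.sym (index₁ k J))))))

    transfer⇒exceptional : ∀ {a b : Fin n} {τ} → a ≢ b → TransferAt (adjacency² n) a b τ → ¬ ¬ Exceptional n (label a) (label b)
    transfer⇒exceptional {a} {b} {τ} a≢b T = Transfer.exceptional positive unit
        (ℕ.s≤s ℕ.z≤n) (ℕ.s≤s ℕ.z≤n) (Fin.toℕ<n a) (Fin.toℕ<n b) (λ eq → a≢b (Fin.toℕ-injective (ℕ.suc-injective eq)))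
        (λ k → cos-equation adjacency²-symmetric T (path-eigenvector (sine-eigenvector k)))
        (λ k → sin-equation adjacency²-symmetric T (path-eigenvector (sine-eigenvector k)))
      where open TransferAt T using (positive; unit)

  -- The square root of 2 and the embedding of ℚ(√2).

  abstract
    -- Obtained as 2 cos (π/4), so that its square follows from the duplication formula and cos
    -- (π/2) = 0.
    √2 : Carrier
    √2 = fromℕ 2 * cos (fromℚ ½ * halfπ)

    √2²≈2 : √2 * √2 ≈ fromℕ 2
    √2²≈2 = ≈-trans (identity (cos q) (sin q)) (≈-trans (+-cong (*-congˡ (cos²+sin²≈1 q)) (*-congˡ
        (≈-trans (≈-sym (cos-+ q q)) (≈-trans (cos-cong (solve 1 (λ p → con ½ :* p :+ con ½ :* p := p) ≈-refl halfπ)) cos-halfπ))))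
      (solve 0 (num 2 :* num 1 :+ num 2 :* num 0 := num 2) ≈-refl))
      where
      q : Carrier
      q = fromℚ ½ * halfπ
      identity : ∀ c s → (fromℕ 2 * c) * (fromℕ 2 * c) ≈ fromℕ 2 * (c * c + s * s) + fromℕ 2 * (c * c - s * s)
      identity = solve 2 (λ c s → (num 2 :* c) :* (num 2 :* c) := num 2 :* (c :* c :+ s :* s) :+ num 2 :* (c :* c :- s :* s)) ≈-refl

    -- π/4 ≤ 1, where the Taylor bound 1 - q²/2 is at least 1/2.
    0<√2 : 0# < √2
    0<√2 = *-pos (0<fromℕ 1) (<-≤-trans (<-respʳ (solve 1 (λ q → con ½ :+ con ½ :* (num 1 :- q :* q) := num 1 :- con ½ :* (q :* q)) ≈-refl q)
        (0<-+-≤ (0<-const ½) (0≤-* (0≤-const ½) (x≤y⇒0≤y-x (≤-resp ≈-refl (*-identityˡ 1#) (*-mono-≤ 0≤q 0≤q q≤1 q≤1))))))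
      (proj₁ (cos-bounds 0≤q (≤-trans q≤1 (≤-by (0≤-const 1ℚ) (≈-trans (solve 0 (num 2 :- num 1 := num 1) ≈-refl) (≈-sym fromℚ-1)))))))
      where
      q : Carrier
      q = fromℚ ½ * halfπ
      0≤q : 0# ≤ q
      0≤q = 0≤-* (0≤-const ½) (<⇒≤ (proj₁ halfπ-range))
      q≤1 : q ≤ 1#
      q≤1 = ≤-resp ≈-refl (solve 0 (con ½ :* num 2 := num 1) ≈-refl) (*-mono-≤ (0≤-const ½) (<⇒≤ (proj₁ halfπ-range)) ≤-refl (proj₂ halfπ-range))

  ⟦_⟧ : ℚ[√2] → Carrier
  ⟦ p , q ⟧ = coefficient p + coefficient q * √2

  ⟦⟧-⊞ : ∀ x y → ⟦ x ⊞ y ⟧ ≈ ⟦ x ⟧ + ⟦ y ⟧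
  ⟦⟧-⊞ (p , q) (p′ , q′) = ≈-trans (+-cong (coefficient-+ p p′) (*-congʳ (coefficient-+ q q′)))
    (solve 5 (λ p q p′ q′ r → (p :+ p′) :+ (q :+ q′) :* r := (p :+ q :* r) :+ (p′ :+ q′ :* r)) ≈-refl
      (coefficient p) (coefficient q) (coefficient p′) (coefficient q′) √2)

  ⟦⟧-⊠ : ∀ x y → ⟦ x ⊠ y ⟧ ≈ ⟦ x ⟧ * ⟦ y ⟧
  ⟦⟧-⊠ (p , q) (p′ , q′) = ≈-trans
    (+-cong (≈-trans (coefficient-+ (p ℚ.* p′) ((+ 2 / 1) ℚ.* (q ℚ.* q′))) (+-cong (coefficient-* p p′) (≈-trans (coefficient-* (+ 2 / 1) (q ℚ.* q′)) (*-cong (≈-sym √2²≈2) (coefficient-* q q′)))))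
      (*-congʳ (≈-trans (coefficient-+ (p ℚ.* q′) (q ℚ.* p′)) (+-cong (coefficient-* p q′) (coefficient-* q p′)))))
    (solve 5 (λ p q p′ q′ r → (p :* p′ :+ (r :* r) :* (q :* q′)) :+ (p :* q′ :+ q :* p′) :* r := (p :+ q :* r) :* (p′ :+ q′ :* r)) ≈-refl
      (coefficient p) (coefficient q) (coefficient p′) (coefficient q′) √2)

  ⟦⟧-neg : ∀ x → ⟦ neg x ⟧ ≈ - ⟦ x ⟧
  ⟦⟧-neg (p , q) = ≈-trans (+-cong (coefficient-neg p) (*-congʳ (coefficient-neg q)))
    (solve 3 (λ p q r → :- p :+ :- q :* r := :- (p :+ q :* r)) ≈-refl (coefficient p) (coefficient q) √2)

  ⟦⟧-cong : ∀ {x y} → x ≡ y → ⟦ x ⟧ ≈ ⟦ y ⟧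
  ⟦⟧-cong eq = ≈-reflexive (≡.cong ⟦_⟧ eq)

  ⟦𝟘⟧≈0 : ⟦ 𝟘 ⟧ ≈ 0#
  ⟦𝟘⟧≈0 = solve 1 (λ r → num 0 :+ num 0 :* r := num 0) ≈-refl √2

  ⟦basis⟧≈basis : ∀ {n} (a i : Fin n) → ⟦ basis[√2] a i ⟧ ≈ basis a i
  ⟦basis⟧≈basis a i with does (i Fin.≟ a)
  ... | true  = solve 1 (λ r → num 1 :+ num 0 :* r := num 1) ≈-refl √2
  ... | false = ⟦𝟘⟧≈0

  ⟦rational⟧≉0 : ∀ q → {True (0ℚ ℚ.<? q)} → ¬ ⟦ q , 0ℚ ⟧ ≈ 0#
  ⟦rational⟧≉0 q {t} q≈0 = <-irrefl (≈-sym (≈-trans (solve 2 (λ q r → q := q :+ num 0 :* r) ≈-refl (fromℚ q) √2)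
    (≈-trans (+-congʳ (≈-sym (coefficient≈ q))) q≈0))) (0<-const q {t})

  eigenvector : ∀ {n} θ u v → {True (isPathEigenvector? n θ u v)} → Eigenvector (adjacency² n) (⟦_⟧ ∘ entry u ∘ label) ⟦ θ ⟧
  eigenvector {n} θ u v {t} = path-eigenvector (pathEigenvector {u = ⟦_⟧ ∘ entry u} {⟦_⟧ ∘ entry v} (zero-at (proj₁ u-ends)) (zero-at (proj₂ u-ends))
      (zero-at (proj₁ v-ends)) (zero-at (proj₂ v-ends))
      (λ j → ≈-trans (≈-sym (⟦⟧-⊞ (entry u (toℕ j)) (entry u (2 ℕ.+ toℕ j)))) (⟦⟧-cong (u⇒v j)))
      (λ j → ≈-trans (≈-sym (⟦⟧-⊞ (entry v (toℕ j)) (entry v (2 ℕ.+ toℕ j)))) (≈-trans (⟦⟧-cong (v⇒θu j)) (⟦⟧-⊠ θ (entry u (label j))))))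
    where
    checked : IsPathEigenvector n θ u v
    checked = toWitness t
    u-ends = proj₁ checked
    v-ends = proj₁ (proj₂ checked)
    u⇒v = proj₁ (proj₂ (proj₂ checked))
    v⇒θu = proj₂ (proj₂ (proj₂ checked))
    zero-at : ∀ {x} → x ≡ 𝟘 → ⟦ x ⟧ ≈ 0#
    zero-at eq = ≈-trans (⟦⟧-cong eq) ⟦𝟘⟧≈0

  evolves⇒transfer : ∀ {n} {a b : Fin n} {τ g h u v} → Evolves (adjacency² n) τ g h u v →
    (∀ i → u i ≈ basis a i) → (∀ i → v i ≈ basis b i) → 0# < τ → g * g + h * h ≈ 1# → TransferAt (adjacency² n) a b τ
  evolves⇒transfer {n} {a} {b} {τ} {g} {h} E u≈ v≈ 0<τ unit = record
    { positive = 0<τ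
    ; P        = λ i j → proj₁ (P-exists i j)
    ; Q        = λ i j → proj₁ (Q-exists i j)
    ; P-limit  = λ i j → proj₂ (P-exists i j)
    ; Q-limit  = λ i j → proj₂ (Q-exists i j)
    ; g        = g
    ; h        = h
    ; unit     = unit
    ; P-column = λ i → ⟶-unique (proj₂ (P-exists i a)) (proj₁ (column i))
    ; Q-column = λ i → ⟶-unique (proj₂ (Q-exists i a)) (proj₂ (column i))
    }
    where
    K : Matrix n
    K = adjacency² n
    P-exists : ∀ i j → ∃[ l ] entrySeries K reI τ i j ⟶ l
    P-exists = entrySeries-converges K adjacency²-⊑ reI reI-⊑ τ
    Q-exists : ∀ i j → ∃[ l ] entrySeries K imI τ i j ⟶ l
    Q-exists = entrySeries-converges K adjacency²-⊑ imI imI-⊑ τ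
    column : ∀ i → entrySeries K reI τ i a ⟶ g * basis b i × entrySeries K imI τ i a ⟶ h * basis b i
    column = evolves-basis K (evolves-cong K u≈ v≈ E)

  cos-opposite : ∀ {x y} → x - y ≈ π → cos x ≈ - cos y
  cos-opposite {x} {y} x-y≈π = ≈-trans (cos-cong (≈-trans (solve 2 (λ x y → x := y :+ (x :- y)) ≈-refl x y) (+-congˡ x-y≈π)))
    (≈-trans (cos-+ y π) (≈-trans (+-cong (*-congˡ cos-π) (-‿cong (*-congˡ sin-π)))
    (solve 2 (λ c s → c :* :- num 1 :- s :* num 0 := :- c) ≈-refl (cos y) (sin y))))

  sin-opposite : ∀ {x y} → x - y ≈ π → sin x ≈ - sin y
  sin-opposite {x} {y} x-y≈π = ≈-trans (sin-cong (≈-trans (solve 2 (λ x y → x := y :+ (x :- y)) ≈-refl x y) (+-congˡ x-y≈π)))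
    (≈-trans (sin-+ y π) (≈-trans (+-cong (*-congˡ cos-π) (*-congˡ sin-π))
    (solve 2 (λ c s → s :* :- num 1 :+ c :* num 0 := :- s) ≈-refl (cos y) (sin y))))

  PathTransfer : ∀ n → Fin n → Fin n → Carrier → Set
  PathTransfer n a b τ = TransferAt (adjacency² n) a b τ

  LeastTransferTime : ∀ {n} → Fin n → Fin n → Carrier → Carrier → Set
  LeastTransferTime {n} a b p d = ∃[ τ ] (PathTransfer n a b τ × (∀ s → PathTransfer n a b s → τ ≤ s)) × τ * d ≈ p

  halfπ*2≈π : halfπ * fromℕ 2 ≈ π
  halfπ*2≈π = ≈-trans (solve 1 (λ p → p :* num 2 := p :+ p) ≈-refl halfπ) (≈-sym π≈)

  -- The three transfers and their least times.

  -- At time τ the part e of e_a = e + o acquires the opposite of the phase of o.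
  module OppositePhases {n : ℕ} (a b : Fin n) (e o : List ℚ[√2]) {τ θ′ d : Carrier} (0<τ : 0# < τ) (τd≈π : τ * d ≈ π)
    {a≡ : True (sums? n (entry e ∘ label) (entry o ∘ label) (basis[√2] a))}
    {b≡ : True (sums? n (entry e ∘ label) (neg ∘ entry o ∘ label) (basis[√2] b))}
    (o-eigen : Eigenvector (adjacency² n) (⟦_⟧ ∘ entry o ∘ label) θ′) where

    K : Matrix n
    K = adjacency² n

    phase-re phase-im : Carrier
    phase-re = - cos (τ * θ′)
    phase-im = - sin (τ * θ′)

    unit-phase : phase-re * phase-re + phase-im * phase-im ≈ 1#
    unit-phase = ≈-trans (solve 2 (λ c s → :- c :* :- c :+ :- s :* :- s := c :* c :+ s :* s) ≈-refl (cos (τ * θ′)) (sin (τ * θ′)))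
      (cos²+sin²≈1 (τ * θ′))

    -- Says exp (-iτK) u = γ u, where γ = -exp (-iτθ′) is the opposite of the phase of o.
    Fixed : List ℚ[√2] → Set
    Fixed u = Evolves K τ phase-re phase-im (⟦_⟧ ∘ entry u ∘ label) (⟦_⟧ ∘ entry u ∘ label)

    -- An angle shifted by π or by -π has the same opposite phase, so θ may lie above or below θ′;
    -- on P₇ the eigenvalues 2 ± √2 lie on both sides of 2.
    fixed : ∀ {u θ} → Eigenvector K (⟦_⟧ ∘ entry u ∘ label) θ → θ - θ′ ≈ d ⊎ θ′ - θ ≈ d → Fixed u
    fixed {u} {θ} eigen θ-θ′ = evolves-cong K (λ _ → ≈-refl) (λ i → *-identityˡ ⟦ entry u (label i) ⟧)
        (evolves-eigenvector K {ε = 1#} eigen (≈-trans (proj₁ (phases θ-θ′)) (≈-sym (*-identityʳ _))) (≈-trans (proj₂ (phases θ-θ′)) (≈-sym (*-identityʳ _))))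
      where
      difference≈π : ∀ {θ θ′} → θ - θ′ ≈ d → τ * θ - τ * θ′ ≈ π
      difference≈π {θ} {θ′} eq = ≈-trans (solve 3 (λ t θ θ′ → t :* θ :- t :* θ′ := t :* (θ :- θ′)) ≈-refl τ θ θ′) (≈-trans (*-congˡ eq) τd≈π)
      phases : θ - θ′ ≈ d ⊎ θ′ - θ ≈ d → cos (τ * θ) ≈ phase-re × sin (τ * θ) ≈ phase-im
      phases (inj₁ eq) = cos-opposite (difference≈π eq) , sin-opposite (difference≈π eq)
      phases (inj₂ eq) = ≈-trans (≈-sym (-‿involutive _)) (-‿cong (≈-sym (cos-opposite (difference≈π eq)))) ,
        ≈-trans (≈-sym (-‿involutive _)) (-‿cong (≈-sym (sin-opposite (difference≈π eq))))

    reversed : Evolves K τ phase-re phase-im (⟦_⟧ ∘ entry o ∘ label) (λ i → - 1# * ⟦ entry o (label i) ⟧)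
    reversed = evolves-eigenvector K {ε = - 1#} o-eigen (negate _) (negate _)
      where
      negate : ∀ z → z ≈ - z * - 1#
      negate = solve 1 (λ z → z := :- z :* :- num 1) ≈-refl

    e+o≈ : ∀ i → ⟦ entry e (label i) ⟧ + ⟦ entry o (label i) ⟧ ≈ basis a i
    e+o≈ i = ≈-trans (≈-sym (⟦⟧-⊞ (entry e (label i)) (entry o (label i)))) (≈-trans (⟦⟧-cong (toWitness a≡ i)) (⟦basis⟧≈basis a i))

    e-o≈ : ∀ i → ⟦ entry e (label i) ⟧ + - 1# * ⟦ entry o (label i) ⟧ ≈ basis b i
    e-o≈ i = ≈-trans (+-congˡ (≈-trans (solve 1 (λ z → :- num 1 :* z := :- z) ≈-refl _) (≈-sym (⟦⟧-neg (entry o (label i))))))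
      (≈-trans (≈-sym (⟦⟧-⊞ (entry e (label i)) (neg (entry o (label i))))) (≈-trans (⟦⟧-cong (toWitness b≡ i)) (⟦basis⟧≈basis b i)))

    forwards : Fixed e → TransferAt K a b τ
    forwards E = evolves⇒transfer (evolves-+ K E reversed) e+o≈ e-o≈ 0<τ unit-phase

    backwards : Fixed e → TransferAt K b a τ
    backwards E = evolves⇒transfer (evolves-+ K E (evolves-scale K (- 1#) reversed)) e-o≈
      (λ i → ≈-trans (+-congˡ (solve 1 (λ z → :- num 1 :* (:- num 1 :* z) := z) ≈-refl _)) (e+o≈ i)) 0<τ unit-phase

    -- The even eigenvector w is separate from e, because on P₇ the even part of eₐ is not itself an
    -- eigenvector.
    module Bound {w : List ℚ[√2]} {θ : Carrier} (w-eigen : Eigenvector K (⟦_⟧ ∘ entry w ∘ label) θ) (θ-θ′≈d : θ - θ′ ≈ d) (0<d : 0# < d)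
      (even : entry w (label b) ≡ entry w (label a)) (odd : entry o (label b) ≡ neg (entry o (label a)))
      (wₐ≉0 : ¬ ⟦ entry w (label a) ⟧ ≈ 0#) (oₐ≉0 : ¬ ⟦ entry o (label a) ⟧ ≈ 0#) (E : Fixed e) where

      w-even : ⟦ entry w (label b) ⟧ ≈ ⟦ entry w (label a) ⟧
      w-even = ⟦⟧-cong even

      o-odd : ⟦ entry o (label b) ⟧ ≈ - ⟦ entry o (label a) ⟧
      o-odd = ≈-trans (⟦⟧-cong odd) (⟦⟧-neg (entry o (label a)))

      least : LeastTransferTime a b π d
      least = τ , (forwards E , λ s T → transfer-time-bound adjacency²-symmetric T w-eigen o-eigen w-even o-odd wₐ≉0 oₐ≉0 θ-θ′≈d 0<d τd≈π) , τd≈π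

      least-reversed : LeastTransferTime b a π d
      least-reversed = τ , (backwards E , λ s T → transfer-time-bound adjacency²-symmetric T w-eigen o-eigen (≈-sym w-even)
          (≈-trans (≈-sym (-‿involutive _)) (-‿cong (≈-sym o-odd)))
          (λ w≈0 → wₐ≉0 (≈-trans (≈-sym w-even) w≈0))
          (λ o≈0 → oₐ≉0 (≈-trans (≈-sym (-‿involutive _)) (≈-trans (-‿cong (≈-trans (≈-sym o-odd) o≈0)) -0#≈0#))) θ-θ′≈d 0<d τd≈π) , τd≈π

  -- The even and odd parts ½ (eₐ ± e_b) of eₐ under the exchange of a and b. For n = 3 and n = 5
  -- both are eigenvectors of A².
  e₃ o₃ : List ℚ[√2]
  e₃ = rationals (0ℚ ∷ ½ ∷ 0ℚ ∷ ½ ∷ [])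
  o₃ = rationals (0ℚ ∷ ½ ∷ 0ℚ ∷ -½ ∷ [])

  module Path₃ = OppositePhases {3} zero (suc (suc zero)) e₃ o₃ (proj₁ halfπ-range) halfπ*2≈π (eigenvector 𝟘 o₃ [])

  e₃-eigen : Eigenvector (adjacency² 3) (⟦_⟧ ∘ entry e₃ ∘ label) ⟦ + 2 / 1 , 0ℚ ⟧
  e₃-eigen = eigenvector (+ 2 / 1 , 0ℚ) e₃ (rationals (0ℚ ∷ 0ℚ ∷ 1ℚ ∷ []))

  θ-θ′≈2₃ : ⟦ + 2 / 1 , 0ℚ ⟧ - ⟦ 𝟘 ⟧ ≈ fromℕ 2
  θ-θ′≈2₃ = solve 1 (λ r → (num 2 :+ num 0 :* r) :- (num 0 :+ num 0 :* r) := num 2) ≈-refl √2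

  module Least₃ = Path₃.Bound {e₃} e₃-eigen θ-θ′≈2₃ (0<fromℕ 1) ≡.refl ≡.refl (⟦rational⟧≉0 ½) (⟦rational⟧≉0 ½)
    (Path₃.fixed {e₃} e₃-eigen (inj₁ θ-θ′≈2₃))

  e₅ o₅ : List ℚ[√2]
  e₅ = rationals (0ℚ ∷ 0ℚ ∷ ½ ∷ 0ℚ ∷ ½ ∷ [])
  o₅ = rationals (0ℚ ∷ 0ℚ ∷ ½ ∷ 0ℚ ∷ -½ ∷ [])

  module Path₅ = OppositePhases {5} (suc zero) (suc (suc (suc zero))) e₅ o₅ (proj₁ halfπ-range) halfπ*2≈π
    (eigenvector 𝟙 o₅ (rationals (0ℚ ∷ ½ ∷ 0ℚ ∷ 0ℚ ∷ 0ℚ ∷ -½ ∷ [])))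

  e₅-eigen : Eigenvector (adjacency² 5) (⟦_⟧ ∘ entry e₅ ∘ label) ⟦ + 3 / 1 , 0ℚ ⟧
  e₅-eigen = eigenvector (+ 3 / 1 , 0ℚ) e₅ (rationals (0ℚ ∷ ½ ∷ 0ℚ ∷ 1ℚ ∷ 0ℚ ∷ ½ ∷ []))

  θ-θ′≈2₅ : ⟦ + 3 / 1 , 0ℚ ⟧ - ⟦ 𝟙 ⟧ ≈ fromℕ 2
  θ-θ′≈2₅ = solve 1 (λ r → (num 3 :+ num 0 :* r) :- (num 1 :+ num 0 :* r) := num 2) ≈-refl √2

  module Least₅ = Path₅.Bound {e₅} e₅-eigen θ-θ′≈2₅ (0<fromℕ 1) ≡.refl ≡.refl (⟦rational⟧≉0 ½) (⟦rational⟧≉0 ½)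
    (Path₅.fixed {e₅} e₅-eigen (inj₁ θ-θ′≈2₅))

  -- For n = 7 the even part is the sum of two eigenvectors, for 2 + √2 and 2 - √2, whose entries ±
  -- √2/4 at the middle vertex cancel.
  e₇ o₇ e₇⁺ e₇⁻ : List ℚ[√2]
  e₇  = rationals (0ℚ ∷ 0ℚ ∷ ½ ∷ 0ℚ ∷ 0ℚ ∷ 0ℚ ∷ ½ ∷ [])
  o₇  = rationals (0ℚ ∷ 0ℚ ∷ ½ ∷ 0ℚ ∷ 0ℚ ∷ 0ℚ ∷ -½ ∷ [])
  e₇⁺ = 𝟘 ∷ 𝟘 ∷ (¼ , 0ℚ) ∷ 𝟘 ∷ (0ℚ , ¼) ∷ 𝟘 ∷ (¼ , 0ℚ) ∷ []
  e₇⁻ = 𝟘 ∷ 𝟘 ∷ (¼ , 0ℚ) ∷ 𝟘 ∷ (0ℚ , ℚ.- ¼) ∷ 𝟘 ∷ (¼ , 0ℚ) ∷ []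

  -- The time π/√2 is written as √2 · π/2, without division.
  τ₇*√2≈π : (√2 * halfπ) * √2 ≈ π
  τ₇*√2≈π = ≈-trans (solve 2 (λ r p → (r :* p) :* r := p :* (r :* r)) ≈-refl √2 halfπ) (≈-trans (*-congˡ √2²≈2) halfπ*2≈π)

  module Path₇ = OppositePhases {7} (suc zero) (suc (suc (suc (suc (suc zero))))) e₇ o₇ (*-pos 0<√2 (proj₁ halfπ-range)) τ₇*√2≈π
    (eigenvector (+ 2 / 1 , 0ℚ) o₇ (rationals (0ℚ ∷ ½ ∷ 0ℚ ∷ ½ ∷ 0ℚ ∷ -½ ∷ 0ℚ ∷ -½ ∷ [])))

  e₇⁺-eigen : Eigenvector (adjacency² 7) (⟦_⟧ ∘ entry e₇⁺ ∘ label) ⟦ + 2 / 1 , 1ℚ ⟧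
  e₇⁺-eigen = eigenvector (+ 2 / 1 , 1ℚ) e₇⁺ (𝟘 ∷ (¼ , 0ℚ) ∷ 𝟘 ∷ (¼ , ¼) ∷ 𝟘 ∷ (¼ , ¼) ∷ 𝟘 ∷ (¼ , 0ℚ) ∷ [])

  e₇⁻-eigen : Eigenvector (adjacency² 7) (⟦_⟧ ∘ entry e₇⁻ ∘ label) ⟦ + 2 / 1 , ℚ.- 1ℚ ⟧
  e₇⁻-eigen = eigenvector (+ 2 / 1 , ℚ.- 1ℚ) e₇⁻ (𝟘 ∷ (¼ , 0ℚ) ∷ 𝟘 ∷ (¼ , ℚ.- ¼) ∷ 𝟘 ∷ (¼ , ℚ.- ¼) ∷ 𝟘 ∷ (¼ , 0ℚ) ∷ [])

  θ⁺-θ′≈√2 : ⟦ + 2 / 1 , 1ℚ ⟧ - ⟦ + 2 / 1 , 0ℚ ⟧ ≈ √2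
  θ⁺-θ′≈√2 = solve 1 (λ r → (num 2 :+ num 1 :* r) :- (num 2 :+ num 0 :* r) := r) ≈-refl √2

  θ′-θ⁻≈√2 : ⟦ + 2 / 1 , 0ℚ ⟧ - ⟦ + 2 / 1 , ℚ.- 1ℚ ⟧ ≈ √2
  θ′-θ⁻≈√2 = solve 1 (λ r → (num 2 :+ num 0 :* r) :- (num 2 :+ con (ℚ.- 1ℚ) :* r) := r) ≈-refl √2

  e₇-fixed : Path₇.Fixed e₇
  e₇-fixed = evolves-cong (adjacency² 7) sum≈ sum≈
      (evolves-+ (adjacency² 7) (Path₇.fixed {e₇⁺} e₇⁺-eigen (inj₁ θ⁺-θ′≈√2)) (Path₇.fixed {e₇⁻} e₇⁻-eigen (inj₂ θ′-θ⁻≈√2)))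
    where
    sum≈ : ∀ i → ⟦ entry e₇⁺ (label i) ⟧ + ⟦ entry e₇⁻ (label i) ⟧ ≈ ⟦ entry e₇ (label i) ⟧
    sum≈ i = ≈-trans (≈-sym (⟦⟧-⊞ (entry e₇⁺ (label i)) (entry e₇⁻ (label i))))
      (⟦⟧-cong (from-yes (sums? 7 (entry e₇⁺ ∘ label) (entry e₇⁻ ∘ label) (entry e₇ ∘ label)) i))

  module Least₇ = Path₇.Bound {e₇⁺} e₇⁺-eigen θ⁺-θ′≈√2 0<√2 ≡.refl ≡.refl (⟦rational⟧≉0 ¼) (⟦rational⟧≉0 ½) e₇-fixed

  same-label : ∀ {n} {i j : Fin n} → label i ≡ label j → i ≡ j
  same-label eq = Fin.toℕ-injective (ℕ.suc-injective eq)

  least-transfer₃ : ∀ {n} (a b : Fin n) → Triple 3 1 3 n (label a) (label b) → LeastTransferTime a b π (fromℕ 2)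
  least-transfer₃ a b (≡.refl , inj₁ (a≡ , b≡)) rewrite same-label {i = a} {zero} a≡ | same-label {i = b} {suc (suc zero)} b≡ = Least₃.least
  least-transfer₃ a b (≡.refl , inj₂ (a≡ , b≡)) rewrite same-label {i = a} {suc (suc zero)} a≡ | same-label {i = b} {zero} b≡ = Least₃.least-reversed

  least-transfer₅ : ∀ {n} (a b : Fin n) → Triple 5 2 4 n (label a) (label b) → LeastTransferTime a b π (fromℕ 2)
  least-transfer₅ a b (≡.refl , inj₁ (a≡ , b≡)) rewrite same-label {i = a} {suc zero} a≡ | same-label {i = b} {suc (suc (suc zero))} b≡ = Least₅.least
  least-transfer₅ a b (≡.refl , inj₂ (a≡ , b≡)) rewrite same-label {i = a} {suc (suc (suc zero))} a≡ | same-label {i = b} {suc zero} b≡ = Least₅.least-reversed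

  least-transfer₇ : ∀ {n} (a b : Fin n) → Triple 7 2 6 n (label a) (label b) → LeastTransferTime a b π √2
  least-transfer₇ a b (≡.refl , inj₁ (a≡ , b≡)) rewrite same-label {i = a} {suc zero} a≡ | same-label {i = b} {suc (suc (suc (suc (suc zero))))} b≡ = Least₇.least
  least-transfer₇ a b (≡.refl , inj₂ (a≡ , b≡)) rewrite same-label {i = a} {suc (suc (suc (suc (suc zero))))} a≡ | same-label {i = b} {suc zero} b≡ = Least₇.least-reversed

  -- Sine series and matrix exponential in the form of the definitions.

  -- Repeats the terms of `IsSin` literally, so that in the Cauchy reals both agree at every index
  -- of the sequences.
  sineTerm : Carrier → ℕ → Carrier
  sineTerm x k = (- 1#) ^ k * (inverseFactorial (2 ℕ.* k ℕ.+ 1) * x ^ (2 ℕ.* k ℕ.+ 1))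

  sineSum : Carrier → ℕ → Carrier
  sineSum x N = sum {N} (λ k → sineTerm x (toℕ k))

  sineSum≈sum : ∀ x N (g : Fin N → Carrier) → (∀ i → sineTerm x (toℕ i) ≈ g i) → sineSum x N ≈ sum g
  sineSum≈sum x N g term≈g = sum-cong term≈g

  sineSum-limit : ∀ {x s} → sin x ≈ s → sineSum x ⟶ s
  sineSum-limit {x} sin≈s = ⟶-resp (λ _ → ≈-refl) sin≈s (sin-alternating x)

  sineSum-unique : ∀ {x s} → sineSum x ⟶ s → sin x ≈ s
  sineSum-unique {x} = ⟶-unique (sin-alternating x)

  -- X + iY = -iτK, R k + i I k is its k-th power, and S N + i T N the N-th partial sum of its exponential series.
  module ImaginaryPowers {n : ℕ} (K : Matrix n) (τ : Carrier) (X Y : Matrix n)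
    (X≈0 : ∀ i j → X i j ≈ 0#) (Y≈-τK : ∀ i j → Y i j ≈ - (τ * K i j)) (R I : ℕ → Matrix n)
    (R-zero : ∀ i j → R 0 i j ≈ basis j i) (I-zero : ∀ i j → I 0 i j ≈ 0#)
    (R-suc : ∀ k i j → ∃[ g ] R (suc k) i j ≈ sum g × (∀ l → g l ≈ X i l * R k l j - Y i l * I k l j))
    (I-suc : ∀ k i j → ∃[ g ] I (suc k) i j ≈ sum g × (∀ l → g l ≈ X i l * I k l j + Y i l * R k l j))
    (S T : ℕ → Matrix n)
    (S≈ : ∀ N i j → Σ (Fin N → Carrier) λ g → S N i j ≈ sum g × (∀ k → g k ≈ inverseFactorial (toℕ k) * R (toℕ k) i j))
    (T≈ : ∀ N i j → Σ (Fin N → Carrier) λ g → T N i j ≈ sum g × (∀ k → g k ≈ inverseFactorial (toℕ k) * I (toℕ k) i j)) where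

    re-power : ∀ k i j → R k i j ≈ reI k * (τ ^ k * (K ^ᴹ k) i j)
    im-power : ∀ k i j → I k i j ≈ - (imI k * (τ ^ k * (K ^ᴹ k) i j))
    re-power zero i j = ≈-trans (R-zero i j) (solve 1 (λ b → b := num 1 :* (num 1 :* b)) ≈-refl (basis j i))
    re-power (suc k) i j = ≈-trans (proj₁ (proj₂ (R-suc k i j)))
      (≈-trans (sum-cong {n} {g = λ l → (- imI k * (τ * τ ^ k)) * (K i l * (K ^ᴹ k) l j)} (λ l →
        ≈-trans (proj₂ (proj₂ (R-suc k i j)) l) (≈-trans (+-cong (*-congʳ (X≈0 i l)) (-‿cong (*-cong (Y≈-τK i l) (im-power k l j))))
          (identity (R k l j) τ (K i l) (imI k) (τ ^ k) ((K ^ᴹ k) l j)))))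
      (≈-trans (sum-scale (- imI k * (τ * τ ^ k)) (λ l → K i l * (K ^ᴹ k) l j)) (*-assoc _ _ _)))
      where
      identity : ∀ r t a s p b → 0# * r - (- (t * a)) * (- (s * (p * b))) ≈ (- s * (t * p)) * (a * b)
      identity = solve 6 (λ r t a s p b → num 0 :* r :- (:- (t :* a)) :* (:- (s :* (p :* b))) := (:- s :* (t :* p)) :* (a :* b)) ≈-refl
    im-power zero i j = ≈-trans (I-zero i j) (solve 1 (λ b → num 0 := :- (num 0 :* (num 1 :* b))) ≈-refl (basis j i))
    im-power (suc k) i j = ≈-trans (proj₁ (proj₂ (I-suc k i j)))
      (≈-trans (sum-cong {n} {g = λ l → (- reI k * (τ * τ ^ k)) * (K i l * (K ^ᴹ k) l j)} (λ l →
        ≈-trans (proj₂ (proj₂ (I-suc k i j)) l) (≈-trans (+-cong (*-congʳ (X≈0 i l)) (*-cong (Y≈-τK i l) (re-power k l j)))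
          (identity (I k l j) τ (K i l) (reI k) (τ ^ k) ((K ^ᴹ k) l j)))))
      (≈-trans (sum-scale (- reI k * (τ * τ ^ k)) (λ l → K i l * (K ^ᴹ k) l j))
        (solve 3 (λ r t b → (:- r :* t) :* b := :- (r :* (t :* b))) ≈-refl (reI k) (τ * τ ^ k) ((K ^ᴹ suc k) i j))))
      where
      identity : ∀ r t a s p b → 0# * r + (- (t * a)) * (s * (p * b)) ≈ (- s * (t * p)) * (a * b)
      identity = solve 6 (λ r t a s p b → num 0 :* r :+ (:- (t :* a)) :* (s :* (p :* b)) := (:- s :* (t :* p)) :* (a :* b)) ≈-refl

    re-series : ∀ i j N → S N i j ≈ entrySeries K reI τ i j N
    re-series i j N = ≈-trans (proj₁ (proj₂ (S≈ N i j))) (≈-trans (sum-cong (proj₂ (proj₂ (S≈ N i j))))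
        (∑-cong N {λ k → inverseFactorial k * R k i j} {λ k → reI k * (dividedPower k τ * (K ^ᴹ k) i j)}
        (λ k → ≈-trans (*-congˡ (re-power k i j)) (rearrange (inverseFactorial k) (reI k) (τ ^ k) ((K ^ᴹ k) i j)))))
      where
      rearrange : ∀ f e p b → f * (e * (p * b)) ≈ e * ((f * p) * b)
      rearrange = solve 4 (λ f e p b → f :* (e :* (p :* b)) := e :* ((f :* p) :* b)) ≈-refl

    im-series : ∀ i j N → T N i j ≈ - entrySeries K imI τ i j N
    im-series i j N = ≈-trans (proj₁ (proj₂ (T≈ N i j))) (≈-trans (sum-cong (proj₂ (proj₂ (T≈ N i j))))
        (≈-trans (∑-cong N {λ k → inverseFactorial k * I k i j} {λ k → - (imI k * (dividedPower k τ * (K ^ᴹ k) i j))}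
        (λ k → ≈-trans (*-congˡ (im-power k i j)) (rearrange (inverseFactorial k) (imI k) (τ ^ k) ((K ^ᴹ k) i j))))
        (∑-neg N (λ k → imI k * (dividedPower k τ * (K ^ᴹ k) i j)))))
      where
      rearrange : ∀ f e p b → f * - (e * (p * b)) ≈ - (e * ((f * p) * b))
      rearrange = solve 4 (λ f e p b → f :* :- (e :* (p :* b)) := :- (e :* ((f :* p) :* b))) ≈-refl

    record ComplexTransfer (a b : Fin n) : Set where
      field
        positive : 0# < τ
        P Q      : Matrix n
        P-limit  : ∀ i j → HasLimit (λ N → S N i j) (P i j)
        Q-limit  : ∀ i j → HasLimit (λ N → T N i j) (Q i j)
        g h      : Carrier
        unit     : 1# * 1# ≈ g * g + h * h
        P-column : ∀ i → P i a ≈ g * basis b i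
        Q-column : ∀ i → Q i a ≈ h * basis b i

    -- Only a sign changes: the exponential is P + iQ and γ = g + ih on the complex side, P - iQ and
    -- g - ih on the real one.
    complex⇒transferAt : ∀ {a b} → ComplexTransfer a b → TransferAt K a b τ
    complex⇒transferAt {a} {b} C = record
      { positive = positive
      ; P = P
      ; Q = λ i j → - Q i j
      ; P-limit = λ i j → ⟶-resp (re-series i j) ≈-refl (HasLimit⇒⟶ (P-limit i j))
      ; Q-limit = λ i j → ⟶-resp (λ N → ≈-trans (-‿cong (im-series i j N)) (-‿involutive _)) ≈-refl (⟶-neg (HasLimit⇒⟶ (Q-limit i j)))
      ; g = g
      ; h = - h
      ; unit = ≈-trans (solve 2 (λ x y → x :* x :+ :- y :* :- y := x :* x :+ y :* y) ≈-refl g h) (≈-trans (≈-sym unit) (*-identityˡ 1#))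
      ; P-column = P-column
      ; Q-column = λ i → ≈-trans (-‿cong (Q-column i)) (-‿distribˡ-* h (basis b i))
      }
      where open ComplexTransfer C

    transferAt⇒complex : ∀ {a b} → TransferAt K a b τ → ComplexTransfer a b
    transferAt⇒complex {a} {b} T = record
      { positive = positive
      ; P = P
      ; Q = λ i j → - Q i j
      ; P-limit = λ i j → ⟶⇒HasLimit (⟶-resp (λ N → ≈-sym (re-series i j N)) ≈-refl (P-limit i j))
      ; Q-limit = λ i j → ⟶⇒HasLimit (⟶-resp (λ N → ≈-sym (im-series i j N)) ≈-refl (⟶-neg (Q-limit i j)))
      ; g = g
      ; h = - h
      ; unit = ≈-trans (*-identityˡ 1#) (≈-trans (≈-sym unit) (solve 2 (λ x y → x :* x :+ y :* y := x :* x :+ :- y :* :- y) ≈-refl g h))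
      ; P-column = P-column
      ; Q-column = λ i → ≈-trans (-‿cong (Q-column i)) (-‿distribˡ-* h (basis b i))
      }
      where open TransferAt T

  sum-pick : ∀ {n} (v : Fin n) (f g : Fin n → Carrier) → (∀ k → g k ≈ f k * basis v k) → sum g ≈ f v
  sum-pick v f g g≈ = ≈-trans (sum-cong g≈) (sum-basis v f)

  adjacency²-unfold : ∀ n i j (g : Fin n → Carrier) (h : Fin n → Fin n → Carrier) → (∀ k l → h k l ≈ adjacency n k l * basis j l) →
    (∀ k → g k ≈ adjacency n i k * sum (h k)) → sum g ≈ adjacency² n i j
  adjacency²-unfold n i j g h h≈ g≈ = sum-cong {n} (λ k → ≈-trans (g≈ k) (*-congˡ (sum-cong (h≈ k))))

  pathTransfer⇒exceptional : ∀ n a b τ → a ≢ b → PathTransfer n a b τ → Exceptional n (label a) (label b)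
  pathTransfer⇒exceptional n a b τ a≢b T = decidable-stable (exceptional? n (label a) (label b)) (transfer⇒exceptional n a≢b T)

  -- Gathers what the theorem asserts about π and √2 for arbitrary p and r, so that the passage to
  -- the Cauchy reals treats them as variables rather than by their constructions.
  record Constants (p r : Carrier) : Set where
    field
      p-positive : 0# < p
      sin-p      : sin p ≈ 0#
      p-least    : ∀ s → 0# < s → sin s ≈ 0# → p ≤ s
      r-nonneg   : 0# ≤ r
      r²≈2       : r * r ≈ fromℕ 2
      least-3    : ∀ {n} (a b : Fin n) → Triple 3 1 3 n (label a) (label b) → LeastTransferTime a b p (fromℕ 2)
      least-5    : ∀ {n} (a b : Fin n) → Triple 5 2 4 n (label a) (label b) → LeastTransferTime a b p (fromℕ 2)
      least-7    : ∀ {n} (a b : Fin n) → Triple 7 2 6 n (label a) (label b) → LeastTransferTime a b p r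

  constants : ∃[ p ] ∃[ r ] Constants p r
  constants = π , √2 , record
    { p-positive = 0<π
    ; sin-p      = sin-π
    ; p-least    = λ s 0<s sin≈0 s<π → sin-nonzero 0<s s<π sin≈0
    ; r-nonneg   = <⇒≤ 0<√2
    ; r²≈2       = √2²≈2
    ; least-3    = least-transfer₃
    ; least-5    = least-transfer₅
    ; least-7    = least-transfer₇
    }

open import Defs
open import Data.Nat using (_≤_)

-- The Cauchy reals

module CauchyReals where
  open import Data.Rational.Base using (∣_∣)
  open ℚ-Solver.+-*-Solver using (solve; _:=_; _:+_; _:*_; _:-_; :-_; con)

  infix 4 0<_
  0<_ : ℚ → Set
  0< q = 0ℚ ℚ.< q

  0<-+ : ∀ {p q} → 0< p → 0< q → 0< p ℚ.+ q
  0<-+ {p} {q} 0<p 0<q = ≡.subst (ℚ._< p ℚ.+ q) (ℚ.+-identityˡ 0ℚ) (ℚ.+-mono-< 0<p 0<q)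

  0<-+-≤ : ∀ {p q} → 0< p → 0ℚ ℚ.≤ q → 0< p ℚ.+ q
  0<-+-≤ {p} {q} 0<p 0≤q = ≡.subst (ℚ._< p ℚ.+ q) (ℚ.+-identityˡ 0ℚ) (ℚ.+-mono-<-≤ 0<p 0≤q)

  0<-* : ∀ {p q} → 0< p → 0< q → 0< p ℚ.* q
  0<-* {p} {q} 0<p 0<q = ≡.subst (ℚ._< p ℚ.* q) (ℚ.*-zeroʳ p) (ℚ.*-monoʳ-<-pos p {{ℚ.positive 0<p}} 0<q)

  ⅛ : ℚ → ℚ
  ⅛ ε = (+ 1 / 8) ℚ.* ε

  0<-⅛ : ∀ {ε} → 0< ε → 0< ⅛ ε
  0<-⅛ = 0<-* (ℚ.positive⁻¹ (+ 1 / 8))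

  <⇒0<- : ∀ {p q} → p ℚ.< q → 0< q ℚ.- p
  <⇒0<- {p} {q} p<q = ≡.subst (ℚ._< q ℚ.- p) (ℚ.+-inverseʳ p) (ℚ.+-monoˡ-< (ℚ.- p) p<q)

  <-by : ∀ {p q d} → 0< d → q ℚ.- p ≡ d → p ℚ.< q
  <-by {p} {q} 0<d ≡.refl = ≡.subst₂ ℚ._<_ (ℚ.+-identityˡ p) (solve 2 (λ p q → (q :- p) :+ p := q) ≡.refl p q) (ℚ.+-monoˡ-< p 0<d)

  p≤∣p∣ : ∀ p → p ℚ.≤ ∣ p ∣
  p≤∣p∣ p with ℚ.≤-total 0ℚ p
  ... | inj₁ 0≤p = ℚ.≤-reflexive (≡.sym (ℚ.0≤p⇒∣p∣≡p 0≤p))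
  ... | inj₂ p≤0 = ℚ.≤-trans p≤0 (ℚ.0≤∣p∣ p)

  -- With `far`, translates |a - b| < e into the positivity of two linear expressions and back;
  -- estimates then become sums of positive rationals, matched by the ring solver.
  near : ∀ a b e → ∣ a ℚ.- b ∣ ℚ.< e → 0< e ℚ.- (a ℚ.- b) × 0< e ℚ.- (b ℚ.- a)
  near a b e close = <⇒0<- (ℚ.≤-<-trans (p≤∣p∣ (a ℚ.- b)) close) ,
    <⇒0<- (ℚ.≤-<-trans (p≤∣p∣ (b ℚ.- a)) (≡.subst (ℚ._< e)
      (≡.trans (≡.sym (ℚ.∣-p∣≡∣p∣ (a ℚ.- b))) (≡.cong ∣_∣ (solve 2 (λ a b → :- (a :- b) := b :- a) ≡.refl a b))) close))

  far : ∀ a b e → 0< e ℚ.- (a ℚ.- b) → 0< e ℚ.- (b ℚ.- a) → ∣ a ℚ.- b ∣ ℚ.< e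
  far a b e p q with ℚ.∣p∣≡p∨∣p∣≡-p (a ℚ.- b)
  ... | inj₁ eq = ≡.subst (ℚ._< e) (≡.sym eq) (<-by p ≡.refl)
  ... | inj₂ eq = ≡.subst (ℚ._< e) (≡.sym eq) (<-by q (solve 3 (λ a b e → e :- :- (a :- b) := e :- (b :- a)) ≡.refl a b e))

  from-index : ∀ {P Q : ℕ → Set} → ∃[ M ] (∀ n → M ℕ.≤ n → P n) → ∃[ N ] (∀ n → N ℕ.≤ n → Q n) →
    ∃[ K ] (∀ n → K ℕ.≤ n → P n × Q n)
  from-index (M , p) (N , q) = M ℕ.⊔ N , λ n le → p n (ℕ.m⊔n≤o⇒m≤o M N le) , q n (ℕ.m⊔n≤o⇒n≤o M N le)

  map-index : ∀ {P Q : ℕ → Set} → (∀ n → P n → Q n) → ∃[ M ] (∀ n → M ℕ.≤ n → P n) → ∃[ N ] (∀ n → N ℕ.≤ n → Q n)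
  map-index f (M , p) = M , λ n le → f n (p n le)

  pointwise : ∀ x y → (∀ n → seq x n ≡ seq y n) → x ≈ᵣ y
  pointwise x y eq ε 0<ε = 0 , λ n _ → ≡.subst (ℚ._< ε) (≡.sym (≡.cong ∣_∣ (≡.trans (≡.cong (ℚ._- seq y n) (eq n)) (ℚ.+-inverseʳ (seq y n))))) 0<ε

  ≈ᵣ-sym : ∀ x y → x ≈ᵣ y → y ≈ᵣ x
  ≈ᵣ-sym x y x≈y ε 0<ε = map-index (λ n close → let p , q = near (seq x n) (seq y n) ε close in far (seq y n) (seq x n) ε q p) (x≈y ε 0<ε)

  ≈ᵣ-trans : ∀ x y z → x ≈ᵣ y → y ≈ᵣ z → x ≈ᵣ z
  ≈ᵣ-trans x y z x≈y y≈z ε 0<ε = map-index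
    (λ n (xy , yz) → let p , p′ = near (seq x n) (seq y n) (⅛ ε) xy ; q , q′ = near (seq y n) (seq z n) (⅛ ε) yz in
      far (seq x n) (seq z n) ε (≡.subst 0<_ (sum (seq x n) (seq y n) (seq z n) ε) (0<-+ (0<-+ p q) six))
          (≡.subst 0<_ (sum (seq z n) (seq y n) (seq x n) ε) (0<-+ (0<-+ q′ p′) six)))
    (from-index (x≈y (⅛ ε) (0<-⅛ 0<ε)) (y≈z (⅛ ε) (0<-⅛ 0<ε)))
    where
    six : 0< (+ 6 / 8) ℚ.* ε
    six = 0<-* (ℚ.positive⁻¹ (+ 6 / 8)) 0<ε
    sum : ∀ a b c ε → ((⅛ ε ℚ.- (a ℚ.- b)) ℚ.+ (⅛ ε ℚ.- (b ℚ.- c))) ℚ.+ (+ 6 / 8) ℚ.* ε ≡ ε ℚ.- (a ℚ.- c)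
    sum = solve 4 (λ a b c ε → ((con (+ 1 / 8) :* ε :- (a :- b)) :+ (con (+ 1 / 8) :* ε :- (b :- c))) :+ con (+ 6 / 8) :* ε := ε :- (a :- c)) ≡.refl

  +ᵣ-cong : ∀ x x′ y y′ → x ≈ᵣ x′ → y ≈ᵣ y′ → x +ᵣ y ≈ᵣ x′ +ᵣ y′
  +ᵣ-cong x x′ y y′ x≈ y≈ ε 0<ε = map-index
    (λ n (xx , yy) → let p , p′ = near (seq x n) (seq x′ n) (⅛ ε) xx ; q , q′ = near (seq y n) (seq y′ n) (⅛ ε) yy in
      far (seq x n ℚ.+ seq y n) (seq x′ n ℚ.+ seq y′ n) ε (≡.subst 0<_ (sum (seq x n) (seq x′ n) (seq y n) (seq y′ n) ε) (0<-+ (0<-+ p q) six))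
          (≡.subst 0<_ (sum (seq x′ n) (seq x n) (seq y′ n) (seq y n) ε) (0<-+ (0<-+ p′ q′) six)))
    (from-index (x≈ (⅛ ε) (0<-⅛ 0<ε)) (y≈ (⅛ ε) (0<-⅛ 0<ε)))
    where
    six : 0< (+ 6 / 8) ℚ.* ε
    six = 0<-* (ℚ.positive⁻¹ (+ 6 / 8)) 0<ε
    sum : ∀ a a′ b b′ ε → ((⅛ ε ℚ.- (a ℚ.- a′)) ℚ.+ (⅛ ε ℚ.- (b ℚ.- b′))) ℚ.+ (+ 6 / 8) ℚ.* ε ≡ ε ℚ.- ((a ℚ.+ b) ℚ.- (a′ ℚ.+ b′))
    sum = solve 5 (λ a a′ b b′ ε → ((con (+ 1 / 8) :* ε :- (a :- a′)) :+ (con (+ 1 / 8) :* ε :- (b :- b′))) :+ con (+ 6 / 8) :* ε := ε :- ((a :+ b) :- (a′ :+ b′))) ≡.refl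

  -ᵣ-cong : ∀ x y → x ≈ᵣ y → -ᵣ x ≈ᵣ -ᵣ y
  -ᵣ-cong x y x≈y ε 0<ε = map-index
    (λ n close → let p , q = near (seq x n) (seq y n) ε close in far (ℚ.- seq x n) (ℚ.- seq y n) ε (≡.subst 0<_ (flip (seq x n) (seq y n) ε) q) (≡.subst 0<_ (flip (seq y n) (seq x n) ε) p))
    (x≈y ε 0<ε)
    where
    flip : ∀ a b ε → ε ℚ.- (b ℚ.- a) ≡ ε ℚ.- ((ℚ.- a) ℚ.- (ℚ.- b))
    flip = solve 3 (λ a b ε → ε :- (b :- a) := ε :- (:- a :- :- b)) ≡.refl

  eventually-bounded : ∀ x → ∃[ B ] 0< B × ∃[ N ] (∀ n → N ℕ.≤ n → ∣ seq x n ∣ ℚ.≤ B)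
  eventually-bounded x with cauchy x 1ℚ (ℚ.positive⁻¹ 1ℚ)
  ... | N , close = 1ℚ ℚ.+ ∣ seq x N ∣ , ℚ.+-mono-<-≤ (ℚ.positive⁻¹ 1ℚ) (ℚ.0≤∣p∣ (seq x N)) , N , λ n N≤n →
    ℚ.≤-trans (ℚ.≤-reflexive (≡.cong ∣_∣ (solve 2 (λ a c → a := (a :- c) :+ c) ≡.refl (seq x n) (seq x N))))
    (ℚ.≤-trans (ℚ.∣p+q∣≤∣p∣+∣q∣ (seq x n ℚ.- seq x N) (seq x N)) (ℚ.+-monoˡ-≤ ∣ seq x N ∣ (ℚ.<⇒≤ (close n N N≤n ℕ.≤-refl))))

  *-small : ∀ B .{{_ : ℚ.Positive B}} .{{_ : ℚ.NonZero B}} u v ε → ∣ u ∣ ℚ.≤ B → ∣ v ∣ ℚ.< ℚ.1/ B ℚ.* ε → ∣ u ℚ.* v ∣ ℚ.< ε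
  *-small B u v ε ∣u∣≤B ∣v∣<ε/B = begin-strict
    ∣ u ℚ.* v ∣             ≡⟨ ℚ.∣p*q∣≡∣p∣*∣q∣ u v ⟩
    ∣ u ∣ ℚ.* ∣ v ∣         ≤⟨ ℚ.*-monoʳ-≤-nonNeg ∣ v ∣ {{ℚ.nonNegative (ℚ.0≤∣p∣ v)}} ∣u∣≤B ⟩
    B ℚ.* ∣ v ∣             <⟨ ℚ.*-monoʳ-<-pos B ∣v∣<ε/B ⟩
    B ℚ.* (ℚ.1/ B ℚ.* ε)    ≡⟨ ≡.sym (ℚ.*-assoc B (ℚ.1/ B) ε) ⟩
    (B ℚ.* ℚ.1/ B) ℚ.* ε    ≡⟨ ≡.cong (ℚ._* ε) (ℚ.*-inverseʳ B) ⟩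
    1ℚ ℚ.* ε                ≡⟨ ℚ.*-identityˡ ε ⟩
    ε                       ∎
    where open ℚ.≤-Reasoning

  *ᵣ-congˡ-bounded : ∀ x y y′ → y ≈ᵣ y′ → ∀ B .{{_ : ℚ.Positive B}} .{{_ : ℚ.NonZero B}} → 
    ∃[ N ] (∀ n → N ℕ.≤ n → ∣ seq x n ∣ ℚ.≤ B) → ∀ ε → 0< ε → 0< ℚ.1/ B ℚ.* ε →
    ∃[ N ] (∀ n → N ℕ.≤ n → ∣ seq x n ℚ.* seq y n ℚ.- seq x n ℚ.* seq y′ n ∣ ℚ.< ε)
  *ᵣ-congˡ-bounded x y y′ y≈ B (N , bound) ε 0<ε 0<ε/B = let M , close = y≈ (ℚ.1/ B ℚ.* ε) 0<ε/B in
    N ℕ.⊔ M , λ n le → ≡.subst (λ z → ∣ z ∣ ℚ.< ε) (distribute (seq x n) (seq y n) (seq y′ n))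
      (*-small B (seq x n) (seq y n ℚ.- seq y′ n) ε (bound n (ℕ.m⊔n≤o⇒m≤o N M le)) (close n (ℕ.m⊔n≤o⇒n≤o N M le)))
    where
    distribute : ∀ x a b → x ℚ.* (a ℚ.- b) ≡ x ℚ.* a ℚ.- x ℚ.* b
    distribute = solve 3 (λ x a b → x :* (a :- b) := x :* a :- x :* b) ≡.refl

  *ᵣ-congˡ : ∀ x y y′ → y ≈ᵣ y′ → x *ᵣ y ≈ᵣ x *ᵣ y′
  *ᵣ-congˡ x y y′ y≈ ε 0<ε = *ᵣ-congˡ-bounded x y y′ y≈ B (proj₂ (proj₂ (eventually-bounded x))) ε 0<ε
      (0<-* {ℚ.1/ B} {ε} (ℚ.positive⁻¹ (ℚ.1/ B) {{ℚ.1/pos⇒pos B}}) 0<ε)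
    where
    B : ℚ
    B = proj₁ (eventually-bounded x)
    instance
      B-positive : ℚ.Positive B
      B-positive = ℚ.positive (proj₁ (proj₂ (eventually-bounded x)))
      B-nonZero : ℚ.NonZero B
      B-nonZero = ℚ.pos⇒nonZero B

  *ᵣ-comm : ∀ x y → x *ᵣ y ≈ᵣ y *ᵣ x
  *ᵣ-comm x y = pointwise (x *ᵣ y) (y *ᵣ x) (λ n → ℚ.*-comm (seq x n) (seq y n))

  *ᵣ-cong : ∀ x x′ y y′ → x ≈ᵣ x′ → y ≈ᵣ y′ → x *ᵣ y ≈ᵣ x′ *ᵣ y′
  *ᵣ-cong x x′ y y′ x≈ y≈ = ≈ᵣ-trans (x *ᵣ y) (x *ᵣ y′) (x′ *ᵣ y′) (*ᵣ-congˡ x y y′ y≈)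
    (≈ᵣ-trans (x *ᵣ y′) (y′ *ᵣ x) (x′ *ᵣ y′) (*ᵣ-comm x y′)
    (≈ᵣ-trans (y′ *ᵣ x) (y′ *ᵣ x′) (x′ *ᵣ y′) (*ᵣ-congˡ y′ x x′ x≈) (*ᵣ-comm y′ x′)))

  ℝ-commutativeRing : CommutativeRing 0ℓ 0ℓ
  ℝ-commutativeRing = record
    { Carrier = ℝ
    ; _≈_ = _≈ᵣ_
    ; _+_ = _+ᵣ_
    ; _*_ = _*ᵣ_
    ; -_  = -ᵣ_
    ; 0#  = fromℕ 0
    ; 1#  = fromℕ 1
    ; isCommutativeRing = record
      { isRing = record
        { +-isAbelianGroup = record
          { isGroup = record
            { isMonoid = record
              { isSemigroup = record
                { isMagma = record
                  { isEquivalence = record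
                    { refl  = λ {x} → pointwise x x (λ _ → ≡.refl)
                    ; sym   = λ {x} {y} → ≈ᵣ-sym x y
                    ; trans = λ {x} {y} {z} → ≈ᵣ-trans x y z
                    }
                  ; ∙-cong = λ {x} {x′} {y} {y′} → +ᵣ-cong x x′ y y′
                  }
                ; assoc = λ x y z → pointwise (x +ᵣ y +ᵣ z) (x +ᵣ (y +ᵣ z)) (λ n → ℚ.+-assoc (seq x n) (seq y n) (seq z n))
                }
              ; identity = (λ x → pointwise (fromℕ 0 +ᵣ x) x (λ n → ℚ.+-identityˡ (seq x n))) , (λ x → pointwise (x +ᵣ fromℕ 0) x (λ n → ℚ.+-identityʳ (seq x n)))
              }
            ; inverse = (λ x → pointwise (-ᵣ x +ᵣ x) (fromℕ 0) (λ n → ℚ.+-inverseˡ (seq x n))) , (λ x → pointwise (x -ᵣ x) (fromℕ 0) (λ n → ℚ.+-inverseʳ (seq x n)))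
            ; ⁻¹-cong = λ {x} {y} → -ᵣ-cong x y
            }
          ; comm = λ x y → pointwise (x +ᵣ y) (y +ᵣ x) (λ n → ℚ.+-comm (seq x n) (seq y n))
          }
        ; *-cong = λ {x} {x′} {y} {y′} → *ᵣ-cong x x′ y y′
        ; *-assoc = λ x y z → pointwise (x *ᵣ y *ᵣ z) (x *ᵣ (y *ᵣ z)) (λ n → ℚ.*-assoc (seq x n) (seq y n) (seq z n))
        ; *-identity = (λ x → pointwise (fromℕ 1 *ᵣ x) x (λ n → ℚ.*-identityˡ (seq x n))) , (λ x → pointwise (x *ᵣ fromℕ 1) x (λ n → ℚ.*-identityʳ (seq x n)))
        ; distrib = (λ x y z → pointwise (x *ᵣ (y +ᵣ z)) (x *ᵣ y +ᵣ x *ᵣ z) (λ n → ℚ.*-distribˡ-+ (seq x n) (seq y n) (seq z n)))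
                  , (λ x y z → pointwise ((y +ᵣ z) *ᵣ x) (y *ᵣ x +ᵣ z *ᵣ x) (λ n → ℚ.*-distribʳ-+ (seq x n) (seq y n) (seq z n)))
        }
      ; *-comm = *ᵣ-comm
      }
    }

  <ᵣ-irrefl : ∀ x y → x ≈ᵣ y → ¬ x <ᵣ y
  <ᵣ-irrefl x y x≈y (δ , 0<δ , M , gap) = let N , close = x≈y δ 0<δ ; n = M ℕ.⊔ N in
    ℚ.<-irrefl ≡.refl (≡.subst 0<_ (cancel (seq x n) (seq y n) δ)
      (0<-+ (<⇒0<- (gap n (ℕ.m≤m⊔n M N))) (proj₂ (near (seq x n) (seq y n) δ (close n (ℕ.m≤n⊔m M N))))))
    where
    cancel : ∀ a b δ → (b ℚ.- (a ℚ.+ δ)) ℚ.+ (δ ℚ.- (b ℚ.- a)) ≡ 0ℚ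
    cancel = solve 3 (λ a b δ → (b :- (a :+ δ)) :+ (δ :- (b :- a)) := con 0ℚ) ≡.refl

  <ᵣ-asym : ∀ x y → x <ᵣ y → ¬ y <ᵣ x
  <ᵣ-asym x y (δ , 0<δ , M , gap) (δ′ , 0<δ′ , N , gap′) = let n = M ℕ.⊔ N in
    ℚ.<-irrefl ≡.refl (≡.subst 0<_ (cancel (seq x n) (seq y n) δ δ′)
      (0<-+ (0<-+ (<⇒0<- (gap n (ℕ.m≤m⊔n M N))) (<⇒0<- (gap′ n (ℕ.m≤n⊔m M N)))) (0<-+ 0<δ 0<δ′)))
    where
    cancel : ∀ a b δ δ′ → ((b ℚ.- (a ℚ.+ δ)) ℚ.+ (a ℚ.- (b ℚ.+ δ′))) ℚ.+ (δ ℚ.+ δ′) ≡ 0ℚ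
    cancel = solve 4 (λ a b δ δ′ → ((b :- (a :+ δ)) :+ (a :- (b :+ δ′))) :+ (δ :+ δ′) := con 0ℚ) ≡.refl

  -- The rational samples of z and of x + δ/2 at K can be compared. Beyond K the samples of x and z
  -- drift by less than δ/8, so the outcome persists with a gap of δ/8.
  <ᵣ-cotrans : ∀ x y → x <ᵣ y → ∀ z → x <ᵣ z ⊎ z <ᵣ y
  <ᵣ-cotrans x y (δ , 0<δ , M , gap) z = decide (ℚ.≤-total (seq z K) (seq x K ℚ.+ ½ ℚ.* δ))
    where
    Nx Nz K : ℕ
    Nx = proj₁ (cauchy x (⅛ δ) (0<-⅛ 0<δ))
    Nz = proj₁ (cauchy z (⅛ δ) (0<-⅛ 0<δ))
    K = Nx ℕ.⊔ Nz
    x-near : ∀ n → K ℕ.≤ n → 0< ⅛ δ ℚ.- (seq x K ℚ.- seq x n) × 0< ⅛ δ ℚ.- (seq x n ℚ.- seq x K)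
    x-near n K≤n = near (seq x K) (seq x n) (⅛ δ) (proj₂ (cauchy x (⅛ δ) (0<-⅛ 0<δ)) K n (ℕ.m≤m⊔n Nx Nz) (ℕ.m⊔n≤o⇒m≤o Nx Nz K≤n))
    z-near : ∀ n → K ℕ.≤ n → 0< ⅛ δ ℚ.- (seq z K ℚ.- seq z n) × 0< ⅛ δ ℚ.- (seq z n ℚ.- seq z K)
    z-near n K≤n = near (seq z K) (seq z n) (⅛ δ) (proj₂ (cauchy z (⅛ δ) (0<-⅛ 0<δ)) K n (ℕ.m≤n⊔m Nx Nz) (ℕ.m⊔n≤o⇒n≤o Nx Nz K≤n))
    nonneg : ∀ {p q} → p ℚ.≤ q → 0ℚ ℚ.≤ q ℚ.- p
    nonneg {p} {q} p≤q = ≡.subst (ℚ._≤ q ℚ.- p) (ℚ.+-inverseʳ p) (ℚ.+-monoˡ-≤ (ℚ.- p) p≤q)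
    above : ∀ xK xn zK zn δ → ((⅛ δ ℚ.- (xn ℚ.- xK)) ℚ.+ (⅛ δ ℚ.- (zK ℚ.- zn)) ℚ.+ ⅛ δ) ℚ.+ (zK ℚ.- (xK ℚ.+ ½ ℚ.* δ)) ≡ zn ℚ.- (xn ℚ.+ ⅛ δ)
    above = solve 5 (λ xK xn zK zn δ → ((con (+ 1 / 8) :* δ :- (xn :- xK)) :+ (con (+ 1 / 8) :* δ :- (zK :- zn)) :+ con (+ 1 / 8) :* δ) :+ (zK :- (xK :+ con ½ :* δ))
      := zn :- (xn :+ con (+ 1 / 8) :* δ)) ≡.refl
    below : ∀ xK xn zK zn yn δ → ((⅛ δ ℚ.- (xK ℚ.- xn)) ℚ.+ (⅛ δ ℚ.- (zn ℚ.- zK)) ℚ.+ ⅛ δ ℚ.+ (yn ℚ.- (xn ℚ.+ δ))) ℚ.+ ((xK ℚ.+ ½ ℚ.* δ) ℚ.- zK) ≡ yn ℚ.- (zn ℚ.+ ⅛ δ)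
    below = solve 6 (λ xK xn zK zn yn δ → ((con (+ 1 / 8) :* δ :- (xK :- xn)) :+ (con (+ 1 / 8) :* δ :- (zn :- zK)) :+ con (+ 1 / 8) :* δ :+ (yn :- (xn :+ δ))) :+ ((xK :+ con ½ :* δ) :- zK)
      := yn :- (zn :+ con (+ 1 / 8) :* δ)) ≡.refl
    decide : seq z K ℚ.≤ seq x K ℚ.+ ½ ℚ.* δ ⊎ seq x K ℚ.+ ½ ℚ.* δ ℚ.≤ seq z K → x <ᵣ z ⊎ z <ᵣ y
    decide (inj₂ far-z) = inj₁ (⅛ δ , 0<-⅛ 0<δ , K , λ n K≤n → <-by
      (0<-+-≤ (0<-+ (0<-+ (proj₂ (x-near n K≤n)) (proj₁ (z-near n K≤n))) (0<-⅛ 0<δ)) (nonneg far-z))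
      (≡.sym (above (seq x K) (seq x n) (seq z K) (seq z n) δ)))
    decide (inj₁ near-z) = inj₂ (⅛ δ , 0<-⅛ 0<δ , K ℕ.⊔ M , λ n le → let K≤n = ℕ.m⊔n≤o⇒m≤o K M le in <-by
      (0<-+-≤ (0<-+ (0<-+ (0<-+ (proj₁ (x-near n K≤n)) (proj₂ (z-near n K≤n))) (0<-⅛ 0<δ)) (<⇒0<- (gap n (ℕ.m⊔n≤o⇒n≤o K M le)))) (nonneg near-z))
      (≡.sym (below (seq x K) (seq x n) (seq z K) (seq z n) (seq y n) δ)))

  -- Samples at K that were ε/2 or more apart would stay apart despite drifts below ε/8 and yield a
  -- strict inequality. Hence they are within ε/2, and all later ones within ε/2 + ε/8 + ε/8.
  <ᵣ-tight : ∀ x y → ¬ x <ᵣ y → ¬ y <ᵣ x → x ≈ᵣ y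
  <ᵣ-tight x y x≮y y≮x ε 0<ε = K , λ n K≤n → let x₁ , x₂ = x-near n K≤n ; y₁ , y₂ = y-near n K≤n in
      far (seq x n) (seq y n) ε
        (≡.subst 0<_ (combine (seq x K) (seq x n) (seq y K) (seq y n) ε) (0<-+ (0<-+ x₂ y₁) y-close))
        (≡.subst 0<_ (combine (seq y K) (seq y n) (seq x K) (seq x n) ε) (0<-+ (0<-+ y₂ x₁) x-close))
    where
    Nx Ny K : ℕ
    Nx = proj₁ (cauchy x (⅛ ε) (0<-⅛ 0<ε))
    Ny = proj₁ (cauchy y (⅛ ε) (0<-⅛ 0<ε))
    K = Nx ℕ.⊔ Ny
    x-near : ∀ n → K ℕ.≤ n → 0< ⅛ ε ℚ.- (seq x K ℚ.- seq x n) × 0< ⅛ ε ℚ.- (seq x n ℚ.- seq x K)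
    x-near n K≤n = near (seq x K) (seq x n) (⅛ ε) (proj₂ (cauchy x (⅛ ε) (0<-⅛ 0<ε)) K n (ℕ.m≤m⊔n Nx Ny) (ℕ.m⊔n≤o⇒m≤o Nx Ny K≤n))
    y-near : ∀ n → K ℕ.≤ n → 0< ⅛ ε ℚ.- (seq y K ℚ.- seq y n) × 0< ⅛ ε ℚ.- (seq y n ℚ.- seq y K)
    y-near n K≤n = near (seq y K) (seq y n) (⅛ ε) (proj₂ (cauchy y (⅛ ε) (0<-⅛ 0<ε)) K n (ℕ.m≤n⊔m Nx Ny) (ℕ.m⊔n≤o⇒n≤o Nx Ny K≤n))
    combine : ∀ xK xn yK yn ε → ((⅛ ε ℚ.- (xn ℚ.- xK)) ℚ.+ (⅛ ε ℚ.- (yK ℚ.- yn))) ℚ.+ (½ ℚ.* ε ℚ.- (xK ℚ.- yK) ℚ.+ ⅛ ε ℚ.+ ⅛ ε) ≡ ε ℚ.- (xn ℚ.- yn)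
    combine = solve 5 (λ xK xn yK yn ε → ((con (+ 1 / 8) :* ε :- (xn :- xK)) :+ (con (+ 1 / 8) :* ε :- (yK :- yn))) :+ (con ½ :* ε :- (xK :- yK) :+ con (+ 1 / 8) :* ε :+ con (+ 1 / 8) :* ε)
      := ε :- (xn :- yn)) ≡.refl
    separated : ∀ u v → (∀ n → K ℕ.≤ n → 0< ⅛ ε ℚ.- (seq u n ℚ.- seq u K)) → (∀ n → K ℕ.≤ n → 0< ⅛ ε ℚ.- (seq v K ℚ.- seq v n)) →
      ¬ u <ᵣ v → 0< ½ ℚ.* ε ℚ.- (seq v K ℚ.- seq u K)
    separated u v u-near v-near u≮v = ℚ.≰⇒> λ T≤0 → u≮v (⅛ ε , 0<-⅛ 0<ε , K , λ n K≤n → <-by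
      (0<-+-≤ (0<-+ (0<-+ (u-near n K≤n) (v-near n K≤n)) (0<-⅛ 0<ε)) (ℚ.neg-antimono-≤ T≤0))
      (≡.sym (identity (seq u K) (seq u n) (seq v K) (seq v n) ε)))
      where
      identity : ∀ uK un vK vn ε → ((⅛ ε ℚ.- (un ℚ.- uK)) ℚ.+ (⅛ ε ℚ.- (vK ℚ.- vn)) ℚ.+ ⅛ ε) ℚ.+ (ℚ.- (½ ℚ.* ε ℚ.- (vK ℚ.- uK))) ≡ vn ℚ.- (un ℚ.+ ⅛ ε)
      identity = solve 5 (λ uK un vK vn ε → ((con (+ 1 / 8) :* ε :- (un :- uK)) :+ (con (+ 1 / 8) :* ε :- (vK :- vn)) :+ con (+ 1 / 8) :* ε) :+ (:- (con ½ :* ε :- (vK :- uK)))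
        := vn :- (un :+ con (+ 1 / 8) :* ε)) ≡.refl
    y-close : 0< ½ ℚ.* ε ℚ.- (seq x K ℚ.- seq y K) ℚ.+ ⅛ ε ℚ.+ ⅛ ε
    y-close = 0<-+ (0<-+ (separated y x (λ n le → proj₂ (y-near n le)) (λ n le → proj₁ (x-near n le)) y≮x) (0<-⅛ 0<ε)) (0<-⅛ 0<ε)
    x-close : 0< ½ ℚ.* ε ℚ.- (seq y K ℚ.- seq x K) ℚ.+ ⅛ ε ℚ.+ ⅛ ε
    x-close = 0<-+ (0<-+ (separated x y (λ n le → proj₂ (x-near n le)) (λ n le → proj₁ (y-near n le)) x≮y) (0<-⅛ 0<ε)) (0<-⅛ 0<ε)

  +ᵣ-monoˡ-<ᵣ : ∀ z x y → x <ᵣ y → x +ᵣ z <ᵣ y +ᵣ z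
  +ᵣ-monoˡ-<ᵣ z x y (δ , 0<δ , M , gap) = δ , 0<δ , M , λ n M≤n → <-by (<⇒0<- (gap n M≤n))
    (identity (seq x n) (seq y n) (seq z n) δ)
    where
    identity : ∀ a b c δ → (b ℚ.+ c) ℚ.- ((a ℚ.+ c) ℚ.+ δ) ≡ b ℚ.- (a ℚ.+ δ)
    identity = solve 4 (λ a b c δ → (b :+ c) :- ((a :+ c) :+ δ) := b :- (a :+ δ)) ≡.refl

  *ᵣ-pos : ∀ x y → fromℕ 0 <ᵣ x → fromℕ 0 <ᵣ y → fromℕ 0 <ᵣ x *ᵣ y
  *ᵣ-pos x y (δ , 0<δ , M , gap) (δ′ , 0<δ′ , N , gap′) = δ ℚ.* δ′ , 0<-* 0<δ 0<δ′ , M ℕ.⊔ N , λ n le →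
    let p = <⇒0<- (gap n (ℕ.m⊔n≤o⇒m≤o M N le)) ; q = <⇒0<- (gap′ n (ℕ.m⊔n≤o⇒n≤o M N le)) in
    <-by (0<-+ (0<-+ (0<-* p q) (0<-* 0<δ q)) (0<-* p 0<δ′)) (identity (seq x n) (seq y n) δ δ′)
    where
    identity : ∀ a b δ δ′ → a ℚ.* b ℚ.- (0ℚ ℚ.+ δ ℚ.* δ′) ≡
      ((a ℚ.- (0ℚ ℚ.+ δ)) ℚ.* (b ℚ.- (0ℚ ℚ.+ δ′)) ℚ.+ δ ℚ.* (b ℚ.- (0ℚ ℚ.+ δ′))) ℚ.+ (a ℚ.- (0ℚ ℚ.+ δ)) ℚ.* δ′
    identity = solve 4 (λ a b δ δ′ → a :* b :- (con 0ℚ :+ δ :* δ′) :=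
      ((a :- (con 0ℚ :+ δ)) :* (b :- (con 0ℚ :+ δ′)) :+ δ :* (b :- (con 0ℚ :+ δ′))) :+ (a :- (con 0ℚ :+ δ)) :* δ′) ≡.refl

  fromℚ-mono : ∀ p q → p ℚ.< q → fromℚ p <ᵣ fromℚ q
  fromℚ-mono p q p<q = ½ ℚ.* (q ℚ.- p) , 0<-* (ℚ.positive⁻¹ ½) (<⇒0<- p<q) , 0 , λ _ _ →
    <-by (0<-* (ℚ.positive⁻¹ ½) (<⇒0<- p<q)) (solve 2 (λ p q → q :- (p :+ con ½ :* (q :- p)) := con ½ :* (q :- p)) ≡.refl p q)

  <ᵣ-gap : ∀ x y → x <ᵣ y → ∃[ δ ] 0ℚ ℚ.< δ × x +ᵣ fromℚ δ <ᵣ y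
  <ᵣ-gap x y (δ , 0<δ , M , gap) = ½ ℚ.* δ , 0<-* (ℚ.positive⁻¹ ½) 0<δ , ½ ℚ.* δ , 0<-* (ℚ.positive⁻¹ ½) 0<δ , M , λ n M≤n →
    ≡.subst (ℚ._< seq y n) (solve 2 (λ a δ → a :+ δ := (a :+ con ½ :* δ) :+ con ½ :* δ) ≡.refl (seq x n) δ) (gap n M≤n)

  ℚ-archimedean : ∀ q → q ℚ.< + suc ℤ.∣ ℚ.↥ q ∣ / 1
  ℚ-archimedean q@(mkℚ p d _) = ≡.subst (q ℚ.<_) (≡.sym (/1≡mkℚ (+ suc ℤ.∣ p ∣))) (ℚ.*<* (ℤ.≤-<-trans
    (ℤ.≤-trans (ℤ.≤-reflexive (ℤ.*-identityʳ p)) (p≤∣p∣ℤ p))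
    (ℤ.+<+ (ℕ.<-≤-trans (ℕ.n<1+n ℤ.∣ p ∣) (ℕ.m≤m*n (suc ℤ.∣ p ∣) (suc d))))))
    where
    p≤∣p∣ℤ : ∀ p → p ℤ.≤ + ℤ.∣ p ∣
    p≤∣p∣ℤ (+ n)    = ℤ.≤-refl
    p≤∣p∣ℤ -[1+ n ] = ℤ.-≤+

  ᵣ-archimedean : ∀ x → ∃[ n ] x <ᵣ fromℚ (+ n / 1)
  ᵣ-archimedean x = suc ℤ.∣ ℚ.↥ (seq x N ℚ.+ 1ℚ ℚ.+ 1ℚ) ∣ , 1ℚ , ℚ.positive⁻¹ 1ℚ , N , λ n N≤n → ℚ.<-trans
      (<-by (proj₁ (near (seq x n) (seq x N) 1ℚ (proj₂ (cauchy x 1ℚ (ℚ.positive⁻¹ 1ℚ)) n N N≤n ℕ.≤-refl))) (identity (seq x N) (seq x n)))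
      (ℚ-archimedean (seq x N ℚ.+ 1ℚ ℚ.+ 1ℚ))
    where
    N : ℕ
    N = proj₁ (cauchy x 1ℚ (ℚ.positive⁻¹ 1ℚ))
    identity : ∀ a b → (a ℚ.+ 1ℚ ℚ.+ 1ℚ) ℚ.- (b ℚ.+ 1ℚ) ≡ 1ℚ ℚ.- (b ℚ.- a)
    identity = solve 2 (λ a b → (a :+ con 1ℚ :+ con 1ℚ) :- (b :+ con 1ℚ) := con 1ℚ :- (b :- a)) ≡.refl

  unitFraction : ℕ → ℚ
  unitFraction k = + 1 / suc k

  0<-unitFraction : ∀ k → 0< unitFraction k
  0<-unitFraction k = ℚ.positive⁻¹ (unitFraction k) {{ℚ.normalize-pos 1 (suc k)}}

  unitFraction-small : ∀ ε → 0< ε → ∃[ K ] (∀ k → K ℕ.≤ k → unitFraction k ℚ.< ε)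
  unitFraction-small ε 0<ε = M , λ k M≤k → ℚ.*-cancelʳ-<-nonNeg (+ suc k / 1) {{ℚ.pos⇒nonNeg (+ suc k / 1) {{ℚ.normalize-pos (suc k) 1}}}}
      (≡.subst₂ ℚ._<_ (≡.sym (≡.trans (ℚ.*-comm (unitFraction k) (+ suc k / 1)) (reciprocal (suc k)))) (ℚ.*-comm (+ suc k / 1) ε)
        (≡.subst (ℚ._< (+ suc k / 1) ℚ.* ε) (ℚ.*-inverseˡ ε)
          (ℚ.*-monoˡ-<-pos ε (ℚ.<-≤-trans (ℚ-archimedean (ℚ.1/ ε)) (/1-mono-≤ (ℤ.+≤+ (ℕ.≤-trans M≤k (ℕ.n≤1+n k))))))))
    where
    instance
      ε-positive : ℚ.Positive ε
      ε-positive = ℚ.positive 0<ε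
      ε-nonZero : ℚ.NonZero ε
      ε-nonZero = ℚ.pos⇒nonZero ε
    M : ℕ
    M = suc ℤ.∣ ℚ.↥ (ℚ.1/ ε) ∣

  module Completeness (s : ℕ → ℝ)
    (s-cauchy : ∀ ε → 0ℚ ℚ.< ε → ∃[ N ] (∀ m n → N ℕ.≤ m → N ℕ.≤ n → s m -ᵣ s n <ᵣ fromℚ ε)) where

    modulus : ℕ → ℕ
    modulus k = proj₁ (cauchy (s k) (unitFraction k) (0<-unitFraction k))

    -- The k-th term is a sample of s k lying within 1/(k + 1) of all later samples of s k.
    diagonal : ℕ → ℚ
    diagonal k = seq (s k) (modulus k)

    diagonal-near : ∀ k n → modulus k ℕ.≤ n → ∣ diagonal k ℚ.- seq (s k) n ∣ ℚ.< unitFraction k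
    diagonal-near k n le = proj₂ (cauchy (s k) (unitFraction k) (0<-unitFraction k)) (modulus k) n ℕ.≤-refl le

    module _ (ε : ℚ) (0<ε : 0< ε) where
      threshold : ℕ
      threshold = proj₁ (s-cauchy (⅛ ε) (0<-⅛ 0<ε)) ℕ.⊔ proj₁ (unitFraction-small (⅛ ε) (0<-⅛ 0<ε))

      fine : ∀ k → threshold ℕ.≤ k → unitFraction k ℚ.< ⅛ ε
      fine k le = proj₂ (unitFraction-small (⅛ ε) (0<-⅛ 0<ε)) k (ℕ.m⊔n≤o⇒n≤o (proj₁ (s-cauchy (⅛ ε) (0<-⅛ 0<ε))) _ le)

      close : ∀ m n → threshold ℕ.≤ m → threshold ℕ.≤ n → s m -ᵣ s n <ᵣ fromℚ (⅛ ε)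
      close m n tm tn = proj₂ (s-cauchy (⅛ ε) (0<-⅛ 0<ε)) m n
        (ℕ.m⊔n≤o⇒m≤o (proj₁ (s-cauchy (⅛ ε) (0<-⅛ 0<ε))) _ tm) (ℕ.m⊔n≤o⇒m≤o (proj₁ (s-cauchy (⅛ ε) (0<-⅛ 0<ε))) _ tn)

      diagonal-within : ∀ k n → threshold ℕ.≤ k → modulus k ℕ.≤ n → 0< ⅛ ε ℚ.- (diagonal k ℚ.- seq (s k) n) × 0< ⅛ ε ℚ.- (seq (s k) n ℚ.- diagonal k)
      diagonal-within k n tk le = near (diagonal k) (seq (s k) n) (⅛ ε) (ℚ.<-trans (diagonal-near k n le) (fine k tk))

      diagonal-difference : ∀ m n → threshold ℕ.≤ m → threshold ℕ.≤ n → 0< ½ ℚ.* ε ℚ.- (diagonal m ℚ.- diagonal n)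
      diagonal-difference m n tm tn = ≡.subst 0<_
          (identity (diagonal m) (diagonal n) (seq (s m) p) (seq (s n) p) δ ε)
          (0<-+ (0<-+ (0<-+ (proj₁ (diagonal-within m p tm (ℕ.≤-trans (ℕ.m≤m⊔n (modulus m) (modulus n)) (ℕ.m≤m⊔n _ P))))
            (proj₂ (diagonal-within n p tn (ℕ.≤-trans (ℕ.m≤n⊔m (modulus m) (modulus n)) (ℕ.m≤m⊔n _ P)))))
            (<⇒0<- (proj₂ (proj₂ (proj₂ (close m n tm tn))) p (ℕ.m≤n⊔m (modulus m ℕ.⊔ modulus n) P))))
            (0<-+ (proj₁ (proj₂ (close m n tm tn))) (0<-⅛ 0<ε)))
        where
        δ : ℚ
        δ = proj₁ (close m n tm tn)
        P p : ℕ
        P = proj₁ (proj₂ (proj₂ (close m n tm tn)))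
        -- A common position past both moduli and past the point P from which the samples witness s
        -- m - s n < ε/8; there the two diagonal terms can be compared.
        p = (modulus m ℕ.⊔ modulus n) ℕ.⊔ P
        identity : ∀ dm dn a b δ ε → (((⅛ ε ℚ.- (dm ℚ.- a)) ℚ.+ (⅛ ε ℚ.- (b ℚ.- dn))) ℚ.+ (⅛ ε ℚ.- ((a ℚ.- b) ℚ.+ δ))) ℚ.+ (δ ℚ.+ ⅛ ε)
          ≡ ½ ℚ.* ε ℚ.- (dm ℚ.- dn)
        identity = solve 6 (λ dm dn a b δ ε → (((con (+ 1 / 8) :* ε :- (dm :- a)) :+ (con (+ 1 / 8) :* ε :- (b :- dn))) :+ (con (+ 1 / 8) :* ε :- ((a :- b) :+ δ))) :+ (δ :+ con (+ 1 / 8) :* ε)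
          := con ½ :* ε :- (dm :- dn)) ≡.refl

    0<-½ : ∀ {ε} → 0< ε → 0< ½ ℚ.* ε
    0<-½ = 0<-* (ℚ.positive⁻¹ ½)

    halve : ∀ ε z → (½ ℚ.* ε ℚ.- z) ℚ.+ ½ ℚ.* ε ≡ ε ℚ.- z
    halve = solve 2 (λ ε z → (con ½ :* ε :- z) :+ con ½ :* ε := ε :- z) ≡.refl

    limit : ℝ
    limit = mkℝ diagonal λ ε 0<ε → threshold ε 0<ε , λ m n tm tn → far (diagonal m) (diagonal n) ε
      (≡.subst 0<_ (halve ε (diagonal m ℚ.- diagonal n)) (0<-+ (diagonal-difference ε 0<ε m n tm tn) (0<-½ 0<ε)))
      (≡.subst 0<_ (halve ε (diagonal n ℚ.- diagonal m)) (0<-+ (diagonal-difference ε 0<ε n m tn tm) (0<-½ 0<ε)))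

    limit-correct : s HasLimit limit
    limit-correct ε 0<ε = threshold ε 0<ε , λ n tn →
      (⅛ ε , 0<-⅛ 0<ε , modulus n ℕ.⊔ threshold ε 0<ε , λ p le → let tp = ℕ.m⊔n≤o⇒n≤o (modulus n) (threshold ε 0<ε) le in
        <-by (0<-+ (0<-+ (proj₂ (diagonal-within ε 0<ε n p tn (ℕ.m⊔n≤o⇒m≤o (modulus n) _ le))) (diagonal-difference ε 0<ε n p tn tp)) (0<-+ (0<-⅛ 0<ε) (0<-⅛ 0<ε)))
          (below (seq (s n) p) (diagonal n) (diagonal p) ε)) ,
      (⅛ ε , 0<-⅛ 0<ε , modulus n ℕ.⊔ threshold ε 0<ε , λ p le → let tp = ℕ.m⊔n≤o⇒n≤o (modulus n) (threshold ε 0<ε) le in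
        <-by (0<-+ (0<-+ (proj₁ (diagonal-within ε 0<ε n p tn (ℕ.m⊔n≤o⇒m≤o (modulus n) _ le))) (diagonal-difference ε 0<ε p n tp tn)) (0<-+ (0<-⅛ 0<ε) (0<-⅛ 0<ε)))
          (above (seq (s n) p) (diagonal n) (diagonal p) ε))
      where
      below : ∀ a dn dp ε → ε ℚ.- ((a ℚ.+ ℚ.- dp) ℚ.+ ⅛ ε) ≡ ((⅛ ε ℚ.- (a ℚ.- dn)) ℚ.+ (½ ℚ.* ε ℚ.- (dn ℚ.- dp))) ℚ.+ (⅛ ε ℚ.+ ⅛ ε)
      below = solve 4 (λ a dn dp ε → ε :- ((a :+ :- dp) :+ con (+ 1 / 8) :* ε) := ((con (+ 1 / 8) :* ε :- (a :- dn)) :+ (con ½ :* ε :- (dn :- dp))) :+ (con (+ 1 / 8) :* ε :+ con (+ 1 / 8) :* ε)) ≡.refl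
      above : ∀ a dn dp ε → ε ℚ.- ((dp ℚ.+ ℚ.- a) ℚ.+ ⅛ ε) ≡ ((⅛ ε ℚ.- (dn ℚ.- a)) ℚ.+ (½ ℚ.* ε ℚ.- (dp ℚ.- dn))) ℚ.+ (⅛ ε ℚ.+ ⅛ ε)
      above = solve 4 (λ a dn dp ε → ε :- ((dp :+ :- a) :+ con (+ 1 / 8) :* ε) := ((con (+ 1 / 8) :* ε :- (dn :- a)) :+ (con ½ :* ε :- (dp :- dn))) :+ (con (+ 1 / 8) :* ε :+ con (+ 1 / 8) :* ε)) ≡.refl

  ℝ-line : RealLine
  ℝ-line = record
    { commutativeRing = ℝ-commutativeRing
    ; _<_          = _<ᵣ_
    ; fromℚ        = fromℚ
    ; <-irrefl     = λ {x} {y} → <ᵣ-irrefl x y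
    ; <-asym       = λ {x} {y} → <ᵣ-asym x y
    ; <-cotrans    = λ {x} {y} → <ᵣ-cotrans x y
    ; <-tight      = λ {x} {y} → <ᵣ-tight x y
    ; +-monoˡ-<    = λ z {x} {y} → +ᵣ-monoˡ-<ᵣ z x y
    ; *-pos        = λ {x} {y} → *ᵣ-pos x y
    ; fromℚ-+      = λ p q → pointwise (fromℚ (p ℚ.+ q)) (fromℚ p +ᵣ fromℚ q) (λ _ → ≡.refl)
    ; fromℚ-*      = λ p q → pointwise (fromℚ (p ℚ.* q)) (fromℚ p *ᵣ fromℚ q) (λ _ → ≡.refl)
    ; fromℚ-0      = pointwise (fromℚ 0ℚ) (fromℕ 0) (λ _ → ≡.refl)
    ; fromℚ-1      = pointwise (fromℚ 1ℚ) (fromℕ 1) (λ _ → ≡.refl)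
    ; fromℚ-mono-< = λ {p} {q} → fromℚ-mono p q
    ; archimedean  = ᵣ-archimedean
    ; <-gap        = λ {x} {y} → <ᵣ-gap x y
    ; complete     = λ s s-cauchy → Completeness.limit s s-cauchy , Completeness.limit-correct s s-cauchy
    }

open CauchyReals

-- Passage between the complex matrices of `PSTAt` and the real analysis.

module A = Analysis ℝ-line

-- With these definitions the types below unfold syntactically to those in PSTAt; spelled out, they would make
-- conversion compare proofs of the Cauchy property.

applyᶜ : ∀ {n} → Matrixᶜ.Matrix n → (Fin n → ℂ) → Fin n → ℂ
applyᶜ E v j = (E Matrixᶜ.⊗ᵛ v) j

column : ∀ {n} → Matrixᶜ.Matrix n → Fin n → Fin n → ℂ
column E a j = (E Matrixᶜ.⊗ᵛ Matrixᶜ.basis a) j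

multiple : ∀ {n} → ℂ → Fin n → Fin n → ℂ
multiple γ b j = γ *ᶜ Matrixᶜ.basis b j

re-sum : ∀ n (f : Fin n → ℂ) (g : Fin n → ℝ) → (∀ i → re (f i) ≈ᵣ g i) → re (sumᶜ f) ≈ᵣ A.sum g
re-sum zero    f g f≈g = pointwise (fromℕ 0) (fromℕ 0) (λ _ → ≡.refl)
re-sum (suc n) f g f≈g = +ᵣ-cong (re (f zero)) (g zero) (re (sumᶜ (λ i → f (suc i)))) (A.sum (λ i → g (suc i)))
  (f≈g zero) (re-sum n (λ i → f (suc i)) (λ i → g (suc i)) (λ i → f≈g (suc i)))

im-sum : ∀ n (f : Fin n → ℂ) (g : Fin n → ℝ) → (∀ i → im (f i) ≈ᵣ g i) → im (sumᶜ f) ≈ᵣ A.sum g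
im-sum zero    f g f≈g = pointwise (fromℕ 0) (fromℕ 0) (λ _ → ≡.refl)
im-sum (suc n) f g f≈g = +ᵣ-cong (im (f zero)) (g zero) (im (sumᶜ (λ i → f (suc i)))) (A.sum (λ i → g (suc i)))
  (f≈g zero) (im-sum n (λ i → f (suc i)) (λ i → g (suc i)) (λ i → f≈g (suc i)))

to-limit : ∀ (s t : ℕ → ℝ) l → (∀ N → s N ≈ᵣ t N) → s HasLimit l → t A.⟶ l
to-limit s t l s≈t s⟶l = A.⟶-resp {s} {t} {l} {l} s≈t (pointwise l l (λ _ → ≡.refl)) (A.HasLimit⇒⟶ {s} {l} s⟶l)

from-limit : ∀ (s t : ℕ → ℝ) l → (∀ N → s N ≈ᵣ t N) → s A.⟶ l → t HasLimit l
from-limit s t l s≈t s⟶l = A.⟶⇒HasLimit {t} {l} (A.⟶-resp {s} {t} {l} {l} s≈t (pointwise l l (λ _ → ≡.refl)) s⟶l)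

sinTerm : ℝ → ℕ → ℝ
sinTerm x k = ((-ᵣ fromℕ 1) ^ᵣ k) *ᵣ (inverseFactorial (2 ℕ.* k ℕ.+ 1) *ᵣ (x ^ᵣ (2 ℕ.* k ℕ.+ 1)))

sineTerm≈ : ∀ x k → A.sineTerm x k ≈ᵣ sinTerm x k
sineTerm≈ x k ε 0<ε = pointwise (A.sineTerm x k) (sinTerm x k) (λ _ → ≡.refl) ε 0<ε

sineSum≈ : ∀ x N → A.sineSum x N ≈ᵣ sumᵣ {N} (λ k → sinTerm x (toℕ k))
sineSum≈ x N = A.sineSum≈sum x N (λ k → sinTerm x (toℕ k)) (λ k → sineTerm≈ x (toℕ k))

isSin : ∀ x s → A.sin x ≈ᵣ s → IsSin x s
isSin x s sin≈s = from-limit (A.sineSum x) (λ N → sumᵣ {N} (λ k → sinTerm x (toℕ k))) s (sineSum≈ x) (A.sineSum-limit {x} {s} sin≈s)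

isSin⇒sin : ∀ x s → IsSin x s → A.sin x ≈ᵣ s
isSin⇒sin x s sine = A.sineSum-unique {x} {s} (to-limit (λ N → sumᵣ {N} (λ k → sinTerm x (toℕ k))) (A.sineSum x) s
  (λ N → ≈ᵣ-sym (A.sineSum x N) (sumᵣ {N} (λ k → sinTerm x (toℕ k))) (sineSum≈ x N)) sine)

isPi : ∀ {p r} → A.Constants p r → IsPi p
isPi {p} c = (A.Constants.p-positive c , isSin p (fromℕ 0) (A.Constants.sin-p c)) ,
  λ s h → A.Constants.p-least c s (proj₁ h) (isSin⇒sin s (fromℕ 0) (proj₂ h))

isSqrt : ∀ {p r} → A.Constants p r → IsSqrt (fromℕ 2) r
isSqrt c = A.Constants.r-nonneg c , A.Constants.r²≈2 c

bit : Bool → ℂ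
bit b = if b then ofℝ (fromℕ 1) else ofℝ (fromℕ 0)

indicator : Bool → ℝ
indicator b = if b then fromℕ 1 else fromℕ 0

re-if : ∀ b → re (bit b) ≈ᵣ indicator b
re-if true  = pointwise (fromℕ 1) (fromℕ 1) (λ _ → ≡.refl)
re-if false = pointwise (fromℕ 0) (fromℕ 0) (λ _ → ≡.refl)

im-if : ∀ b → im (bit b) ≈ᵣ fromℕ 0
im-if true  = pointwise (fromℕ 0) (fromℕ 0) (λ _ → ≡.refl)
im-if false = pointwise (fromℕ 0) (fromℕ 0) (λ _ → ≡.refl)

open ℚ-Solver.+-*-Solver using (solve; _:=_; _:+_; _:*_; _:-_; :-_; con)

re-*-if : ∀ z b → re (z *ᶜ bit b) ≈ᵣ re z *ᵣ indicator b
re-*-if z true  = pointwise (re (z *ᶜ bit true)) (re z *ᵣ indicator true) (λ n →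
  solve 2 (λ r i → r :* con 1ℚ :- i :* con 0ℚ := r :* con 1ℚ) ≡.refl (seq (re z) n) (seq (im z) n))
re-*-if z false = pointwise (re (z *ᶜ bit false)) (re z *ᵣ indicator false) (λ n →
  solve 2 (λ r i → r :* con 0ℚ :- i :* con 0ℚ := r :* con 0ℚ) ≡.refl (seq (re z) n) (seq (im z) n))

im-*-if : ∀ z b → im (z *ᶜ bit b) ≈ᵣ im z *ᵣ indicator b
im-*-if z true  = pointwise (im (z *ᶜ bit true)) (im z *ᵣ indicator true) (λ n →
  solve 2 (λ r i → r :* con 0ℚ :+ i :* con 1ℚ := i :* con 1ℚ) ≡.refl (seq (re z) n) (seq (im z) n))
im-*-if z false = pointwise (im (z *ᶜ bit false)) (im z *ᵣ indicator false) (λ n →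
  solve 2 (λ r i → r :* con 0ℚ :+ i :* con 0ℚ := i :* con 0ℚ) ≡.refl (seq (re z) n) (seq (im z) n))

adjacency²≈ : ∀ n i j → pathAdjacency² n i j ≈ᵣ A.adjacency² n i j
adjacency²≈ n i j = A.adjacency²-unfold n i j g h
    (λ k l → pointwise (h k l) (A.adjacency n k l A.* A.Mat.basis j l) (λ _ → ≡.refl))
    (λ k → pointwise (g k) (A.adjacency n i k A.* A.sum (h k)) (λ _ → ≡.refl))
  where
  -- Again the form to which pathAdjacency² unfolds.
  h : Fin n → Fin n → ℝ
  h k l = RawSemiring._*_ (RawRing.rawSemiring ℝ-rawRing) (pathAdjacency n k l)
    (Matrices._^ᴹ_ (RawRing.rawSemiring ℝ-rawRing) (pathAdjacency n) 0 l j)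
  g : Fin n → ℝ
  g k = RawSemiring._*_ (RawRing.rawSemiring ℝ-rawRing) (pathAdjacency n i k)
    (Matrices._^ᴹ_ (RawRing.rawSemiring ℝ-rawRing) (pathAdjacency n) 1 k j)

module Exponential (n : ℕ) (τ : ℝ) where
  X : Matrixᶜ.Matrix n
  X = generator τ (pathAdjacency² n)

  K : Matrixᵣ.Matrix n
  K = pathAdjacency² n

  re-X : ∀ i j → re (X i j) ≈ᵣ fromℕ 0
  re-X i j = pointwise (re (X i j)) (fromℕ 0) (λ m →
    solve 2 (λ t k → (:- (con 0ℚ :* t :- con 1ℚ :* con 0ℚ)) :* k :- (:- (con 0ℚ :* con 0ℚ :+ con 1ℚ :* t)) :* con 0ℚ := con 0ℚ) ≡.refl (seq τ m) (seq (K i j) m))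

  im-X : ∀ i j → im (X i j) ≈ᵣ A.- (τ A.* A.adjacency² n i j)
  im-X i j = ≈ᵣ-trans (im (X i j)) (-ᵣ (τ *ᵣ K i j)) (A.- (τ A.* A.adjacency² n i j))
    (pointwise (im (X i j)) (-ᵣ (τ *ᵣ K i j)) (λ m →
      solve 2 (λ t k → (:- (con 0ℚ :* t :- con 1ℚ :* con 0ℚ)) :* con 0ℚ :+ (:- (con 0ℚ :* con 0ℚ :+ con 1ℚ :* t)) :* k := :- (t :* k)) ≡.refl (seq τ m) (seq (K i j) m)))
    (-ᵣ-cong (τ *ᵣ K i j) (τ *ᵣ A.adjacency² n i j) (*ᵣ-congˡ τ (K i j) (A.adjacency² n i j) (adjacency²≈ n i j)))

  R I : ℕ → Matrixᵣ.Matrix n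
  R k i j = re ((X Matrixᶜ.^ᴹ k) i j)
  I k i j = im ((X Matrixᶜ.^ᴹ k) i j)

  R-zero : ∀ i j → R 0 i j ≈ᵣ A.Mat.basis j i
  R-zero i j = re-if (does (i Fin.≟ j))

  I-zero : ∀ i j → I 0 i j ≈ᵣ fromℕ 0
  I-zero i j = im-if (does (i Fin.≟ j))

  summand : ℕ → Fin n → Fin n → Fin n → ℂ
  summand k i j l = RawSemiring._*_ (RawRing.rawSemiring ℂ-rawRing) (X i l) (Matrices._^ᴹ_ (RawRing.rawSemiring ℂ-rawRing) X k l j)

  R-suc : ∀ k i j → Σ (Fin n → ℝ) λ g → R (suc k) i j ≈ᵣ A.sum g ×
    (∀ l → g l ≈ᵣ re (X i l) A.* R k l j A.- im (X i l) A.* I k l j)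
  R-suc k i j = (λ l → re (summand k i j l)) ,
    re-sum n (summand k i j) (λ l → re (summand k i j l)) (λ l → pointwise (re (summand k i j l)) (re (summand k i j l)) (λ _ → ≡.refl)) ,
    (λ l → pointwise (re (summand k i j l)) (re (X i l) A.* R k l j A.- im (X i l) A.* I k l j) (λ _ → ≡.refl))

  I-suc : ∀ k i j → Σ (Fin n → ℝ) λ g → I (suc k) i j ≈ᵣ A.sum g ×
    (∀ l → g l ≈ᵣ re (X i l) A.* I k l j A.+ im (X i l) A.* R k l j)
  I-suc k i j = (λ l → im (summand k i j l)) ,
    im-sum n (summand k i j) (λ l → im (summand k i j l)) (λ l → pointwise (im (summand k i j l)) (im (summand k i j l)) (λ _ → ≡.refl)) ,
    (λ l → pointwise (im (summand k i j l)) (re (X i l) A.* I k l j A.+ im (X i l) A.* R k l j) (λ _ → ≡.refl))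

  term : ℕ → Fin n → Fin n → ℂ
  term k i j = ofℝ (inverseFactorial k) *ᶜ (generator τ (pathAdjacency² n) Matrixᶜ.^ᴹ k) i j

  partial : ℕ → Matrixᶜ.Matrix n
  partial N i j = sumᶜ {N} (λ k → ofℝ (inverseFactorial (toℕ k)) *ᶜ (generator τ (pathAdjacency² n) Matrixᶜ.^ᴹ toℕ k) i j)

  S T : ℕ → Matrixᵣ.Matrix n
  S N i j = re (partial N i j)
  T N i j = im (partial N i j)

  S≈ : ∀ N i j → Σ (Fin N → ℝ) λ g → S N i j ≈ᵣ A.sum g × (∀ k → g k ≈ᵣ A.inverseFactorial (toℕ k) A.* R (toℕ k) i j)
  S≈ N i j = (λ k → re (term (toℕ k) i j)) ,
    re-sum N (λ k → ofℝ (inverseFactorial (toℕ k)) *ᶜ (generator τ (pathAdjacency² n) Matrixᶜ.^ᴹ toℕ k) i j) (λ k → re (term (toℕ k) i j))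
      (λ k → pointwise (re (term (toℕ k) i j)) (re (term (toℕ k) i j)) (λ _ → ≡.refl)) ,
    (λ k → pointwise (re (term (toℕ k) i j)) (A.inverseFactorial (toℕ k) A.* R (toℕ k) i j) (λ m →
      solve 3 (λ f r s → f :* r :- con 0ℚ :* s := f :* r) ≡.refl (seq (inverseFactorial (toℕ k)) m) (seq (R (toℕ k) i j) m) (seq (I (toℕ k) i j) m)))

  T≈ : ∀ N i j → Σ (Fin N → ℝ) λ g → T N i j ≈ᵣ A.sum g × (∀ k → g k ≈ᵣ A.inverseFactorial (toℕ k) A.* I (toℕ k) i j)
  T≈ N i j = (λ k → im (term (toℕ k) i j)) ,
    im-sum N (λ k → ofℝ (inverseFactorial (toℕ k)) *ᶜ (generator τ (pathAdjacency² n) Matrixᶜ.^ᴹ toℕ k) i j) (λ k → im (term (toℕ k) i j))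
      (λ k → pointwise (im (term (toℕ k) i j)) (im (term (toℕ k) i j)) (λ _ → ≡.refl)) ,
    (λ k → pointwise (im (term (toℕ k) i j)) (A.inverseFactorial (toℕ k) A.* I (toℕ k) i j) (λ m →
      solve 3 (λ f r s → f :* s :+ con 0ℚ :* r := f :* s) ≡.refl (seq (inverseFactorial (toℕ k)) m) (seq (R (toℕ k) i j) m) (seq (I (toℕ k) i j) m)))

  module Powers = A.ImaginaryPowers (A.adjacency² n) τ (λ i j → re (X i j)) (λ i j → im (X i j))
    re-X im-X R I R-zero I-zero R-suc I-suc S T S≈ T≈

  re-⊗ᵛ : ∀ (E : Matrixᶜ.Matrix n) (v : Fin n → ℂ) j (g : Fin n → ℝ) → (∀ k → re (E j k *ᶜ v k) ≈ᵣ g k) →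
    re (applyᶜ E v j) ≈ᵣ A.sum g
  re-⊗ᵛ E v j g = re-sum n (λ k → RawSemiring._*_ (RawRing.rawSemiring ℂ-rawRing) (E j k) (v k)) g

  re-column : ∀ (E : Matrixᶜ.Matrix n) a j → re (column E a j) ≈ᵣ re (E j a)
  re-column E a j = ≈ᵣ-trans (re (column E a j)) (A.sum g) (re (E j a))
      (re-⊗ᵛ E (Matrixᶜ.basis a) j g (λ k → re-*-if (E j k) (does (k Fin.≟ a))))
      (A.sum-pick a (λ k → re (E j k)) g (λ k → pointwise (g k) (re (E j k) A.* A.Mat.basis a k) (λ _ → ≡.refl)))
    where
    g : Fin n → ℝ
    g k = re (E j k) *ᵣ indicator (does (k Fin.≟ a))

  im-⊗ᵛ : ∀ (E : Matrixᶜ.Matrix n) (v : Fin n → ℂ) j (g : Fin n → ℝ) → (∀ k → im (E j k *ᶜ v k) ≈ᵣ g k) →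
    im (applyᶜ E v j) ≈ᵣ A.sum g
  im-⊗ᵛ E v j g = im-sum n (λ k → RawSemiring._*_ (RawRing.rawSemiring ℂ-rawRing) (E j k) (v k)) g

  im-column : ∀ (E : Matrixᶜ.Matrix n) a j → im (column E a j) ≈ᵣ im (E j a)
  im-column E a j = ≈ᵣ-trans (im (column E a j)) (A.sum g) (im (E j a))
      (im-⊗ᵛ E (Matrixᶜ.basis a) j g (λ k → im-*-if (E j k) (does (k Fin.≟ a))))
      (A.sum-pick a (λ k → im (E j k)) g (λ k → pointwise (g k) (im (E j k) A.* A.Mat.basis a k) (λ _ → ≡.refl)))
    where
    g : Fin n → ℝ
    g k = im (E j k) *ᵣ indicator (does (k Fin.≟ a))

  re-multiple : ∀ γ (b j : Fin n) → re (multiple γ b j) ≈ᵣ re γ *ᵣ A.Mat.basis b j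
  re-multiple γ b j = re-*-if γ (does (j Fin.≟ b))

  im-multiple : ∀ γ (b j : Fin n) → im (multiple γ b j) ≈ᵣ im γ *ᵣ A.Mat.basis b j
  im-multiple γ b j = im-*-if γ (does (j Fin.≟ b))

  PSTAt⇒complex : ∀ a b → PSTAt (pathAdjacency² n) a b τ → Powers.ComplexTransfer a b
  PSTAt⇒complex a b (0<τ , E , exponential , γ , (_ , modulus) , transfer) = record
    { positive = 0<τ
    ; P        = λ i j → re (E i j)
    ; Q        = λ i j → im (E i j)
    ; P-limit  = λ i j → proj₁ (exponential i j)
    ; Q-limit  = λ i j → proj₂ (exponential i j)
    ; g        = re γ
    ; h        = im γ
    ; unit     = modulus
    ; P-column = λ j → ≈ᵣ-trans (re (E j a)) (re (column E a j)) (re γ *ᵣ A.Mat.basis b j)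
        (≈ᵣ-sym (re (column E a j)) (re (E j a)) (re-column E a j))
        (≈ᵣ-trans (re (column E a j)) (re (multiple γ b j)) (re γ *ᵣ A.Mat.basis b j)
          (proj₁ (transfer j)) (re-multiple γ b j))
    ; Q-column = λ j → ≈ᵣ-trans (im (E j a)) (im (column E a j)) (im γ *ᵣ A.Mat.basis b j)
        (≈ᵣ-sym (im (column E a j)) (im (E j a)) (im-column E a j))
        (≈ᵣ-trans (im (column E a j)) (im (multiple γ b j)) (im γ *ᵣ A.Mat.basis b j)
          (proj₂ (transfer j)) (im-multiple γ b j))
    }

  complex⇒PSTAt : ∀ a b → Powers.ComplexTransfer a b → PSTAt (pathAdjacency² n) a b τ
  complex⇒PSTAt a b C = C.positive , E , (λ i j → C.P-limit i j , C.Q-limit i j) , γ , (A.<⇒≤ {fromℕ 0} {fromℕ 1} A.0<1 , C.unit) , λ j →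
      ≈ᵣ-trans (re (column E a j)) (C.P j a) (re (multiple γ b j)) (re-column E a j)
        (≈ᵣ-trans (C.P j a) (C.g *ᵣ A.Mat.basis b j) (re (multiple γ b j)) (C.P-column j)
          (≈ᵣ-sym (re (multiple γ b j)) (C.g *ᵣ A.Mat.basis b j) (re-multiple γ b j))) ,
      ≈ᵣ-trans (im (column E a j)) (C.Q j a) (im (multiple γ b j)) (im-column E a j)
        (≈ᵣ-trans (C.Q j a) (C.h *ᵣ A.Mat.basis b j) (im (multiple γ b j)) (C.Q-column j)
          (≈ᵣ-sym (im (multiple γ b j)) (C.h *ᵣ A.Mat.basis b j) (im-multiple γ b j)))
    where
    module C = Powers.ComplexTransfer C
    E : Matrixᶜ.Matrix n
    E i j = C.P i j +i C.Q i j
    γ : ℂ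
    γ = C.g +i C.h

PSTAt⇒transfer : ∀ n a b τ → PSTAt (pathAdjacency² n) a b τ → A.PathTransfer n a b τ
PSTAt⇒transfer n a b τ pst = Exponential.Powers.complex⇒transferAt n τ (Exponential.PSTAt⇒complex n τ a b pst)

transfer⇒PSTAt : ∀ n a b τ → A.PathTransfer n a b τ → PSTAt (pathAdjacency² n) a b τ
transfer⇒PSTAt n a b τ T = Exponential.complex⇒PSTAt n τ a b (Exponential.Powers.transferAt⇒complex n τ T)

least-time : ∀ n (a b : Fin n) p d → A.LeastTransferTime a b p d → LeastTimeIsQuotient (pathAdjacency² n) a b p d
least-time n a b p d (τ , (T , least) , τd≈p) =
  τ , (transfer⇒PSTAt n a b τ T , λ s pst → least s (PSTAt⇒transfer n a b s pst)) , τd≈p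

transfer-exists : ∀ n (a b : Fin n) p d → LeastTimeIsQuotient (pathAdjacency² n) a b p d → PST (pathAdjacency² n) a b
transfer-exists n a b p d (τ , (pst , _) , _) = τ , pst

theorem5p11 : ∃[ π ] ∃[ √2 ] IsPi π × IsSqrt (fromℕ 2) √2 ×
    (∀ (n : ℕ) → 2 ≤ n → (a b : Fin n) → a ≢ b →
    (PST (pathAdjacency² n) a b ⇔
    (IsTriple 3 1 3 n a b ⊎ IsTriple 5 2 4 n a b ⊎ IsTriple 7 2 6 n a b)) ×
    (IsTriple 3 1 3 n a b →
    LeastTimeIsQuotient (pathAdjacency² n) a b π (fromℕ 2)) ×
    (IsTriple 5 2 4 n a b →
    LeastTimeIsQuotient (pathAdjacency² n) a b π (fromℕ 2)) ×
    (IsTriple 7 2 6 n a b →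
    LeastTimeIsQuotient (pathAdjacency² n) a b π √2))
theorem5p11 = from-constants A.constants
  where
  from-constants : (∃[ p ] ∃[ r ] A.Constants p r) → _
  from-constants (p , r , c) = p , r , isPi c , isSqrt c , λ n _ a b a≢b →
    mk⇔ (λ (τ , pst) → A.pathTransfer⇒exceptional n a b τ a≢b (PSTAt⇒transfer n a b τ pst))
        (λ { (inj₁ t) → transfer-exists n a b p (fromℕ 2) (at-3 n a b t)
           ; (inj₂ (inj₁ t)) → transfer-exists n a b p (fromℕ 2) (at-5 n a b t)
           ; (inj₂ (inj₂ t)) → transfer-exists n a b p r (at-7 n a b t) }) ,
    at-3 n a b , at-5 n a b , at-7 n a b
    where
    at-3 : ∀ n a b → IsTriple 3 1 3 n a b → LeastTimeIsQuotient (pathAdjacency² n) a b p (fromℕ 2)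
    at-3 n a b t = least-time n a b p (fromℕ 2) (A.Constants.least-3 c a b t)
    at-5 : ∀ n a b → IsTriple 5 2 4 n a b → LeastTimeIsQuotient (pathAdjacency² n) a b p (fromℕ 2)
    at-5 n a b t = least-time n a b p (fromℕ 2) (A.Constants.least-5 c a b t)
    at-7 : ∀ n a b → IsTriple 7 2 6 n a b → LeastTimeIsQuotient (pathAdjacency² n) a b p r
    at-7 n a b t = least-time n a b p r (A.Constants.least-7 c a b t)
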